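{- Let $k$ and $\ell$ be two integers such that $k>3$ and $\ell \in \{2,\ldots,k-2\}$. The graph $C_{k,\ell}$ is balanceable if and only if $k$ is even and $(k,\ell) \notin \{(6,2),(6,4)\}$.
   Context: All graphs are simple and finite. For integers $k>3$ and $\ell\in\{2,\ldots,k-2\}$, $C_{k,\ell}$ is the simple graph with vertices $u_0,\ldots,u_{k-1}$ in which, for every $i$, $u_i$ is adjacent to $u_{i+1}$ and to $u_{i+\ell}$ (indices modulo $k$); that is, the cycle $C_k$ with all chords $u_iu_{i+\ell}$ added (so $C_{k,\ell}=C_{k,k-\ell}$). A 2-coloring of the edges of $K_n$ is a function $\alpha:E(K_n)\to\{R,B\}$. It contains a balanced copy of a graph $G$ if $K_n$ has a (not necessarily induced) subgraph isomorphic to $G$ whose edge set is partitioned into $E_1,E_2$ with $\alpha(e)=R$ for $e\in E_1$, $\alpha(e)=B$ for $e\in E_2$, and $\big||E_1|-|E_2|\big|\le 1$. A graph $G$ is balanceable if there is an $n_0$ such that for every $n\ge n_0$ there exists an integer $m$ with $0\le m<\lfloor \frac12\binom n2\rfloor$ such that every 2-coloring $\alpha$ of $E(K_n)$ with $|\alpha^{ -1}(R)|>m$ and $|\alpha^{ -1}(B)|>m$ contains a balanced copy of $G$. -}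

module Defs where

open import Data.Fin using (Fin; toℕ)
open import Data.Fin.Properties using (toℕ-fromℕ<; _≟_; _<?_)
open import Data.List using (List; length; filter; cartesianProduct; allFin)
open import Data.Nat
  using (ℕ; zero; suc; _+_; _*_; _∸_; _≤_; _<_; _>_; _≥_; z≤n; s≤s; ∣_-_∣; ⌊_/2⌋; NonZero; >-nonZero)
open import Data.Nat.Combinatorics using (_C_)
open import Data.Nat.Divisibility using (divides; ∣⇒≤)
open import Data.Nat.DivMod using (_%_; _/_; _mod_; m≡m%n+[m/n]*n; m%n<n)
open import Data.Nat.Properties using (+-cancelˡ-≡; <⇒≱; m<n⇒0<n; ≤-trans; ≤-<-trans; m<n+m)
open import Data.Product using (Σ-syntax; _×_; _,_; ∃-syntax)
open import Data.Sum using (_⊎_; inj₁; inj₂; swap)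
open import Function using (_on_)
open import Function.Definitions using (Injective)
open import Level using (0ℓ)
open import Relation.Binary.Core using (Rel)
open import Relation.Binary.Definitions using (Decidable; DecidableEquality; Symmetric; Irreflexive)
open import Relation.Binary.PropositionalEquality using (_≡_; _≢_; refl; sym; trans; cong; ≢-sym)
open import Relation.Nullary using (yes; no; ¬_)
open import Relation.Nullary.Decidable using (¬?; _×-dec_; _⊎-dec_)

record Graph (n : ℕ) : Set₁ where
  field
    Adj    : Rel (Fin n) 0ℓ
    adj?   : Decidable Adj
    symm   : Symmetric Adj
    irrefl : Irreflexive _≡_ Adj

open Graph public

-- The edge {u, v} is represented once, by the pair (u , v) with u < v.
edges : ∀ {n} → Graph n → List (Fin n × Fin n)
edges {n} G =
  filter (λ (u , v) → u <? v ×-dec adj? G u v) (cartesianProduct (allFin n) (allFin n))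

K : ∀ n → Graph n
K n = record
  { Adj    = _≢_
  ; adj?   = λ u v → ¬? (u ≟ v)
  ; symm   = ≢-sym
  ; irrefl = λ u≡v u≢v → u≢v u≡v
  }

data Colour : Set where
  R B : Colour

_≟ᶜ_ : DecidableEquality Colour
R ≟ᶜ R = yes refl
R ≟ᶜ B = no λ ()
B ≟ᶜ R = no λ ()
B ≟ᶜ B = yes refl

-- A 2-coloring of E(Kₙ). The values on the diagonal carry no meaning: colors
-- are only ever counted along edges of a graph.
record Colouring (n : ℕ) : Set where
  field
    colour      : Fin n → Fin n → Colour
    colour-symm : ∀ u v → colour u v ≡ colour v u

open Colouring public

#edges : ∀ {n} → Graph n → (Fin n → Fin n → Colour) → Colour → ℕ
#edges G α c = length (filter (λ (u , v) → α u v ≟ᶜ c) (edges G))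

-- A not necessarily induced subgraph of H isomorphic to G, given by the
-- isomorphism from G onto it.
record Copy {k n} (G : Graph k) (H : Graph n) : Set where
  field
    to        : Fin k → Fin n
    injective : Injective _≡_ _≡_ to
    preserves : ∀ {u v} → Adj G u v → Adj H (to u) (to v)

open Copy public

-- The color of an edge of the copy is read off at the corresponding edge of G.
-- The parts E₁, E₂ are forced to be the red and the blue edges of the copy.
BalancedCopy : ∀ {k n} → Graph k → Colouring n → Set
BalancedCopy {n = n} G α =
  Σ[ f ∈ Copy G (K n) ]
    ∣ #edges G (colour α on to f) R - #edges G (colour α on to f) B ∣ ≤ 1

Balanceable : ∀ {k} → Graph k → Set
Balanceable G =
  ∃[ n₀ ] ∀ n → n ≥ n₀ →
    ∃[ m ] m < ⌊ n C 2 /2⌋ ×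
      ((α : Colouring n) →
        #edges (K n) (colour α) R > m →
        #edges (K n) (colour α) B > m →
        BalancedCopy G α)

shift : ∀ {k} .{{_ : NonZero k}} → ℕ → Fin k → Fin k
shift {k} d i = (toℕ i + d) mod k

shift-irrefl : ∀ {k} .{{_ : NonZero k}} {d} → 0 < d → d < k → (i : Fin k) → i ≢ shift d i
shift-irrefl {k} {d@(suc _)} _ d<k i i≡ = <⇒≱ d<k (∣⇒≤ (divides q d≡qk))
  where
  q = (toℕ i + d) / k
  i≡% : toℕ i ≡ (toℕ i + d) % k
  i≡% = trans (cong toℕ i≡) (toℕ-fromℕ< (m%n<n (toℕ i + d) k))
  d≡qk : d ≡ q * k
  d≡qk = +-cancelˡ-≡ (toℕ i) d (q * k)
    (trans (m≡m%n+[m/n]*n (toℕ i + d) k) (cong (_+ q * k) (sym i≡%)))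

module _ (k ℓ : ℕ) (k>3 : k > 3) (2≤ℓ : 2 ≤ ℓ) (ℓ≤k-2 : ℓ ≤ k ∸ 2) where
  private
    instance
      k≢0 : NonZero k
      k≢0 = >-nonZero (m<n⇒0<n k>3)

    _↝_ : Rel (Fin k) 0ℓ
    i ↝ j = j ≡ shift 1 i ⊎ j ≡ shift ℓ i

    _↝?_ : Decidable _↝_
    i ↝? j = j ≟ shift 1 i ⊎-dec j ≟ shift ℓ i

    1<k : 1 < k
    1<k = ≤-trans (s≤s (s≤s z≤n)) k>3

    ℓ<k : ℓ < k
    ℓ<k = ≤-<-trans ℓ≤k-2 (∸-lt k>3)
      where
      ∸-lt : ∀ {m} → m > 3 → m ∸ 2 < m
      ∸-lt {suc (suc m)} _ = m<n+m m {2} (s≤s z≤n)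
      ∸-lt {suc zero} (s≤s ())

    ↝-irrefl : ∀ i → ¬ (i ↝ i)
    ↝-irrefl i (inj₁ e) = shift-irrefl (s≤s z≤n) 1<k i e
    ↝-irrefl i (inj₂ e) = shift-irrefl (≤-trans (s≤s z≤n) 2≤ℓ) ℓ<k i e

  chordedCycle : Graph k
  chordedCycle = record
    { Adj    = λ i j → i ↝ j ⊎ j ↝ i
    ; adj?   = λ i j → i ↝? j ⊎-dec j ↝? i
    ; symm   = swap
    ; irrefl = λ { {i} refl (inj₁ p) → ↝-irrefl i p ; {i} refl (inj₂ p) → ↝-irrefl i p }
    }

{-# OPTIONS --safe #-}

-- Since m may be as large as ⌊½ C(n,2)⌋ − 1, only colorings of Kₙ with (almost) equal
-- color classes matter. Ramsey's theorem and the pigeonhole principle yield, in every such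
-- coloring of a large Kₙ, two disjoint k-sets S and T such that S, T and the bipartite graph
-- between them are each monochromatic, but not all in the same color. Placing a set W of
-- vertices of G in S and the others in T (or conversely) gives a balanced copy as soon as G has
-- a set inducing half of its edges and a cut consisting of half of its edges.
--
-- For even k, a set inducing half of the edges of C_{k,ℓ} is an interval [0, w) of the cycle with
-- some of the vertices w+1, w+3, w+5 added (except for two small graphs), and a balanced cut is
-- given by the parity of the index (ℓ even, 2ℓ ≠ k) or by about k/4 vertices with even index and at
-- most one more vertex.
--
-- Conversely, two disjoint red cliques joined by blue edges can be exactly balanced (n a square), but
-- for odd k cuts of the 4-regular graph C_{k,ℓ} are even while half of its 2k edges is odd. A single
-- red clique can be exactly balanced too (a Pell equation), but no set of vertices of the octahedron
-- C_{6,2} = C_{6,4} induces half of its edges.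

module Submission where

open import Defs
open import Data.Bool using (Bool; true; false; not; _∧_; _∨_; _xor_; if_then_else_)
import Data.Bool.Properties as Bool
open import Data.Empty using (⊥)
open import Data.Fin as Fin using (Fin; toℕ; zero; suc)
import Data.Fin.Properties as Fin
open import Data.List using (List; []; _∷_; _++_; length; map; filter; lookup; allFin; downFrom; tabulate; cartesianProduct)
import Data.List.Properties as List
open import Data.List.Membership.Propositional using (_∈_; _∉_)
open import Data.List.Membership.Propositional.Properties using (∈-filter⁻; ∈-lookup)
open import Data.List.Relation.Unary.All as All using (All)
open import Data.List.Relation.Unary.AllPairs as AllPairs using ()
open import Data.List.Relation.Unary.Any using (here; there)
open import Data.List.Relation.Unary.Unique.Propositional using (Unique)
import Data.List.Relation.Unary.Unique.Propositional.Properties as Unique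
open import Data.Nat
open import Data.Nat.Combinatorics using (_C_; nC1≡n; nCk+nC[k+1]≡[n+1]C[k+1])
open import Data.Nat.Divisibility using (_∣_; divides)
open import Data.Nat.DivMod using (_%_; _/_; m%n<n; m≡m%n+[m/n]*n; m<n⇒m%n≡m; [m+n]%n≡m%n; %-distribˡ-+; m%n%n≡m%n)
open import Data.Nat.Properties
open import Data.Nat.Tactic.RingSolver using (solve; solve-∀)
open import Data.Product using (_×_; _,_; proj₁; proj₂; ∃-syntax; Σ-syntax)
open import Data.Sum using (_⊎_; inj₁; inj₂; [_,_]′)
open import Data.Unit using (⊤; tt)
open import Data.Vec as Vec using (Vec)
import Data.Vec.Properties as Vec
open import Function using (_∘_; _on_)
open import Function.Bundles using (_⇔_; mk⇔)
open import Level using (0ℓ)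
open import Relation.Binary.Definitions using (tri<; tri≈; tri>)
open import Relation.Binary.PropositionalEquality
open import Relation.Nullary using (Dec; yes; no; does; ¬_; contradiction)
open import Relation.Nullary.Decidable using (from-yes; map′; dec-true; dec-false; does-⇔; _×-dec_; ¬?)
open import Relation.Unary using (Pred; Decidable)

-- Ramsey's theorem alone might return cliques of one color only. Degrees bring in the other color:
-- each color d has about half of all edges, so roughly a quarter of the vertices or more have at
-- least n/4 neighbors in color d. A large clique of the wrong color among these has so many edges
-- of color d that many vertices see a large part of it in color d. Without such cliques there are a
-- red and a blue one, and the color between them differs from one of theirs. Let ℓ < k/2. The
-- interval [0, w) has w - 1 cycle edges and w - ℓ and w - (k - ℓ) chords of the two kinds, each
-- truncated at 0. Its count grows by 2 per vertex beyond ℓ and by 3 beyond k - ℓ, so it can jump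
-- over the target k. The vertices w+1, w+3, w+5 have no cycle neighbor in the set, hence add only 1
-- or 2 edges each and correct the count. If ℓ is too small their chords miss the interval; this
-- leaves C_{8,2} and C_{12,4}, treated by explicit sets, and C_{6,2}, the true exception.

private variable
  X Y : Set

-- Finite sums and edge counts

∑ : List X → (X → ℕ) → ℕ
∑ []       f = 0
∑ (x ∷ xs) f = f x + ∑ xs f

infixr 8 ∑
syntax ∑ xs (λ x → e) = ∑[ x ∈ xs ] e

bit : Bool → ℕ
bit b = if b then 1 else 0

∑-cong∈ : (xs : List X) {f g : X → ℕ} → (∀ {x} → x ∈ xs → f x ≡ g x) → ∑ xs f ≡ ∑ xs g
∑-cong∈ []       f≗g = refl
∑-cong∈ (x ∷ xs) f≗g = cong₂ _+_ (f≗g (here refl)) (∑-cong∈ xs (f≗g ∘ there))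

∑-cong : (xs : List X) {f g : X → ℕ} → (∀ x → f x ≡ g x) → ∑ xs f ≡ ∑ xs g
∑-cong xs f≗g = ∑-cong∈ xs (λ {x} _ → f≗g x)

∑-mono∈ : (xs : List X) {f g : X → ℕ} → (∀ {x} → x ∈ xs → f x ≤ g x) → ∑ xs f ≤ ∑ xs g
∑-mono∈ []       f≤g = z≤n
∑-mono∈ (x ∷ xs) f≤g = +-mono-≤ (f≤g (here refl)) (∑-mono∈ xs (f≤g ∘ there))

∑-mono : (xs : List X) {f g : X → ℕ} → (∀ x → f x ≤ g x) → ∑ xs f ≤ ∑ xs g
∑-mono xs f≤g = ∑-mono∈ xs (λ {x} _ → f≤g x)

∑-+ : (xs : List X) (f g : X → ℕ) → ∑[ x ∈ xs ] (f x + g x) ≡ ∑ xs f + ∑ xs g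
∑-+ []       f g = refl
∑-+ (x ∷ xs) f g rewrite ∑-+ xs f g = interchange (f x) (g x) (∑ xs f) (∑ xs g)
  where
  interchange : ∀ a b c d → a + b + (c + d) ≡ a + c + (b + d)
  interchange = solve-∀

∑-*ˡ : (xs : List X) (c : ℕ) (f : X → ℕ) → ∑[ x ∈ xs ] (c * f x) ≡ c * ∑ xs f
∑-*ˡ []       c f = sym (*-zeroʳ c)
∑-*ˡ (x ∷ xs) c f = trans (cong (c * f x +_) (∑-*ˡ xs c f)) (sym (*-distribˡ-+ c (f x) (∑ xs f)))

∑-*ʳ : (xs : List X) (c : ℕ) (f : X → ℕ) → ∑[ x ∈ xs ] (f x * c) ≡ ∑ xs f * c
∑-*ʳ xs c f = trans (∑-cong xs (λ x → *-comm (f x) c)) (trans (∑-*ˡ xs c f) (*-comm c (∑ xs f)))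

∑-const : (xs : List X) (c : ℕ) → ∑[ _ ∈ xs ] c ≡ length xs * c
∑-const []       c = refl
∑-const (x ∷ xs) c = cong (c +_) (∑-const xs c)

∑-swap : (xs : List X) (ys : List Y) (f : X → Y → ℕ) →
  ∑[ x ∈ xs ] (∑[ y ∈ ys ] f x y) ≡ ∑[ y ∈ ys ] (∑[ x ∈ xs ] f x y)
∑-swap []       ys f = sym (trans (∑-const ys 0) (*-zeroʳ (length ys)))
∑-swap (x ∷ xs) ys f =
  trans (cong (∑ ys (f x) +_) (∑-swap xs ys f)) (sym (∑-+ ys (f x) (λ y → ∑[ x′ ∈ xs ] f x′ y)))

∑-++ : (xs ys : List X) (f : X → ℕ) → ∑ (xs ++ ys) f ≡ ∑ xs f + ∑ ys f
∑-++ []       ys f = refl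
∑-++ (x ∷ xs) ys f = trans (cong (f x +_) (∑-++ xs ys f)) (sym (+-assoc (f x) _ _))

∑-map : (xs : List X) (g : X → Y) (f : Y → ℕ) → ∑ (map g xs) f ≡ ∑ xs (f ∘ g)
∑-map []       g f = refl
∑-map (x ∷ xs) g f = cong (f (g x) +_) (∑-map xs g f)

∑-cartesianProduct : (xs : List X) (ys : List Y) (f : X × Y → ℕ) →
  ∑ (cartesianProduct xs ys) f ≡ ∑[ x ∈ xs ] (∑[ y ∈ ys ] f (x , y))
∑-cartesianProduct []       ys f = refl
∑-cartesianProduct (x ∷ xs) ys f =
  trans (∑-++ (map (x ,_) ys) _ f) (cong₂ _+_ (∑-map ys (x ,_) f) (∑-cartesianProduct xs ys f))

module _ {P : Pred X 0ℓ} (P? : Decidable P) where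

  ∑-filter : (xs : List X) (f : X → ℕ) →
    ∑ (filter P? xs) f ≡ ∑[ x ∈ xs ] (bit (does (P? x)) * f x)
  ∑-filter []       f = refl
  ∑-filter (x ∷ xs) f with does (P? x)
  ... | true  = cong₂ _+_ (sym (*-identityˡ (f x))) (∑-filter xs f)
  ... | false = ∑-filter xs f

  length-filter-∑ : (xs : List X) → length (filter P? xs) ≡ ∑[ x ∈ xs ] bit (does (P? x))
  length-filter-∑ []       = refl
  length-filter-∑ (x ∷ xs) with does (P? x)
  ... | true  = cong suc (length-filter-∑ xs)
  ... | false = length-filter-∑ xs

∑-tabulate : ∀ {n} (g : Fin n → X) (f : X → ℕ) → ∑ (tabulate g) f ≡ ∑ (allFin n) (f ∘ g)
∑-tabulate {n = n} g f =
  trans (cong (λ xs → ∑ xs f) (sym (List.map-tabulate (λ i → i) g))) (∑-map (allFin n) g f)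

∑-suc : ∀ {n} (f : Fin (suc n) → ℕ) → ∑ (allFin (suc n)) f ≡ f zero + ∑ (allFin n) (f ∘ suc)
∑-suc f = cong (f zero +_) (∑-tabulate suc f)

∑-allFin-const : ∀ n c → ∑[ _ ∈ allFin n ] c ≡ n * c
∑-allFin-const n c = trans (∑-const (allFin n) c) (cong (_* c) (List.length-tabulate {n = n} (λ i → i)))

∑-δ : ∀ {n} (w : Fin n) (f : Fin n → ℕ) → ∑[ v ∈ allFin n ] (bit (does (v Fin.≟ w)) * f v) ≡ f w
∑-δ {n = suc n} zero f = trans (∑-suc (λ v → bit (does (v Fin.≟ zero)) * f v))
  (trans (cong₂ _+_ (*-identityˡ (f zero)) (trans (∑-allFin-const n 0) (*-zeroʳ n))) (+-identityʳ (f zero)))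
∑-δ {n = suc n} (suc w) f = trans (∑-suc (λ v → bit (does (v Fin.≟ suc w)) * f v)) (∑-δ w (f ∘ suc))

within crossing : ∀ {k} → (Fin k → Bool) → Fin k → Fin k → Bool
within W u v = W u ∧ W v
crossing W u v = W u xor W v

module _ {k : ℕ} (G : Graph k) where

  private
    V : List (Fin k)
    V = allFin k

  edge : Fin k → Fin k → ℕ
  edge u v = bit (does (adj? G u v))

  count : (Fin k → Fin k → Bool) → ℕ
  count P = ∑[ (u , v) ∈ edges G ] bit (P u v)

  does-adj-sym : ∀ u v → does (adj? G u v) ≡ does (adj? G v u)
  does-adj-sym u v with adj? G v u
  ... | yes v~u = dec-true (adj? G u v) (symm G v~u)
  ... | no  v≁u = dec-false (adj? G u v) (v≁u ∘ symm G)

  edge-sym : ∀ u v → edge u v ≡ edge v u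
  edge-sym u v = cong bit (does-adj-sym u v)

  edge-irrefl : ∀ u → edge u u ≡ 0
  edge-irrefl u = cong bit (dec-false (adj? G u u) (irrefl G refl))

  edges-adj : ∀ {u v} → (u , v) ∈ edges G → Adj G u v
  edges-adj uv∈ = proj₂ (proj₂ (∈-filter⁻ _ {xs = cartesianProduct V V} uv∈))

  count-unfold : ∀ P → count P ≡
    ∑[ u ∈ V ] (∑[ v ∈ V ] (bit (does (u Fin.<? v) ∧ does (adj? G u v)) * bit (P u v)))
  count-unfold P = trans (∑-filter _ (cartesianProduct V V) _) (∑-cartesianProduct V V _)

  count-cong : ∀ {P Q} → (∀ {u v} → Adj G u v → P u v ≡ Q u v) → count P ≡ count Q
  count-cong P≗Q = ∑-cong∈ (edges G) (λ uv∈ → cong bit (P≗Q (edges-adj uv∈)))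

  -- `edges` holds each edge once, smaller endpoint first. Adding the transposed sum covers both
  -- orders, so the order on `Fin k` disappears and counting can proceed by sums over ordered pairs.
  handshake : ∀ P → (∀ u v → P u v ≡ P v u) →
    count P + count P ≡ ∑[ u ∈ V ] (∑[ v ∈ V ] (edge u v * bit (P u v)))
  handshake P P-sym = begin
    count P + count P
      ≡⟨ cong₂ _+_ (count-unfold P) (count-unfold P) ⟩
    ∑[ u ∈ V ] (∑[ v ∈ V ] e u v) + ∑[ u ∈ V ] (∑[ v ∈ V ] e u v)
      ≡⟨ cong (∑[ u ∈ V ] (∑[ v ∈ V ] e u v) +_) (∑-swap V V e) ⟩
    ∑[ u ∈ V ] (∑[ v ∈ V ] e u v) + ∑[ v ∈ V ] (∑[ u ∈ V ] e u v)
      ≡⟨ ∑-+ V _ _ ⟨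
    ∑[ u ∈ V ] (∑[ v ∈ V ] e u v + ∑[ v ∈ V ] e v u)
      ≡⟨ ∑-cong V (λ u → ∑-+ V _ _) ⟨
    ∑[ u ∈ V ] (∑[ v ∈ V ] (e u v + e v u))
      ≡⟨ ∑-cong V (λ u → ∑-cong V (orient u)) ⟩
    ∑[ u ∈ V ] (∑[ v ∈ V ] (edge u v * bit (P u v))) ∎
    where
    open ≡-Reasoning
    e : Fin k → Fin k → ℕ
    e u v = bit (does (u Fin.<? v) ∧ does (adj? G u v)) * bit (P u v)
    orient : ∀ u v → e u v + e v u ≡ edge u v * bit (P u v)
    orient u v with Fin.<-cmp u v
    ... | tri< u<v _ v≮u rewrite dec-true (u Fin.<? v) u<v | dec-false (v Fin.<? u) v≮u = +-identityʳ _
    ... | tri> u≮v _ v<u rewrite dec-true (v Fin.<? u) v<u | dec-false (u Fin.<? v) u≮v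
                               | does-adj-sym v u | P-sym v u = refl
    ... | tri≈ u≮u refl _ rewrite dec-false (u Fin.<? u) u≮u | edge-irrefl u = refl

  count-complement : ∀ P → count P + count (λ u v → not (P u v)) ≡ length (edges G)
  count-complement P = begin
    count P + count (λ u v → not (P u v))             ≡⟨ ∑-+ (edges G) _ _ ⟨
    ∑[ (u , v) ∈ edges G ] (bit (P u v) + bit (not (P u v))) ≡⟨ ∑-cong (edges G) (λ (u , v) → total (P u v)) ⟩
    ∑[ _ ∈ edges G ] 1                                ≡⟨ ∑-const (edges G) 1 ⟩
    length (edges G) * 1                              ≡⟨ *-identityʳ _ ⟩
    length (edges G)                                  ∎
    where
    open ≡-Reasoning
    total : ∀ b → bit b + bit (not b) ≡ 1
    total true  = refl
    total false = refl

  size-handshake : length (edges G) + length (edges G) ≡ ∑[ u ∈ V ] (∑[ v ∈ V ] edge u v)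
  size-handshake = begin
    length (edges G) + length (edges G)      ≡⟨ cong₂ _+_ size size ⟨
    count all + count all                    ≡⟨ handshake all (λ _ _ → refl) ⟩
    ∑[ u ∈ V ] (∑[ v ∈ V ] (edge u v * 1))   ≡⟨ ∑-cong V (λ u → ∑-cong V (λ v → *-identityʳ _)) ⟩
    ∑[ u ∈ V ] (∑[ v ∈ V ] edge u v)         ∎
    where
    open ≡-Reasoning
    all : Fin k → Fin k → Bool
    all _ _ = true
    size : count all ≡ length (edges G)
    size = trans (∑-const (edges G) 1) (*-identityʳ _)

  #edges-count : ∀ (γ : Fin k → Fin k → Colour) c → #edges G γ c ≡ count (λ u v → does (γ u v ≟ᶜ c))
  #edges-count γ c = length-filter-∑ (λ (u , v) → γ u v ≟ᶜ c) (edges G)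

  2within : ∀ W → count (within W) + count (within W) ≡
    ∑[ u ∈ V ] (bit (W u) * ∑[ v ∈ V ] (edge u v * bit (W v)))
  2within W = trans (handshake (within W) (λ u v → Bool.∧-comm (W u) (W v)))
    (∑-cong V (λ u → trans (∑-cong V (λ v → lemma (W u) (W v) (edge u v))) (∑-*ˡ V (bit (W u)) _)))
    where
    lemma : ∀ a b e → e * bit (a ∧ b) ≡ bit a * (e * bit b)
    lemma true  b e = sym (+-identityʳ (e * bit b))
    lemma false b e = *-zeroʳ e

  -- Both sides count the pairs (endpoint in W, edge).
  crossing+2within : ∀ W → count (crossing W) + (count (within W) + count (within W)) ≡
    ∑[ u ∈ V ] (bit (W u) * ∑[ v ∈ V ] edge u v)
  crossing+2within W = *-cancelˡ-≡ _ _ 2 (begin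
    2 * (x + (i + i))
      ≡⟨ shuffle x i ⟩
    (x + x) + 2 * (i + i)
      ≡⟨ cong₂ (λ a b → a + 2 * b) (handshake (crossing W) (λ u v → Bool.xor-comm (W u) (W v)))
                                   (handshake (within W) (λ u v → Bool.∧-comm (W u) (W v))) ⟩
    ∑[ u ∈ V ] (∑[ v ∈ V ] (edge u v * bit (crossing W u v))) + 2 * ∑[ u ∈ V ] (∑[ v ∈ V ] (edge u v * bit (within W u v)))
      ≡⟨ cong (∑[ u ∈ V ] (∑[ v ∈ V ] (edge u v * bit (crossing W u v))) +_)
           (trans (sym (∑-*ˡ V 2 _)) (∑-cong V (λ u → sym (∑-*ˡ V 2 _)))) ⟩
    ∑[ u ∈ V ] (∑[ v ∈ V ] (edge u v * bit (crossing W u v))) + ∑[ u ∈ V ] (∑[ v ∈ V ] (2 * (edge u v * bit (within W u v))))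
      ≡⟨ trans (sym (∑-+ V _ _)) (∑-cong V (λ u → sym (∑-+ V _ _))) ⟩
    ∑[ u ∈ V ] (∑[ v ∈ V ] (edge u v * bit (crossing W u v) + 2 * (edge u v * bit (within W u v))))
      ≡⟨ ∑-cong V (λ u → ∑-cong V (λ v → lemma (W u) (W v) (edge u v))) ⟩
    ∑[ u ∈ V ] (∑[ v ∈ V ] (bit (W u) * edge u v + bit (W v) * edge u v))
      ≡⟨ trans (∑-cong V (λ u → ∑-+ V _ _)) (∑-+ V _ _) ⟩
    ∑[ u ∈ V ] (∑[ v ∈ V ] (bit (W u) * edge u v)) + ∑[ u ∈ V ] (∑[ v ∈ V ] (bit (W v) * edge u v))
      ≡⟨ cong (∑[ u ∈ V ] (∑[ v ∈ V ] (bit (W u) * edge u v)) +_)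
           (trans (∑-swap V V _) (∑-cong V (λ v → ∑-cong V (λ u → cong (bit (W v) *_) (edge-sym u v))))) ⟩
    d + d
      ≡⟨ trans (cong (d +_) (sym (+-identityʳ d))) (cong (2 *_) (∑-cong V (λ u → ∑-*ˡ V (bit (W u)) _))) ⟩
    2 * ∑[ u ∈ V ] (bit (W u) * ∑[ v ∈ V ] edge u v) ∎)
    where
    open ≡-Reasoning
    x i d : ℕ
    x = count (crossing W)
    i = count (within W)
    d = ∑[ u ∈ V ] (∑[ v ∈ V ] (bit (W u) * edge u v))
    shuffle : ∀ x i → 2 * (x + (i + i)) ≡ (x + x) + 2 * (i + i)
    shuffle = solve-∀
    lemma : ∀ a b e → e * bit (a xor b) + 2 * (e * bit (a ∧ b)) ≡ bit a * e + bit b * e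
    lemma true  true  = solve-∀
    lemma true  false = solve-∀
    lemma false true  = solve-∀
    lemma false false = solve-∀

  Halved : (Fin k → Fin k → Bool) → Set
  Halved P = ∣ count P - count (λ u v → not (P u v)) ∣ ≤ 1

-- Unavoidable patterns

opp : Colour → Colour
opp R = B
opp B = R

≢⇒opp : ∀ {c d} → d ≢ c → d ≡ opp c
≢⇒opp {R} {R} d≢c = contradiction refl d≢c
≢⇒opp {R} {B} _   = refl
≢⇒opp {B} {R} _   = refl
≢⇒opp {B} {B} d≢c = contradiction refl d≢c

≢-opp : ∀ c → c ≢ opp c
≢-opp R ()
≢-opp B ()

-- The slack of one pays for the vertex that `ramsey` takes out before it splits the others; the
-- other uses give it away.
pigeonhole₂ : ∀ p a b → 2 * p ≤ suc (a + b) → p ≤ a ⊎ p ≤ b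
pigeonhole₂ p a b 2p≤ with p ≤? a | p ≤? b
... | yes p≤a | _       = inj₁ p≤a
... | no _    | yes p≤b = inj₂ p≤b
... | no p≰a  | no p≰b  = contradiction (begin-strict
  suc (a + b)   <⟨ ≤-reflexive (sym (cong suc (+-suc a b))) ⟩
  suc a + suc b ≤⟨ +-mono-≤ (≰⇒> p≰a) (≰⇒> p≰b) ⟩
  p + p         ≡⟨ cong (p +_) (+-identityʳ p) ⟨
  2 * p         ∎) (≤⇒≯ 2p≤)
  where open ≤-Reasoning

-- Pointwise form of a reverse Markov inequality: the quantity is at most `b` where `P` holds and at
-- most `c` elsewhere. Summed over all vertices, it turns a large average into many vertices that
-- satisfy `P`.
threshold : ∀ {P : Set} {a b c} (P? : Dec P) → a ≤ b → (¬ P → a ≤ c) → a ≤ bit (does P?) * b + c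
threshold (yes _) a≤b _   = ≤-trans a≤b (≤-trans (≤-reflexive (sym (*-identityˡ _))) (m≤m+n _ _))
threshold (no ¬p) _   a≤c = a≤c ¬p

length-split : {P : Pred X 0ℓ} (P? : Decidable P) (xs : List X) →
  length (filter P? xs) + length (filter (¬? ∘ P?) xs) ≡ length xs
length-split P? []       = refl
length-split P? (x ∷ xs) with does (P? x)
... | true  = cong suc (length-split P? xs)
... | false = trans (+-suc _ _) (cong suc (length-split P? xs))

module _ {n : ℕ} where

  infixl 6 _∖_
  _∖_ : List (Fin n) → List (Fin n) → List (Fin n)
  xs ∖ []       = xs
  xs ∖ (y ∷ ys) = filter (λ x → ¬? (x Fin.≟ y)) (xs ∖ ys)

  ∖-unique : ∀ {xs : List (Fin n)} ys → Unique xs → Unique (xs ∖ ys)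
  ∖-unique []       xs! = xs!
  ∖-unique (y ∷ ys) xs! = Unique.filter⁺ _ (∖-unique ys xs!)

  ∈-∖⁻ : ∀ {x} xs ys → x ∈ xs ∖ ys → x ∈ xs × x ∉ ys
  ∈-∖⁻ xs []       x∈ = x∈ , λ ()
  ∈-∖⁻ xs (y ∷ ys) x∈ with ∈-filter⁻ _ {xs = xs ∖ ys} x∈
  ... | x∈′ , x≢y with ∈-∖⁻ xs ys x∈′
  ...   | x∈xs , x∉ys = x∈xs , λ { (here x≡y) → x≢y x≡y ; (there x∈ys) → x∉ys x∈ys }

  length-remove : ∀ {xs : List (Fin n)} y → Unique xs → length xs ≤ suc (length (filter (λ x → ¬? (x Fin.≟ y)) xs))
  length-remove {[]}     y _                    = z≤n
  length-remove {x ∷ xs} y (x∉xs AllPairs.∷ xs!) with x Fin.≟ y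
  ... | yes refl = s≤s (≤-reflexive (sym (cong length (List.filter-all _ (All.map ≢-sym x∉xs)))))
  ... | no  _    = s≤s (length-remove y xs!)

  length-∖ : ∀ {xs : List (Fin n)} ys → Unique xs → length xs ≤ length ys + length (xs ∖ ys)
  length-∖ []       xs! = ≤-refl
  length-∖ {xs} (y ∷ ys) xs! = ≤-trans (length-∖ ys xs!)
    (≤-trans (+-monoʳ-≤ (length ys) (length-remove y (∖-unique ys xs!))) (≤-reflexive (+-suc _ _)))

record SubList {n : ℕ} (xs : List (Fin n)) : Set where
  constructor subList
  field
    elems    : List (Fin n)
    distinct : Unique elems
    included : ∀ {x} → x ∈ elems → x ∈ xs

open SubList public

sub-⊆ : ∀ {n} {xs ys : List (Fin n)} → (∀ {x} → x ∈ ys → x ∈ xs) → SubList ys → SubList xs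
sub-⊆ ys⊆xs (subList zs zs! zs⊆ys) = subList zs zs! (ys⊆xs ∘ zs⊆ys)

module _ {n : ℕ} (α : Colouring n) where

  private
    V : List (Fin n)
    V = allFin n

  Mono : Colour → List (Fin n) → Set
  Mono c xs = ∀ {x y} → x ∈ xs → y ∈ xs → x ≢ y → colour α x y ≡ c

  Clique : Colour → List (Fin n) → ℕ → Set
  Clique c xs s = Σ[ ys ∈ SubList xs ] (length (elems ys) ≡ s × Mono c (elems ys))

  clique-[] : ∀ {c xs} → Clique c xs 0
  clique-[] = subList [] AllPairs.[] (λ ()) , refl , λ ()

  clique-⊆ : ∀ {c s xs ys} → (∀ {x} → x ∈ ys → x ∈ xs) → Clique c ys s → Clique c xs s
  clique-⊆ ys⊆xs (zs , size , mono) = sub-⊆ ys⊆xs zs , size , mono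

  clique-∷ : ∀ {c s x xs} ys → All (x ≢_) xs → (∀ {y} → y ∈ ys → y ∈ xs × colour α x y ≡ c) →
    Clique c ys s → Clique c (x ∷ xs) (suc s)
  clique-∷ {c} {x = x} ys x∉xs ys⊆ (subList zs zs! zs⊆ys , size , mono) =
    subList (x ∷ zs) (All.tabulate (λ z∈ → All.lookup x∉xs (proj₁ (ys⊆ (zs⊆ys z∈)))) AllPairs.∷ zs!)
      (λ { (here z≡x) → here z≡x ; (there z∈) → there (proj₁ (ys⊆ (zs⊆ys z∈))) }) ,
    cong suc size , mono′
    where
    mono′ : Mono c (x ∷ zs)
    mono′ (here refl) (here refl) x≢x = contradiction refl x≢x
    mono′ (here refl) (there v∈)  _   = proj₂ (ys⊆ (zs⊆ys v∈))
    mono′ (there u∈)  (here refl) _   = trans (colour-symm α _ _) (proj₂ (ys⊆ (zs⊆ys u∈)))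
    mono′ (there u∈)  (there v∈)  u≢v = mono u∈ v∈ u≢v

  -- The crude bound 2^(s+t) replaces the binomial one. It doubles with each unit of `s` or `t`, so
  -- after splitting the remaining vertices by their color towards `x`, one class is large enough
  -- for a smaller instance.
  ramsey : ∀ c s t xs → Unique xs → 2 ^ (s + t) ≤ length xs → Clique c xs s ⊎ Clique (opp c) xs t
  ramsey c zero    t       xs _ _ = inj₁ clique-[]
  ramsey c (suc s) zero    xs _ _ = inj₂ clique-[]
  ramsey c (suc s) (suc t) [] _ 2^≤0 = contradiction (≤-trans (m^n>0 2 (suc s + suc t)) 2^≤0) λ ()
  ramsey c (suc s) (suc t) (x ∷ xs) (x∉xs AllPairs.∷ xs!) 2^≤
    with pigeonhole₂ (2 ^ (s + suc t)) _ _ (subst (λ m → 2 * 2 ^ (s + suc t) ≤ suc m) (sym (length-split col? xs)) 2^≤)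
    where
    col? : Decidable (λ y → colour α x y ≡ c)
    col? y = colour α x y ≟ᶜ c
  ... | inj₁ 2^≤same = [ inj₁ ∘ clique-∷ same x∉xs (∈-filter⁻ _ {xs = xs})
                       , inj₂ ∘ clique-⊆ (there ∘ proj₁ ∘ ∈-filter⁻ _ {xs = xs}) ]′
                       (ramsey c s (suc t) same (Unique.filter⁺ _ xs!) 2^≤same)
    where
    same : List (Fin n)
    same = filter (λ y → colour α x y ≟ᶜ c) xs
  ... | inj₂ 2^≤other = [ inj₁ ∘ clique-⊆ (there ∘ proj₁ ∘ ∈-filter⁻ _ {xs = xs})
                        , inj₂ ∘ clique-∷ other x∉xs other⊆ ]′
                        (ramsey c (suc s) t other (Unique.filter⁺ _ xs!)
                          (subst (λ m → 2 ^ m ≤ length other) (+-suc s t) 2^≤other))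
    where
    other : List (Fin n)
    other = filter (λ y → ¬? (colour α x y ≟ᶜ c)) xs
    other⊆ : ∀ {y} → y ∈ other → y ∈ xs × colour α x y ≡ opp c
    other⊆ y∈ with ∈-filter⁻ _ {xs = xs} y∈
    ... | y∈xs , xy≢c = y∈xs , ≢⇒opp xy≢c

  Agree : List (Fin n) → List (Fin n) → Set
  Agree xs ys = ∀ {x x′ y} → x ∈ xs → x′ ∈ xs → y ∈ ys → colour α x y ≡ colour α x′ y

  -- Each `y` costs a factor 2: only a color class of `xs` towards `y` that is still large enough is
  -- kept. Hence `ys` has to be of bounded size, and `xs` exponentially larger.
  homogenise : ∀ m xs ys → Unique xs → 2 ^ length ys * m ≤ length xs →
    Σ[ zs ∈ SubList xs ] (m ≤ length (elems zs) × Agree (elems zs) ys)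
  homogenise m xs [] xs! m≤ =
    subList xs xs! (λ x∈ → x∈) , ≤-trans (≤-reflexive (sym (*-identityˡ m))) m≤ , λ _ _ ()
  homogenise m xs (y ∷ ys) xs! m≤
    with pigeonhole₂ (2 ^ length ys * m) _ _ (≤-trans (≤-reflexive (sym (*-assoc 2 (2 ^ length ys) m)))
           (≤-trans m≤ (≤-trans (≤-reflexive (sym (length-split (λ x → colour α x y ≟ᶜ R) xs))) (n≤1+n _))))
  ... | inj₁ m≤R with homogenise m (filter (λ x → colour α x y ≟ᶜ R) xs) ys (Unique.filter⁺ _ xs!) m≤R
  ...   | zs , m≤ , agree = sub-⊆ (proj₁ ∘ ∈-filter⁻ _ {xs = xs}) zs , m≤ , agree′
    where
    red : ∀ {x} → x ∈ elems zs → colour α x y ≡ R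
    red = proj₂ ∘ ∈-filter⁻ (λ x → colour α x y ≟ᶜ R) {xs = xs} ∘ included zs
    agree′ : Agree (elems zs) (y ∷ ys)
    agree′ x∈ x′∈ (here refl) = trans (red x∈) (sym (red x′∈))
    agree′ x∈ x′∈ (there y∈)  = agree x∈ x′∈ y∈
  homogenise m xs (y ∷ ys) xs! m≤ | inj₂ m≤B
    with homogenise m (filter (λ x → ¬? (colour α x y ≟ᶜ R)) xs) ys (Unique.filter⁺ _ xs!) m≤B
  ...   | zs , m≤ , agree = sub-⊆ (proj₁ ∘ ∈-filter⁻ _ {xs = xs}) zs , m≤ , agree′
    where
    blue : ∀ {x} → x ∈ elems zs → colour α x y ≡ B
    blue x∈ = ≢⇒opp (proj₂ (∈-filter⁻ (λ x → ¬? (colour α x y ≟ᶜ R)) {xs = xs} (included zs x∈)))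
    agree′ : Agree (elems zs) (y ∷ ys)
    agree′ x∈ x′∈ (here refl) = trans (blue x∈) (sym (blue x′∈))
    agree′ x∈ x′∈ (there y∈)  = agree x∈ x′∈ y∈

  -- With two colors, `nonconstant` leaves two shapes: exactly one part differs in color from the
  -- edges across, or both parts do and then share their color.
  record Pattern (t : ℕ) : Set where
    field
      {part₁ part₂}  : List (Fin n)
      {c₁ c₂ c₃}     : Colour
      size₁          : t ≤ length part₁
      size₂          : t ≤ length part₂
      distinct₁      : Unique part₁
      distinct₂      : Unique part₂
      disjoint       : ∀ {x} → x ∈ part₁ → x ∉ part₂
      mono₁          : Mono c₁ part₁
      mono₂          : Mono c₂ part₂
      across         : ∀ {x y} → x ∈ part₁ → y ∈ part₂ → colour α x y ≡ c₃
      nonconstant    : ¬ (c₁ ≡ c₃ × c₂ ≡ c₃)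

  nbrs : Colour → Fin n → List (Fin n) → List (Fin n)
  nbrs c x = filter (λ y → colour α x y ≟ᶜ c)

  -- After homogenising, all remaining vertices have the same neighbors of color `opp c` in `ys`, at
  -- least `t` of them. A monochromatic set of `t` remaining vertices of either color then serves as
  -- the first part, because the second part already differs in color from the edges across. `1 ≤ t`
  -- provides a vertex `w` whose neighborhood is the second part.
  fan-pattern : ∀ {c t xs ys} → 1 ≤ t → Unique xs → Unique ys → Mono c ys → (∀ {x} → x ∈ xs → x ∉ ys) →
    (∀ {x} → x ∈ xs → t ≤ length (nbrs (opp c) x ys)) →
    2 ^ length ys * 2 ^ (t + t) ≤ length xs → Pattern t
  fan-pattern {c} {t@(suc _)} {xs} {ys} (s≤s _) xs! ys! ys-mono disj many 2^≤ with homogenise _ xs ys xs! 2^≤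
  ... | zs , 2^≤′ , agree = [ build , build ]′ (ramsey c t t (elems zs) (distinct zs) 2^≤′)
    where
    build : ∀ {d} → Clique d (elems zs) t → Pattern t
    build (subList ws@(w ∷ _) ws! ws⊆ , size , mono) = record
      { size₁       = ≤-reflexive (sym size)
      ; size₂       = many (included zs (ws⊆ (here refl)))
      ; distinct₁   = ws!
      ; distinct₂   = Unique.filter⁺ _ ys!
      ; disjoint    = λ x∈ x∈′ → disj (included zs (ws⊆ x∈)) (proj₁ (nbr x∈′))
      ; mono₁       = mono
      ; mono₂       = λ x∈ y∈ → ys-mono (proj₁ (nbr x∈)) (proj₁ (nbr y∈))
      ; across      = λ x∈ y∈ → trans (agree (ws⊆ x∈) (ws⊆ (here refl)) (proj₁ (nbr y∈))) (proj₂ (nbr y∈))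
      ; nonconstant = λ (_ , c≡opp) → ≢-opp c c≡opp
      }
      where
      nbr : ∀ {y} → y ∈ nbrs (opp c) w ys → y ∈ ys × colour α w y ≡ opp c
      nbr = ∈-filter⁻ _ {xs = ys}

  -- The cliques have different colors, so any color between them differs from one of the two. It
  -- only remains to make the edges between them monochromatic: by homogenising, and by halving `ys`
  -- according to the color towards one vertex `w`.
  bicolour-pattern : ∀ {c t xs ys} → 1 ≤ t → Unique xs → Unique ys → Mono (opp c) xs → Mono c ys →
    (∀ {x} → x ∈ xs → x ∉ ys) → 2 * t ≤ length ys → 2 ^ length ys * t ≤ length xs → Pattern t
  bicolour-pattern {c} {t@(suc _)} {xs} {ys} (s≤s _) xs! ys! xs-mono ys-mono disj 2t≤ 2^≤ with homogenise _ xs ys xs! 2^≤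
  ... | subList ws@(w ∷ _) ws! ws⊆ , size , agree
    with pigeonhole₂ t _ _ (≤-trans 2t≤ (≤-trans (≤-reflexive (sym (length-split (λ y → colour α w y ≟ᶜ c) ys))) (n≤1+n _)))
  ...   | inj₁ t≤ = record
      { size₁       = size
      ; size₂       = t≤
      ; distinct₁   = ws!
      ; distinct₂   = Unique.filter⁺ _ ys!
      ; disjoint    = λ x∈ x∈′ → disj (ws⊆ x∈) (proj₁ (nbr x∈′))
      ; mono₁       = λ x∈ y∈ → xs-mono (ws⊆ x∈) (ws⊆ y∈)
      ; mono₂       = λ x∈ y∈ → ys-mono (proj₁ (nbr x∈)) (proj₁ (nbr y∈))
      ; across      = λ x∈ y∈ → trans (agree x∈ (here refl) (proj₁ (nbr y∈))) (proj₂ (nbr y∈))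
      ; nonconstant = λ (opp≡c , _) → ≢-opp c (sym opp≡c)
      }
      where
      nbr : ∀ {y} → y ∈ nbrs c w ys → y ∈ ys × colour α w y ≡ c
      nbr = ∈-filter⁻ _ {xs = ys}
  ...   | inj₂ t≤ = record
      { size₁       = size
      ; size₂       = t≤
      ; distinct₁   = ws!
      ; distinct₂   = Unique.filter⁺ _ ys!
      ; disjoint    = λ x∈ x∈′ → disj (ws⊆ x∈) (proj₁ (nbr x∈′))
      ; mono₁       = λ x∈ y∈ → xs-mono (ws⊆ x∈) (ws⊆ y∈)
      ; mono₂       = λ x∈ y∈ → ys-mono (proj₁ (nbr x∈)) (proj₁ (nbr y∈))
      ; across      = λ x∈ y∈ → trans (agree x∈ (here refl) (proj₁ (nbr y∈))) (≢⇒opp (proj₂ (nbr y∈)))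
      ; nonconstant = λ (_ , c≡opp) → ≢-opp c c≡opp
      }
      where
      nbr : ∀ {y} → y ∈ filter (λ y → ¬? (colour α w y ≟ᶜ c)) ys → y ∈ ys × colour α w y ≢ c
      nbr = ∈-filter⁻ _ {xs = ys}

  -- Degrees in one color, and existence of a pattern

  coloured : Colour → Fin n → Fin n → Bool
  coloured c u v = does (colour α u v ≟ᶜ c)

  deg : Colour → Fin n → ℕ
  deg c v = ∑[ u ∈ V ] (edge (K n) v u * bit (coloured c v u))

  ∑-deg : ∀ c → ∑ V (deg c) ≡ #edges (K n) (colour α) c + #edges (K n) (colour α) c
  ∑-deg c = sym (trans (cong₂ _+_ (#edges-count (K n) (colour α) c) (#edges-count (K n) (colour α) c))
    (handshake (K n) (coloured c) (λ u v → cong (λ d → does (d ≟ᶜ c)) (colour-symm α u v))))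

  bit≤1 : ∀ b → bit b ≤ 1
  bit≤1 true  = ≤-refl
  bit≤1 false = z≤n

  deg≤n : ∀ c v → deg c v ≤ n
  deg≤n c v = ≤-trans (∑-mono V {g = λ _ → 1} (λ u → *-mono-≤ (bit≤1 (does (adj? (K n) v u))) (bit≤1 (coloured c v u))))
    (≤-reflexive (trans (∑-allFin-const n 1) (*-identityʳ n)))

  dense : Colour → List (Fin n)
  dense c = filter (λ v → n ≤? 4 * deg c v) V

  -- The average degree in color `c` is about n/2 and no degree exceeds n, so at least about a
  -- quarter of the vertices reach half of the average. The 6 collects the lower-order terms 2 n + 4
  -- ≤ 6 n.
  dense-size : ∀ c → 1 ≤ n → n * (n ∸ 1) ≤ 4 * #edges (K n) (colour α) c + 2 → n ≤ 4 * length (dense c) + 6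
  dense-size c 1≤n many = *-cancelˡ-≤ n {{>-nonZero 1≤n}} (+-cancelʳ-≤ (n * n) _ _ (begin
    n * n + n * n
      ≡⟨ cong₂ (λ a b → n * a + n * b) n≡ n≡ ⟩
    n * (1 + (n ∸ 1)) + n * (1 + (n ∸ 1))
      ≡⟨ expand n (n ∸ 1) ⟩
    2 * n + 2 * (n * (n ∸ 1))
      ≤⟨ +-monoʳ-≤ (2 * n) (*-monoʳ-≤ 2 many) ⟩
    2 * n + 2 * (4 * e + 2)
      ≡⟨ regroup n e ⟩
    4 * (e + e) + (2 * n + 4)
      ≡⟨ cong (λ m → 4 * m + (2 * n + 4)) (∑-deg c) ⟨
    4 * ∑ V (deg c) + (2 * n + 4)
      ≤⟨ +-mono-≤ upper (+-monoʳ-≤ (2 * n) (*-monoʳ-≤ 4 1≤n)) ⟩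
    length (dense c) * (4 * n) + n * n + (2 * n + 4 * n)
      ≡⟨ collect (length (dense c)) n ⟩
    n * (4 * length (dense c) + 6) + n * n ∎))
    where
    open ≤-Reasoning
    e : ℕ
    e = #edges (K n) (colour α) c
    n≡ : n ≡ 1 + (n ∸ 1)
    n≡ = sym (m+[n∸m]≡n 1≤n)
    expand : ∀ a b → a * (1 + b) + a * (1 + b) ≡ 2 * a + 2 * (a * b)
    expand = solve-∀
    regroup : ∀ a e → 2 * a + 2 * (4 * e + 2) ≡ 4 * (e + e) + (2 * a + 4)
    regroup = solve-∀
    collect : ∀ l n → l * (4 * n) + n * n + (2 * n + 4 * n) ≡ n * (4 * l + 6) + n * n
    collect = solve-∀
    pointwise : ∀ v → 4 * deg c v ≤ bit (does (n ≤? 4 * deg c v)) * (4 * n) + n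
    pointwise v = threshold (n ≤? 4 * deg c v) (*-monoʳ-≤ 4 (deg≤n c v)) ≰⇒≥
    upper : 4 * ∑ V (deg c) ≤ length (dense c) * (4 * n) + n * n
    upper = begin
      4 * ∑ V (deg c)                                          ≡⟨ ∑-*ˡ V 4 (deg c) ⟨
      ∑[ v ∈ V ] (4 * deg c v)                                 ≤⟨ ∑-mono V pointwise ⟩
      ∑[ v ∈ V ] (bit (does (n ≤? 4 * deg c v)) * (4 * n) + n) ≡⟨ ∑-+ V _ _ ⟩
      ∑[ v ∈ V ] (bit (does (n ≤? 4 * deg c v)) * (4 * n)) + ∑[ _ ∈ V ] n
        ≡⟨ cong₂ _+_ (trans (∑-*ʳ V (4 * n) _) (cong (_* (4 * n)) (sym (length-filter-∑ _ V)))) (∑-allFin-const n n) ⟩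
      length (dense c) * (4 * n) + n * n                       ∎

  -- Double counting of the edges of color `opp c` at the clique: its 8 t vertices have degree at
  -- least n/4 each, so a vertex has on average 2 t such neighbors in the clique, twice what
  -- `fan-pattern` asks for. No vertex has more than 8 t, hence at least n/8 vertices are `rich`.
  -- The bound on n keeps enough of them after the clique is removed.
  dense-clique-pattern : ∀ {c t} → 1 ≤ t → Clique c (dense (opp c)) (8 * t) →
    8 * (8 * t + 2 ^ (8 * t) * 2 ^ (t + t)) ≤ n → Pattern t
  dense-clique-pattern {c} {t} 1≤t (subList ys ys! ys⊆ , size , mono) n≥ =
    fan-pattern 1≤t (∖-unique ys rich!) ys! mono (proj₂ ∘ ∈-∖⁻ rich ys)
      (λ x∈ → proj₂ (∈-filter⁻ _ {xs = V} (proj₁ (∈-∖⁻ rich ys x∈))))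
      (≤-trans (≤-reflexive (cong (λ b → 2 ^ b * 2 ^ (t + t)) size)) (+-cancelˡ-≤ (8 * t) _ _ (begin
        8 * t + 2 ^ (8 * t) * 2 ^ (t + t) ≤⟨ *-cancelˡ-≤ 8 (≤-trans n≥ rich-size) ⟩
        length rich                       ≤⟨ length-∖ ys rich! ⟩
        length ys + length (rich ∖ ys)    ≡⟨ cong (_+ length (rich ∖ ys)) size ⟩
        8 * t + length (rich ∖ ys)        ∎)))
    where
    open ≤-Reasoning
    degᵧ : Fin n → ℕ
    degᵧ v = length (nbrs (opp c) v ys)
    rich? : Decidable (λ v → t ≤ degᵧ v)
    rich? v = t ≤? degᵧ v
    rich : List (Fin n)
    rich = filter rich? V
    rich! : Unique rich
    rich! = Unique.filter⁺ _ (Unique.allFin⁺ n)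
    pointwise : ∀ v → degᵧ v ≤ bit (does (rich? v)) * (8 * t) + t
    pointwise v = threshold (rich? v) (≤-trans (List.length-filter _ ys) (≤-reflexive size)) ≰⇒≥
    lower : 4 * (n * (2 * t)) ≤ 4 * ∑ V degᵧ
    lower = begin
      4 * (n * (2 * t))                   ≡⟨ shuffle n t ⟩
      8 * t * n                           ≡⟨ cong (_* n) size ⟨
      length ys * n                       ≡⟨ ∑-const ys n ⟨
      ∑[ _ ∈ ys ] n                       ≤⟨ ∑-mono∈ ys (λ y∈ → proj₂ (∈-filter⁻ _ {xs = V} (ys⊆ y∈))) ⟩
      ∑[ y ∈ ys ] (4 * deg (opp c) y)     ≡⟨ ∑-*ˡ ys 4 _ ⟩
      4 * ∑ ys (deg (opp c))              ≡⟨ cong (4 *_) (∑-swap ys V _) ⟩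
      4 * ∑[ v ∈ V ] (∑[ y ∈ ys ] (edge (K n) y v * bit (coloured (opp c) y v)))
        ≤⟨ *-monoʳ-≤ 4 (∑-mono V (λ v → ∑-mono ys (λ y → *-monoˡ-≤ (bit (coloured (opp c) y v)) (bit≤1 (does (adj? (K n) y v)))))) ⟩
      4 * ∑[ v ∈ V ] (∑[ y ∈ ys ] (1 * bit (coloured (opp c) y v)))
        ≡⟨ cong (4 *_) (∑-cong V (λ v → trans (∑-cong ys (λ y → trans (*-identityˡ _)
             (cong (λ d → bit (does (d ≟ᶜ opp c))) (colour-symm α y v)))) (sym (length-filter-∑ _ ys)))) ⟩
      4 * ∑ V degᵧ ∎
      where
      shuffle : ∀ n t → 4 * (n * (2 * t)) ≡ 8 * t * n
      shuffle = solve-∀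
    upper : ∑ V degᵧ ≤ length rich * (8 * t) + n * t
    upper = begin
      ∑ V degᵧ                                        ≤⟨ ∑-mono V pointwise ⟩
      ∑[ v ∈ V ] (bit (does (rich? v)) * (8 * t) + t) ≡⟨ ∑-+ V _ _ ⟩
      ∑[ v ∈ V ] (bit (does (rich? v)) * (8 * t)) + ∑[ _ ∈ V ] t
        ≡⟨ cong₂ _+_ (trans (∑-*ʳ V (8 * t) _) (cong (_* (8 * t)) (sym (length-filter-∑ rich? V)))) (∑-allFin-const n t) ⟩
      length rich * (8 * t) + n * t                   ∎
    rich-size : n ≤ 8 * length rich
    rich-size = *-cancelʳ-≤ n _ t {{>-nonZero 1≤t}} (+-cancelʳ-≤ (n * t) _ _ (begin
      n * t + n * t                         ≡⟨ double n t ⟩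
      n * (2 * t)                           ≤⟨ *-cancelˡ-≤ 4 lower ⟩
      ∑ V degᵧ                              ≤⟨ upper ⟩
      length rich * (8 * t) + n * t         ≡⟨ cong (_+ n * t) (rotate (length rich) t) ⟩
      8 * length rich * t + n * t           ∎))
      where
      double : ∀ n t → n * t + n * t ≡ n * (2 * t)
      double = solve-∀
      rotate : ∀ l t → l * (8 * t) ≡ 8 * l * t
      rotate = solve-∀

-- `ramsey` is applied among the red-dense and among the blue-dense vertices. A blue clique of size
-- `b` among the former or a red one among the latter gives a pattern at once; otherwise there are a
-- red clique of size `s` and a blue one of size `b`. The summand `b` in `s` pays for making them
-- disjoint, the summand 2^b t for homogenising towards the blue clique. The sizes are variables
-- with equations, which keeps the iterated powers folded.
pattern-exists′ : ∀ {n t b s r} (α : Colouring n) → 1 ≤ t → b ≡ 8 * t → s ≡ b + 2 ^ b * t → r ≡ 2 ^ (b + s) →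
  4 * r + 6 ≤ n → 8 * (b + 2 ^ b * 2 ^ (t + t)) ≤ n →
  (∀ c → n * (n ∸ 1) ≤ 4 * #edges (K n) (colour α) c + 2) → Pattern α t
pattern-exists′ {n} {t} {b} {s} {r} α 1≤t b≡ s≡ r≡ r-large n-large many =
  combine (search B R s refl (≤-reflexive (sym r≡))) (search R B b refl b-small)
  where
  open ≤-Reasoning
  b-small : 2 ^ (b + b) ≤ r
  b-small = ≤-trans (^-monoʳ-≤ 2 (+-monoʳ-≤ b (≤-trans (m≤m+n b _) (≤-reflexive (sym s≡))))) (≤-reflexive (sym r≡))
  dense-large : ∀ d → r ≤ length (dense α d)
  dense-large d = *-cancelˡ-≤ 4 (+-cancelʳ-≤ 6 (4 * r) (4 * length (dense α d))
    (≤-trans r-large (dense-size α d (≤-trans (s≤s z≤n) (≤-trans (m≤n+m 6 (4 * r)) r-large)) (many d))))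
  search : ∀ c d s → opp c ≡ d → 2 ^ (b + s) ≤ r → Pattern α t ⊎ Clique α d (dense α d) s
  search c d s refl 2^≤ = [ inj₁ ∘ found , inj₂ ]′
    (ramsey α c b s (dense α d) (Unique.filter⁺ _ (Unique.allFin⁺ n)) (≤-trans 2^≤ (dense-large d)))
    where
    found : Clique α c (dense α (opp c)) b → Pattern α t
    found q = dense-clique-pattern α 1≤t (subst (Clique α c _) b≡ q)
      (subst (λ b → 8 * (b + 2 ^ b * 2 ^ (t + t)) ≤ n) b≡ n-large)
  combine : Pattern α t ⊎ Clique α R (dense α R) s → Pattern α t ⊎ Clique α B (dense α B) b → Pattern α t
  combine (inj₁ p) _        = p
  combine _        (inj₁ p) = p
  combine (inj₂ (subList rs rs! _ , rs-size , rs-mono)) (inj₂ (subList bs bs! _ , bs-size , bs-mono)) =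
    bicolour-pattern α {c = B} 1≤t (∖-unique bs rs!) bs!
      (λ x∈ y∈ → rs-mono (proj₁ (∈-∖⁻ rs bs x∈)) (proj₁ (∈-∖⁻ rs bs y∈))) bs-mono (proj₂ ∘ ∈-∖⁻ rs bs)
      2t≤ (+-cancelˡ-≤ (length bs) _ _ (begin
        length bs + 2 ^ length bs * t ≡⟨ cong (λ b → b + 2 ^ b * t) bs-size ⟩
        b + 2 ^ b * t                 ≡⟨ trans rs-size s≡ ⟨
        length rs                     ≤⟨ length-∖ bs rs! ⟩
        length bs + length (rs ∖ bs)  ∎))
    where
    2t≤ : 2 * t ≤ length bs
    2t≤ = ≤-trans (*-monoˡ-≤ t (s≤s (s≤s (z≤n {6})))) (≤-reflexive (sym (trans bs-size b≡)))

pattern-exists : ∀ t → 1 ≤ t → ∃[ n₀ ] (∀ {n} (α : Colouring n) → n₀ ≤ n →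
  (∀ c → n * (n ∸ 1) ≤ 4 * #edges (K n) (colour α) c + 2) → Pattern α t)
pattern-exists t 1≤t = choose (8 * t) refl _ refl _ refl
  where
  choose : ∀ b → b ≡ 8 * t → ∀ s → s ≡ b + 2 ^ b * t → ∀ r → r ≡ 2 ^ (b + s) →
    ∃[ n₀ ] (∀ {n} (α : Colouring n) → n₀ ≤ n →
      (∀ c → n * (n ∸ 1) ≤ 4 * #edges (K n) (colour α) c + 2) → Pattern α t)
  choose b b≡ s s≡ r r≡ = (4 * r + 6) + 8 * (b + 2 ^ b * 2 ^ (t + t)) , λ α n₀≤n →
    pattern-exists′ α 1≤t b≡ s≡ r≡ (m+n≤o⇒m≤o (4 * r + 6) n₀≤n) (m+n≤o⇒n≤o (4 * r + 6) n₀≤n)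

-- Balanced copies in a pattern

lookup-injective : {xs : List X} → Unique xs → ∀ i j → lookup xs i ≡ lookup xs j → i ≡ j
lookup-injective (_ AllPairs.∷ _)      zero    zero    _  = refl
lookup-injective (x∉xs AllPairs.∷ _)   zero    (suc j) eq = contradiction eq (All.lookup x∉xs (∈-lookup j))
lookup-injective (x∉xs AllPairs.∷ _)   (suc i) zero    eq = contradiction (sym eq) (All.lookup x∉xs (∈-lookup i))
lookup-injective (_ AllPairs.∷ xs!)    (suc i) (suc j) eq = cong suc (lookup-injective xs! i j eq)

module _ {n k : ℕ} {α : Colouring n} (G : Graph k) (p : Pattern α k) where
  open Pattern p

  -- Each vertex of `G` owns the position with its index in both parts. Every choice of sides is
  -- therefore injective, no matter how many vertices go to each side; this is why both parts need
  -- size `k`.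
  place : Bool → Fin k → Fin n
  place true  u = lookup part₁ (Fin.inject≤ u size₁)
  place false u = lookup part₂ (Fin.inject≤ u size₂)

  place-injective : ∀ {a b u v} → place a u ≡ place b v → u ≡ v
  place-injective {true}  {true}  {u} {v} eq =
    Fin.inject≤-injective size₁ size₁ u v (lookup-injective distinct₁ _ _ eq)
  place-injective {true}  {false} eq = contradiction (∈-lookup _) (disjoint (subst (_∈ part₁) eq (∈-lookup _)))
  place-injective {false} {true}  eq = contradiction (∈-lookup _) (disjoint (subst (_∈ part₁) (sym eq) (∈-lookup _)))
  place-injective {false} {false} {u} {v} eq =
    Fin.inject≤-injective size₂ size₂ u v (lookup-injective distinct₂ _ _ eq)

  copy : (Fin k → Bool) → Copy G (K n)
  copy W = record
    { to        = λ u → place (W u) u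
    ; injective = λ {u} {v} → place-injective {W u} {W v}
    ; preserves = λ {u} {v} u~v eq → irrefl G (place-injective {W u} {W v} eq) u~v
    }

  expected : Bool → Bool → Colour
  expected true  true  = c₁
  expected false false = c₂
  expected _     _     = c₃

  place-colour : ∀ a b {u v} → u ≢ v → colour α (place a u) (place b v) ≡ expected a b
  place-colour true  true  u≢v = mono₁ (∈-lookup _) (∈-lookup _) (u≢v ∘ place-injective {true} {true})
  place-colour false false u≢v = mono₂ (∈-lookup _) (∈-lookup _) (u≢v ∘ place-injective {false} {false})
  place-colour true  false u≢v = across (∈-lookup _) (∈-lookup _)
  place-colour false true  u≢v = trans (colour-symm α _ _) (across (∈-lookup _) (∈-lookup _))

  balanced-copy : ∀ W P c → Halved G P →
    (∀ {u v} → Adj G u v → expected (W u) (W v) ≡ (if P u v then c else opp c)) → BalancedCopy G α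
  balanced-copy W P c halved cols = copy W , balanced c refl
    where
    γ : Fin k → Fin k → Colour
    γ = colour α on to (copy W)
    colours : ∀ {u v} → Adj G u v → γ u v ≡ (if P u v then c else opp c)
    colours {u} {v} u~v = trans (place-colour (W u) (W v) λ { refl → irrefl G refl u~v }) (cols u~v)
    counts : ∀ d (Q : Bool → Bool) → (∀ b → does ((if b then c else opp c) ≟ᶜ d) ≡ Q b) → #edges G γ d ≡ count G (λ u v → Q (P u v))
    counts d Q Q-spec = trans (#edges-count G γ d)
      (count-cong G {λ u v → does (γ u v ≟ᶜ d)} {λ u v → Q (P u v)}
        (λ {u} {v} u~v → trans (cong (λ e → does (e ≟ᶜ d)) (colours u~v)) (Q-spec (P u v))))
    balanced : ∀ d → c ≡ d → ∣ #edges G γ R - #edges G γ B ∣ ≤ 1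
    balanced R refl = subst₂ (λ x y → ∣ x - y ∣ ≤ 1)
      (sym (counts R (λ b → b) λ { true → refl ; false → refl }))
      (sym (counts B not λ { true → refl ; false → refl })) halved
    balanced B refl = subst₂ (λ x y → ∣ x - y ∣ ≤ 1)
      (sym (counts R not λ { true → refl ; false → refl }))
      (sym (counts B (λ b → b) λ { true → refl ; false → refl }))
      (subst (_≤ 1) (∣-∣-comm (count G P) (count G (λ u v → not (P u v)))) halved)

  -- If a single part differs in color from the edges across, then `W` is put into it, and the edges
  -- within `W` form one color class of the copy. If both parts differ, the crossing edges of `X`
  -- form one.
  pattern-balanced : ∃[ W ] Halved G (within W) → ∃[ W ] Halved G (crossing W) → BalancedCopy G α
  pattern-balanced (W , halfW) (X , halfX) with c₁ ≟ᶜ c₃ | c₂ ≟ᶜ c₃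
  ... | yes c₁≡ | yes c₂≡ = contradiction (c₁≡ , c₂≡) nonconstant
  ... | no c₁≢  | yes c₂≡ = balanced-copy W (within W) c₁ halfW (λ {u} {v} _ → cols (W u) (W v))
    where
    c₃≡ : c₃ ≡ opp c₁
    c₃≡ = ≢⇒opp (c₁≢ ∘ sym)
    cols : ∀ a b → expected a b ≡ (if a ∧ b then c₁ else opp c₁)
    cols true  true  = refl
    cols true  false = c₃≡
    cols false true  = c₃≡
    cols false false = trans c₂≡ c₃≡
  ... | yes c₁≡ | no c₂≢  = balanced-copy (not ∘ W) (within W) c₂ halfW (λ {u} {v} _ → cols (W u) (W v))
    where
    c₃≡ : c₃ ≡ opp c₂
    c₃≡ = ≢⇒opp (c₂≢ ∘ sym)
    cols : ∀ a b → expected (not a) (not b) ≡ (if a ∧ b then c₂ else opp c₂)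
    cols true  true  = refl
    cols true  false = c₃≡
    cols false true  = c₃≡
    cols false false = trans c₁≡ c₃≡
  ... | no c₁≢  | no c₂≢  = balanced-copy X (crossing X) c₃ halfX (λ {u} {v} _ → cols (X u) (X v))
    where
    cols : ∀ a b → expected a b ≡ (if a xor b then c₃ else opp c₃)
    cols true  true  = ≢⇒opp c₁≢
    cols true  false = refl
    cols false true  = refl
    cols false false = ≢⇒opp c₂≢

2*nC2 : ∀ n → 2 * (n C 2) ≡ n * (n ∸ 1)
2*nC2 zero    = refl
2*nC2 (suc n) = begin
  2 * (suc n C 2)       ≡⟨ cong (2 *_) (nCk+nC[k+1]≡[n+1]C[k+1] n 1) ⟨
  2 * (n C 1 + n C 2)   ≡⟨ cong (λ m → 2 * (m + n C 2)) (nC1≡n n) ⟩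
  2 * (n + n C 2)       ≡⟨ *-distribˡ-+ 2 n (n C 2) ⟩
  2 * n + 2 * (n C 2)   ≡⟨ cong (2 * n +_) (2*nC2 n) ⟩
  2 * n + n * (n ∸ 1)   ≡⟨ step n ⟩
  suc n * n             ∎
  where
  open ≡-Reasoning
  step : ∀ n → 2 * n + n * (n ∸ 1) ≡ suc n * n
  step zero    = refl
  step (suc m) = expand m
    where
    expand : ∀ m → 2 * suc m + suc m * m ≡ suc (suc m) * suc m
    expand = solve-∀

≤2⌊n/2⌋+1 : ∀ n → n ≤ 2 * ⌊ n /2⌋ + 1
≤2⌊n/2⌋+1 zero          = z≤n
≤2⌊n/2⌋+1 (suc zero)    = ≤-refl
≤2⌊n/2⌋+1 (suc (suc n)) = ≤-trans (s≤s (s≤s (≤2⌊n/2⌋+1 n))) (≤-reflexive (expand ⌊ n /2⌋))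
  where
  expand : ∀ h → 2 + (2 * h + 1) ≡ 2 * suc h + 1
  expand = solve-∀

-- `m` takes its largest admissible value, so both color classes have at least ⌊½ C(n,2)⌋ edges.
-- From n = 3 on this half is positive; for n ≤ 2 no admissible `m` exists.
balanceable : ∀ {k} {G : Graph k} → 1 ≤ k →
  ∃[ W ] Halved G (within W) → ∃[ W ] Halved G (crossing W) → Balanceable G
balanceable {k} {G} 1≤k halfW halfX = from (pattern-exists k 1≤k)
  where
  half-positive : ∀ {n} → 3 ≤ n → pred ⌊ n C 2 /2⌋ < ⌊ n C 2 /2⌋
  half-positive {n} 3≤n = ≤-reflexive (suc-pred ⌊ n C 2 /2⌋ {{>-nonZero (⌊n/2⌋-mono {2} (*-cancelˡ-≤ 2 4≤2nC2))}})
    where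
    open ≤-Reasoning
    4≤2nC2 : 2 * 2 ≤ 2 * (n C 2)
    4≤2nC2 = begin
      2 * 2       ≤⟨ *-mono-≤ (≤-trans (s≤s (s≤s z≤n)) 3≤n) (∸-monoˡ-≤ 1 3≤n) ⟩
      n * (n ∸ 1) ≡⟨ 2*nC2 n ⟨
      2 * (n C 2) ∎
  enough : ∀ {n c} (α : Colouring n) → #edges (K n) (colour α) c > pred ⌊ n C 2 /2⌋ →
    n * (n ∸ 1) ≤ 4 * #edges (K n) (colour α) c + 2
  enough {n} {c} α many = begin
    n * (n ∸ 1)                         ≡⟨ 2*nC2 n ⟨
    2 * (n C 2)                         ≤⟨ *-monoʳ-≤ 2 (≤2⌊n/2⌋+1 (n C 2)) ⟩
    2 * (2 * ⌊ n C 2 /2⌋ + 1)           ≡⟨ expand ⌊ n C 2 /2⌋ ⟩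
    4 * ⌊ n C 2 /2⌋ + 2                 ≤⟨ +-monoˡ-≤ 2 (*-monoʳ-≤ 4 (≤-trans (suc-pred≤ ⌊ n C 2 /2⌋) many)) ⟩
    4 * #edges (K n) (colour α) c + 2   ∎
    where
    open ≤-Reasoning
    expand : ∀ h → 2 * (2 * h + 1) ≡ 4 * h + 2
    expand = solve-∀
    suc-pred≤ : ∀ h → h ≤ suc (pred h)
    suc-pred≤ zero    = z≤n
    suc-pred≤ (suc h) = ≤-refl
  from : ∃[ n₀ ] (∀ {n} (α : Colouring n) → n₀ ≤ n →
    (∀ c → n * (n ∸ 1) ≤ 4 * #edges (K n) (colour α) c + 2) → Pattern α k) → Balanceable G
  from (n₀ , find) = 3 + n₀ , λ n n≥ →
    pred ⌊ n C 2 /2⌋ , half-positive (m+n≤o⇒m≤o 3 n≥) , λ α reds blues →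
    pattern-balanced G (find α (m+n≤o⇒n≤o 3 n≥) λ { R → enough α reds ; B → enough α blues }) halfW halfX

-- Circulant graphs

insert : ∀ {k} → Fin k → (Fin k → Bool) → Fin k → Bool
insert x W u = does (u Fin.≟ x) ∨ W u

module _ {k : ℕ} where

  private
    V : List (Fin k)
    V = allFin k

  bit-insert : ∀ (x : Fin k) W → W x ≡ false → ∀ u → bit (insert x W u) ≡ bit (does (u Fin.≟ x)) + bit (W u)
  bit-insert x W x∉W u with u Fin.≟ x
  ... | yes refl rewrite x∉W = refl
  ... | no _ = refl

  size-insert : ∀ (x : Fin k) W → W x ≡ false → ∑[ u ∈ V ] bit (insert x W u) ≡ suc (∑[ u ∈ V ] bit (W u))
  size-insert x W x∉W = begin
    ∑[ u ∈ V ] bit (insert x W u)                             ≡⟨ ∑-cong V (bit-insert x W x∉W) ⟩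
    ∑[ u ∈ V ] (bit (does (u Fin.≟ x)) + bit (W u))           ≡⟨ ∑-+ V _ _ ⟩
    ∑[ u ∈ V ] bit (does (u Fin.≟ x)) + ∑[ u ∈ V ] bit (W u)  ≡⟨ cong (_+ ∑[ u ∈ V ] bit (W u)) single ⟩
    suc (∑[ u ∈ V ] bit (W u))                                ∎
    where
    open ≡-Reasoning
    single : ∑[ u ∈ V ] bit (does (u Fin.≟ x)) ≡ 1
    single = trans (∑-cong V (λ u → sym (*-identityʳ _))) (∑-δ x (λ _ → 1))

  within-insert : ∀ (G : Graph k) x W → W x ≡ false →
    count G (within (insert x W)) ≡ ∑[ v ∈ V ] (edge G x v * bit (W v)) + count G (within W)
  within-insert G x W x∉W = *-cancelˡ-≡ _ _ 2 (begin
    2 * count G (within (insert x W))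
      ≡⟨ cong (count G (within (insert x W)) +_) (+-identityʳ _) ⟩
    count G (within (insert x W)) + count G (within (insert x W))
      ≡⟨ 2within G (insert x W) ⟩
    ∑[ u ∈ V ] (bit (insert x W u) * nbr (insert x W) u)
      ≡⟨ ∑-cong V (λ u → cong₂ _*_ (bit-insert x W x∉W u) (nbr-insert u)) ⟩
    ∑[ u ∈ V ] ((δ u + bit (W u)) * (edge G x u + nbr W u))
      ≡⟨ ∑-cong V (λ u → expand (δ u) (bit (W u)) (edge G x u) (nbr W u)) ⟩
    ∑[ u ∈ V ] (δ u * (edge G x u + nbr W u) + (edge G x u * bit (W u) + bit (W u) * nbr W u))
      ≡⟨ trans (∑-+ V _ _) (cong (∑[ u ∈ V ] (δ u * (edge G x u + nbr W u)) +_) (∑-+ V _ _)) ⟩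
    ∑[ u ∈ V ] (δ u * (edge G x u + nbr W u)) + (nbr W x + ∑[ u ∈ V ] (bit (W u) * nbr W u))
      ≡⟨ cong₂ (λ a b → a + (nbr W x + b)) (∑-δ x _) (sym (2within G W)) ⟩
    edge G x x + nbr W x + (nbr W x + (count G (within W) + count G (within W)))
      ≡⟨ cong (λ a → a + nbr W x + (nbr W x + (count G (within W) + count G (within W)))) (edge-irrefl G x) ⟩
    nbr W x + (nbr W x + (count G (within W) + count G (within W)))
      ≡⟨ regroup (nbr W x) (count G (within W)) ⟩
    2 * (nbr W x + count G (within W)) ∎)
    where
    open ≡-Reasoning
    δ : Fin k → ℕ
    δ u = bit (does (u Fin.≟ x))
    nbr : (Fin k → Bool) → Fin k → ℕ
    nbr U u = ∑[ v ∈ V ] (edge G u v * bit (U v))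
    nbr-insert : ∀ u → nbr (insert x W) u ≡ edge G x u + nbr W u
    nbr-insert u = begin
      nbr (insert x W) u
        ≡⟨ ∑-cong V (λ v → trans (cong (edge G u v *_) (bit-insert x W x∉W v)) (distrib (edge G u v) (δ v) (bit (W v)))) ⟩
      ∑[ v ∈ V ] (δ v * edge G u v + edge G u v * bit (W v))
        ≡⟨ ∑-+ V _ _ ⟩
      ∑[ v ∈ V ] (δ v * edge G u v) + nbr W u
        ≡⟨ cong (_+ nbr W u) (trans (∑-δ x (edge G u)) (edge-sym G u x)) ⟩
      edge G x u + nbr W u ∎
      where
      distrib : ∀ a b c → a * (b + c) ≡ b * a + a * c
      distrib = solve-∀
    expand : ∀ a b c d → (a + b) * (c + d) ≡ a * (c + d) + (c * b + b * d)
    expand = solve-∀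
    regroup : ∀ a b → a + (a + (b + b)) ≡ 2 * (a + b)
    regroup = solve-∀

-- A computing test, so that for explicit lists membership, and with it `inner`, is settled by
-- `refl`.
mem : List ℕ → ℕ → Bool
mem []       y = false
mem (x ∷ xs) y = does (y ≟ x) ∨ mem xs y

Simple : ℕ → List ℕ → Set
Simple k []       = ⊤
Simple k (x ∷ xs) = x < k × mem xs x ≡ false × Simple k xs

module _ {k : ℕ} .{{_ : NonZero k}} where

  private
    V : List (Fin k)
    V = allFin k

  -- Stating this by sums also records multiplicities: for constant `f` it gives the degree, so the
  -- shifts of `u` have to be distinct, and for an indicator it counts the neighbors in a set.
  Circulant : Graph k → List ℕ → Set
  Circulant G D = ∀ u (f : Fin k → ℕ) → ∑[ v ∈ V ] (edge G u v * f v) ≡ ∑[ d ∈ D ] f (shift d u)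

  gain : List ℕ → List ℕ → ℕ → ℕ
  gain D xs x = ∑[ d ∈ D ] bit (mem xs ((x + d) % k))

  -- The edges induced by the listed vertices, added one at a time from the end of the list: each
  -- edge is counted at its endpoint nearer to the head.
  inner : List ℕ → List ℕ → ℕ
  inner D []       = 0
  inner D (x ∷ xs) = gain D xs x + inner D xs

  toℕ-shift : ∀ d (u : Fin k) → toℕ (shift d u) ≡ (toℕ u + d) % k
  toℕ-shift d u = Fin.toℕ-fromℕ< (m%n<n (toℕ u + d) k)

  subset : List ℕ → Fin k → Bool
  subset xs u = mem xs (toℕ u)

  module _ {G : Graph k} {D : List ℕ} (circ : Circulant G D) where

    degree : ∀ u → ∑[ v ∈ V ] edge G u v ≡ length D
    degree u = begin
      ∑[ v ∈ V ] edge G u v       ≡⟨ ∑-cong V (λ v → *-identityʳ (edge G u v)) ⟨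
      ∑[ v ∈ V ] (edge G u v * 1) ≡⟨ circ u (λ _ → 1) ⟩
      ∑[ _ ∈ D ] 1                ≡⟨ ∑-const D 1 ⟩
      length D * 1                ≡⟨ *-identityʳ (length D) ⟩
      length D                    ∎
      where open ≡-Reasoning

    2size : length (edges G) + length (edges G) ≡ k * length D
    2size = trans (size-handshake G) (trans (∑-cong V degree) (∑-allFin-const k (length D)))

    private
      insert-subset : ∀ {x} xs (x<k : x < k) u → subset (x ∷ xs) u ≡ insert (Fin.fromℕ< x<k) (subset xs) u
      insert-subset {x} xs x<k u = cong (_∨ mem xs (toℕ u)) same
        where
        same : does (toℕ u ≟ x) ≡ does (u Fin.≟ Fin.fromℕ< x<k)
        same with u Fin.≟ Fin.fromℕ< x<k
        ... | yes eq = dec-true (toℕ u ≟ x) (trans (cong toℕ eq) (Fin.toℕ-fromℕ< x<k))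
        ... | no neq = dec-false (toℕ u ≟ x) λ eq → neq (Fin.toℕ-injective (trans eq (sym (Fin.toℕ-fromℕ< x<k))))

    within-subset : ∀ xs → Simple k xs → count G (within (subset xs)) ≡ inner D xs
    within-subset [] _ = trans (∑-const (edges G) 0) (*-zeroʳ (length (edges G)))
    within-subset (x ∷ xs) (x<k , x∉xs , xs!) = begin
      count G (within (subset (x ∷ xs)))
        ≡⟨ count-cong G (λ {u} {v} _ → cong₂ _∧_ (insert-subset xs x<k u) (insert-subset xs x<k v)) ⟩
      count G (within (insert x′ (subset xs)))
        ≡⟨ within-insert G x′ (subset xs) (trans (cong (mem xs) toℕ-x′) x∉xs) ⟩
      ∑[ v ∈ V ] (edge G x′ v * bit (subset xs v)) + count G (within (subset xs))
        ≡⟨ cong₂ _+_ (circ x′ (bit ∘ subset xs)) (within-subset xs xs!) ⟩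
      ∑[ d ∈ D ] bit (subset xs (shift d x′)) + inner D xs
        ≡⟨ cong (_+ inner D xs) (∑-cong D (λ d → cong (bit ∘ mem xs)
             (trans (toℕ-shift d x′) (cong (λ y → (y + d) % k) toℕ-x′)))) ⟩
      gain D xs x + inner D xs ∎
      where
      open ≡-Reasoning
      x′ : Fin k
      x′ = Fin.fromℕ< x<k
      toℕ-x′ : toℕ x′ ≡ x
      toℕ-x′ = Fin.toℕ-fromℕ< x<k

    size-subset : ∀ xs → Simple k xs → ∑[ u ∈ V ] bit (subset xs u) ≡ length xs
    size-subset [] _ = trans (∑-allFin-const k 0) (*-zeroʳ k)
    size-subset (x ∷ xs) (x<k , x∉xs , xs!) = begin
      ∑[ u ∈ V ] bit (subset (x ∷ xs) u)                         ≡⟨ ∑-cong V (cong bit ∘ insert-subset xs x<k) ⟩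
      ∑[ u ∈ V ] bit (insert (Fin.fromℕ< x<k) (subset xs) u)
        ≡⟨ size-insert (Fin.fromℕ< x<k) (subset xs) (trans (cong (mem xs) (Fin.toℕ-fromℕ< x<k)) x∉xs) ⟩
      suc (∑[ u ∈ V ] bit (subset xs u))                         ≡⟨ cong suc (size-subset xs xs!) ⟩
      suc (length xs)                                            ∎
      where open ≡-Reasoning

    crossing+2within-regular : ∀ W → count G (crossing W) + (count G (within W) + count G (within W)) ≡
      (∑[ u ∈ V ] bit (W u)) * length D
    crossing+2within-regular W = trans (crossing+2within G W)
      (trans (∑-cong V (λ u → cong (bit (W u) *_) (degree u))) (∑-*ʳ V (length D) _))

    crossing-subset : ∀ xs → Simple k xs →
      count G (crossing (subset xs)) + (inner D xs + inner D xs) ≡ length xs * length D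
    crossing-subset xs xs! = trans (cong (λ i → count G (crossing (subset xs)) + (i + i)) (sym (within-subset xs xs!)))
      (trans (crossing+2within-regular (subset xs)) (cong (_* length D) (size-subset xs xs!)))

    -- There are T edges with 2 T = k · `length D`, and |e - (T - e)| ≤ 1 doubles to |4 e - 2 T| ≤
    -- 2. This form avoids division and covers even and odd T alike.
    halved : ∀ P e → count G P ≡ e → 4 * e ≤ k * length D + 2 → k * length D ≤ 4 * e + 2 → Halved G P
    halved P _ refl upper lower = ∣-∣≤1 (count G P) (count G (λ u v → not (P u v)))
      (*-cancelˡ-≤ 2 (+-cancelˡ-≤ (2 * p) _ _ (≤-trans (≤-reflexive (double p)) (≤-trans upper (≤-reflexive upper′)))))
      (*-cancelˡ-≤ 2 (+-cancelˡ-≤ (2 * p) _ _ (≤-trans (≤-reflexive (sym total)) (≤-trans lower (≤-reflexive (lower′ p))))))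
      where
      p q : ℕ
      p = count G P
      q = count G (λ u v → not (P u v))
      ∣-∣≤1 : ∀ a b → a ≤ suc b → b ≤ suc a → ∣ a - b ∣ ≤ 1
      ∣-∣≤1 zero    b       _         b≤1       = b≤1
      ∣-∣≤1 (suc a) zero    a≤1       _         = a≤1
      ∣-∣≤1 (suc a) (suc b) (s≤s a≤)  (s≤s b≤)  = ∣-∣≤1 a b a≤ b≤
      sum² : ∀ p q → p + q + (p + q) ≡ 2 * p + 2 * q
      sum² = solve-∀
      total : k * length D ≡ 2 * p + 2 * q
      total = trans (sym 2size) (trans (cong (λ T → T + T) (sym (count-complement G P))) (sum² p q))
      double : ∀ p → 2 * p + 2 * p ≡ 4 * p
      double = solve-∀
      shuffle : ∀ p q → 2 * p + 2 * q + 2 ≡ 2 * p + 2 * suc q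
      shuffle = solve-∀
      upper′ : k * length D + 2 ≡ 2 * p + 2 * suc q
      upper′ = trans (cong (_+ 2) total) (shuffle p q)
      lower′ : ∀ p → 4 * p + 2 ≡ 2 * p + 2 * suc p
      lower′ = solve-∀

module _ {k : ℕ} .{{_ : NonZero k}} where

  shift-shift : ∀ d e (u : Fin k) → shift e (shift d u) ≡ shift (d + e) u
  shift-shift d e u = Fin.toℕ-injective (begin
    toℕ (shift e (shift d u))                  ≡⟨ toℕ-shift e (shift d u) ⟩
    (toℕ (shift d u) + e) % k                  ≡⟨ cong (λ x → (x + e) % k) (toℕ-shift d u) ⟩
    ((toℕ u + d) % k + e) % k                  ≡⟨ %-distribˡ-+ ((toℕ u + d) % k) e k ⟩
    ((toℕ u + d) % k % k + e % k) % k          ≡⟨ cong (λ x → (x + e % k) % k) (m%n%n≡m%n (toℕ u + d) k) ⟩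
    ((toℕ u + d) % k + e % k) % k              ≡⟨ %-distribˡ-+ (toℕ u + d) e k ⟨
    (toℕ u + d + e) % k                        ≡⟨ cong (_% k) (+-assoc (toℕ u) d e) ⟩
    (toℕ u + (d + e)) % k                      ≡⟨ toℕ-shift (d + e) u ⟨
    toℕ (shift (d + e) u)                      ∎)
    where open ≡-Reasoning

  shift-full : ∀ {d d′} → d + d′ ≡ k → (u : Fin k) → shift d′ (shift d u) ≡ u
  shift-full {d} {d′} refl u = trans (shift-shift d d′ u) (Fin.toℕ-injective
    (trans (toℕ-shift k u) (trans ([m+n]%n≡m%n (toℕ u) k) (m<n⇒m%n≡m (Fin.toℕ<n u)))))

  shift-distinct : ∀ {d d′} → d < d′ → d′ < k → (u : Fin k) → shift d u ≢ shift d′ u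
  shift-distinct {d} {d′} d<d′ d′<k u eq = shift-irrefl (m<n⇒0<n∸m d<d′) (≤-<-trans (m∸n≤m d′ d) d′<k) (shift d u)
    (trans eq (sym (trans (shift-shift d (d′ ∸ d) u) (cong (λ e → shift e u) (m+[n∸m]≡n (<⇒≤ d<d′))))))

  -- Adjacency is defined by arcs in both directions; this turns an arc into `u` into an arc out of
  -- `u`, so that all neighbors of `u` are shifts of `u`.
  reverse-arc : ∀ {d d′} → d + d′ ≡ k → (u v : Fin k) → does (u Fin.≟ shift d v) ≡ does (v Fin.≟ shift d′ u)
  reverse-arc {d} {d′} d+d′≡k u v = does-⇔ (mk⇔
    (λ u≡ → sym (trans (cong (shift d′) u≡) (shift-full d+d′≡k v)))
    (λ v≡ → sym (trans (cong (shift d) v≡) (shift-full (trans (+-comm d′ d) d+d′≡k) u)))) (u Fin.≟ shift d v) (v Fin.≟ shift d′ u)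

  circulant : (G : Graph k) (D : List ℕ) →
    (∀ u v → edge G u v ≡ ∑[ d ∈ D ] bit (does (v Fin.≟ shift d u))) → Circulant G D
  circulant G D edge≡ u f = begin
    ∑[ v ∈ V ] (edge G u v * f v)
      ≡⟨ ∑-cong V (λ v → trans (cong (_* f v) (edge≡ u v)) (sym (∑-*ʳ D (f v) _))) ⟩
    ∑[ v ∈ V ] (∑[ d ∈ D ] (bit (does (v Fin.≟ shift d u)) * f v))
      ≡⟨ ∑-swap V D _ ⟩
    ∑[ d ∈ D ] (∑[ v ∈ V ] (bit (does (v Fin.≟ shift d u)) * f v))
      ≡⟨ ∑-cong D (λ d → ∑-δ (shift d u) f) ⟩
    ∑[ d ∈ D ] f (shift d u) ∎
    where
    open ≡-Reasoning
    V : List (Fin k)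
    V = allFin k

Disjoint : Bool → Bool → Set
Disjoint a b = a ≡ true → b ≡ true → ⊥

bit-∨ : ∀ {a b} → Disjoint a b → bit (a ∨ b) ≡ bit a + bit b
bit-∨ {true}  {true}  disj = contradiction refl (disj refl)
bit-∨ {true}  {false} _    = refl
bit-∨ {false} {_}     _    = refl

∨-disjoint : ∀ {a b c} → Disjoint a c → Disjoint b c → Disjoint (a ∨ b) c
∨-disjoint {true}  a#c _   = a#c
∨-disjoint {false} _   b#c = b#c

disjoint-sym : ∀ {a b} → Disjoint a b → Disjoint b a
disjoint-sym a#b b a = a#b a b

≟-disjoint : ∀ {k} {v x y : Fin k} → x ≢ y → Disjoint (does (v Fin.≟ x)) (does (v Fin.≟ y))
≟-disjoint {v = v} {x} {y} x≢y _ _ with v Fin.≟ x | v Fin.≟ y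
≟-disjoint x≢y _ _  | yes refl | yes refl = x≢y refl
≟-disjoint x≢y () _ | no _     | _
≟-disjoint x≢y _ () | yes _    | no _

module _ (k ℓ : ℕ) (k>3 : k > 3) (2≤ℓ : 2 ≤ ℓ) (ℓ≤k-2 : ℓ ≤ k ∸ 2)
  {k′ ℓ′ : ℕ} (1+k′≡k : suc k′ ≡ k) (ℓ+ℓ′≡k : ℓ + ℓ′ ≡ k) where

  private
    instance
      k≢0 : NonZero k
      k≢0 = >-nonZero (m<n⇒0<n k>3)

    G : Graph k
    G = chordedCycle k ℓ k>3 2≤ℓ ℓ≤k-2

    2≤ℓ′ : 2 ≤ ℓ′
    2≤ℓ′ = +-cancelˡ-≤ ℓ 2 ℓ′ (begin
      ℓ + 2     ≤⟨ +-monoˡ-≤ 2 ℓ≤k-2 ⟩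
      k ∸ 2 + 2 ≡⟨ m∸n+n≡m (≤-trans (s≤s (s≤s z≤n)) k>3) ⟩
      k         ≡⟨ ℓ+ℓ′≡k ⟨
      ℓ + ℓ′    ∎)
      where open ≤-Reasoning

    suc<k′ : ∀ {a b} → a + b ≡ k → 2 ≤ b → a < k′
    suc<k′ {a} {b} a+b≡k 2≤b = s≤s⁻¹ (≤-trans (≤-reflexive (+-comm 2 a)) (≤-trans (+-monoʳ-≤ a 2≤b) (≤-reflexive (trans a+b≡k (sym 1+k′≡k)))))

    ℓ<k′ : ℓ < k′
    ℓ<k′ = suc<k′ ℓ+ℓ′≡k 2≤ℓ′

    ℓ′<k′ : ℓ′ < k′
    ℓ′<k′ = suc<k′ (trans (+-comm ℓ′ ℓ) ℓ+ℓ′≡k) 2≤ℓ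

    k′<k : k′ < k
    k′<k = ≤-reflexive 1+k′≡k

    arc : ℕ → Fin k → Fin k → Bool
    arc d u v = does (v Fin.≟ shift d u)

    arc-disjoint : ∀ {d d′} → d < d′ → d′ < k → ∀ u v → Disjoint (arc d u v) (arc d′ u v)
    arc-disjoint d<d′ d′<k u v = ≟-disjoint {v = v} (shift-distinct d<d′ d′<k u)

    arc-disjoint′ : ∀ {d d′} → d ≢ d′ → d < k → d′ < k → ∀ u v → Disjoint (arc d u v) (arc d′ u v)
    arc-disjoint′ {d} {d′} d≢d′ d<k d′<k u v with <-cmp d d′
    ... | tri< d<d′ _ _ = arc-disjoint d<d′ d′<k u v
    ... | tri≈ _ d≡d′ _ = contradiction d≡d′ d≢d′
    ... | tri> _ _ d′<d = disjoint-sym (arc-disjoint d′<d d<k u v)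

    adj-arcs : ∀ u v → edge G u v ≡ bit ((arc 1 u v ∨ arc ℓ u v) ∨ (arc k′ u v ∨ arc ℓ′ u v))
    adj-arcs u v = cong₂ (λ a b → bit ((arc 1 u v ∨ arc ℓ u v) ∨ (a ∨ b)))
      (reverse-arc 1+k′≡k u v) (reverse-arc ℓ+ℓ′≡k u v)

  circulant₄ : ℓ ≢ ℓ′ → Circulant G (1 ∷ k′ ∷ ℓ ∷ ℓ′ ∷ [])
  circulant₄ ℓ≢ℓ′ = circulant G (1 ∷ k′ ∷ ℓ ∷ ℓ′ ∷ []) λ u v → begin
    edge G u v
      ≡⟨ adj-arcs u v ⟩
    bit ((arc 1 u v ∨ arc ℓ u v) ∨ (arc k′ u v ∨ arc ℓ′ u v))
      ≡⟨ bit-∨ (∨-disjoint (disjoint-sym (∨-disjoint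
           (disjoint-sym (arc-disjoint (≤-trans 2≤ℓ (<⇒≤ ℓ<k′)) k′<k u v)) (disjoint-sym (arc-disjoint 2≤ℓ′ (<-trans ℓ′<k′ k′<k) u v))))
           (disjoint-sym (∨-disjoint (disjoint-sym (arc-disjoint ℓ<k′ k′<k u v))
           (arc-disjoint′ (≢-sym ℓ≢ℓ′) (<-trans ℓ′<k′ k′<k) (<-trans ℓ<k′ k′<k) u v)))) ⟩
    bit (arc 1 u v ∨ arc ℓ u v) + bit (arc k′ u v ∨ arc ℓ′ u v)
      ≡⟨ cong₂ _+_ (bit-∨ (arc-disjoint 2≤ℓ (<-trans ℓ<k′ k′<k) u v)) (bit-∨ (disjoint-sym (arc-disjoint ℓ′<k′ k′<k u v))) ⟩
    bit (arc 1 u v) + bit (arc ℓ u v) + (bit (arc k′ u v) + bit (arc ℓ′ u v))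
      ≡⟨ reorder (bit (arc 1 u v)) (bit (arc ℓ u v)) (bit (arc k′ u v)) (bit (arc ℓ′ u v)) ⟩
    bit (arc 1 u v) + (bit (arc k′ u v) + (bit (arc ℓ u v) + (bit (arc ℓ′ u v) + 0))) ∎
    where
    open ≡-Reasoning
    reorder : ∀ a b c d → a + b + (c + d) ≡ a + (c + (b + (d + 0)))
    reorder = solve-∀

  -- A chord to the opposite vertex is its own reverse, so the two chord arcs coincide and the graph
  -- is cubic.
  circulant₃ : ℓ ≡ ℓ′ → Circulant G (1 ∷ k′ ∷ ℓ ∷ [])
  circulant₃ refl = circulant G (1 ∷ k′ ∷ ℓ ∷ []) λ u v → begin
    edge G u v
      ≡⟨ adj-arcs u v ⟩
    bit ((arc 1 u v ∨ arc ℓ u v) ∨ (arc k′ u v ∨ arc ℓ u v))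
      ≡⟨ cong bit (absorb (arc 1 u v) (arc ℓ u v) (arc k′ u v)) ⟩
    bit ((arc 1 u v ∨ arc ℓ u v) ∨ arc k′ u v)
      ≡⟨ bit-∨ (∨-disjoint (arc-disjoint (≤-trans 2≤ℓ (<⇒≤ ℓ<k′)) k′<k u v) (arc-disjoint ℓ<k′ k′<k u v)) ⟩
    bit (arc 1 u v ∨ arc ℓ u v) + bit (arc k′ u v)
      ≡⟨ cong (_+ bit (arc k′ u v)) (bit-∨ (arc-disjoint 2≤ℓ (<-trans ℓ<k′ k′<k) u v)) ⟩
    bit (arc 1 u v) + bit (arc ℓ u v) + bit (arc k′ u v)
      ≡⟨ reorder (bit (arc 1 u v)) (bit (arc ℓ u v)) (bit (arc k′ u v)) ⟩
    bit (arc 1 u v) + (bit (arc k′ u v) + (bit (arc ℓ u v) + 0)) ∎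
    where
    open ≡-Reasoning
    absorb : ∀ a b c → (a ∨ b) ∨ (c ∨ b) ≡ (a ∨ b) ∨ c
    absorb true  b     c     = refl
    absorb false true  c     = refl
    absorb false false c     = Bool.∨-identityʳ c
    reorder : ∀ a b c → a + b + c ≡ a + (c + (b + 0))
    reorder = solve-∀

-- Intervals, spreads and even numbers modulo k

≤-by : ∀ d {x y} → x + d ≡ y → x ≤ y
≤-by d refl = m≤m+n _ d

2+2* : ∀ q → suc (suc (2 * q)) ≡ 2 * suc q
2+2* = solve-∀

even⊎odd : ∀ n → ∃[ a ] (n ≡ 2 * a ⊎ n ≡ suc (2 * a))
even⊎odd zero = 0 , inj₁ refl
even⊎odd (suc n) with even⊎odd n
... | a , inj₁ refl = a , inj₂ refl
... | a , inj₂ refl = suc a , inj₁ (2+2* a)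

mem-∷-no : ∀ {x y} xs → y ≢ x → mem (x ∷ xs) y ≡ mem xs y
mem-∷-no {x} {y} xs y≢x = cong (_∨ mem xs y) (dec-false (y ≟ x) y≢x)

mem-∷-yes : ∀ {x y} xs → y ≡ x → mem (x ∷ xs) y ≡ true
mem-∷-yes {x} {y} xs y≡x = cong (_∨ mem xs y) (dec-true (y ≟ x) y≡x)

mem-∷-old : ∀ x {y} xs → mem xs y ≡ true → mem (x ∷ xs) y ≡ true
mem-∷-old x {y} xs y∈ = trans (cong (does (y ≟ x) ∨_) y∈) (Bool.∨-zeroʳ _)

mem-downFrom-< : ∀ {w y} → y < w → mem (downFrom w) y ≡ true
mem-downFrom-< {suc w} {y} (s≤s y≤w) with y ≟ w
... | yes y≡w = mem-∷-yes (downFrom w) y≡w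
... | no  y≢w = mem-∷-old w (downFrom w) (mem-downFrom-< (≤∧≢⇒< y≤w y≢w))

mem-downFrom-≥ : ∀ w {y} → w ≤ y → mem (downFrom w) y ≡ false
mem-downFrom-≥ zero    _   = refl
mem-downFrom-≥ (suc w) w<y = trans (mem-∷-no (downFrom w) (>⇒≢ w<y)) (mem-downFrom-≥ w (<⇒≤ w<y))

simple-downFrom : ∀ {k w} → w ≤ k → Simple k (downFrom w)
simple-downFrom {w = zero}  _   = tt
simple-downFrom {w = suc w} w<k = w<k , mem-downFrom-≥ w ≤-refl , simple-downFrom (<⇒≤ w<k)

-- The extra elements w+1, w+3, … are pairwise nonconsecutive, and not consecutive to the interval.
spread : ℕ → ℕ → List ℕ
spread w zero    = downFrom w
spread w (suc r) = w + suc (2 * r) ∷ spread w r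

mem-spread-< : ∀ {w y} r → y < w → mem (spread w r) y ≡ true
mem-spread-< zero    y<w = mem-downFrom-< y<w
mem-spread-< {w} (suc r) y<w = mem-∷-old (w + suc (2 * r)) (spread w r) (mem-spread-< r y<w)

mem-spread-even : ∀ w z r → mem (spread w r) (w + 2 * z) ≡ false
mem-spread-even w z zero    = mem-downFrom-≥ w (m≤m+n w (2 * z))
mem-spread-even w z (suc r) =
  trans (mem-∷-no (spread w r) (even≢odd z r ∘ +-cancelˡ-≡ w _ _)) (mem-spread-even w z r)

mem-spread-≥ : ∀ {w y} r → w + 2 * r ≤ y → mem (spread w r) y ≡ false
mem-spread-≥ {w} zero    w≤y = mem-downFrom-≥ w (≤-trans (m≤m+n w 0) w≤y)
mem-spread-≥ {w} {y} (suc r) w≤y = trans (mem-∷-no (spread w r) (>⇒≢ (≤-trans (≤-reflexive (two w r)) w≤y)))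
  (mem-spread-≥ r (≤-trans (+-monoʳ-≤ w (*-monoʳ-≤ 2 (n≤1+n r))) w≤y))
  where
  two : ∀ w r → suc (w + suc (2 * r)) ≡ w + 2 * suc r
  two = solve-∀

simple-spread : ∀ {k w} r → w + 2 * r ≤ k → Simple k (spread w r)
simple-spread {k} {w} zero    w≤k = simple-downFrom (≤-trans (m≤m+n w 0) w≤k)
simple-spread {k} {w} (suc r) w≤k =
  ≤-trans (≤-reflexive (two w r)) w≤k ,
  mem-spread-≥ r (+-monoʳ-≤ w (n≤1+n (2 * r))) ,
  simple-spread r (≤-trans (+-monoʳ-≤ w (*-monoʳ-≤ 2 (n≤1+n r))) w≤k)
  where
  two : ∀ w r → suc (w + suc (2 * r)) ≡ w + 2 * suc r
  two = solve-∀

evens : ℕ → List ℕ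
evens zero    = []
evens (suc q) = 2 * q ∷ evens q

length-evens : ∀ q → length (evens q) ≡ q
length-evens zero    = refl
length-evens (suc q) = cong suc (length-evens q)

mem-evens-≥ : ∀ q {y} → 2 * q ≤ y → mem (evens q) y ≡ false
mem-evens-≥ zero        _    = refl
mem-evens-≥ (suc q) {y} 2q≤y = trans (mem-∷-no (evens q) (>⇒≢ 2q<y)) (mem-evens-≥ q (<⇒≤ 2q<y))
  where
  2q<y : 2 * q < y
  2q<y = ≤-trans (≤-trans (n≤1+n _) (≤-reflexive (2+2* q))) 2q≤y

mem-evens-odd : ∀ q z → mem (evens q) (suc (2 * z)) ≡ false
mem-evens-odd zero    z = refl
mem-evens-odd (suc q) z = trans (mem-∷-no (evens q) (≢-sym (even≢odd q z))) (mem-evens-odd q z)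

mem-evens-even : ∀ {q z} → z < q → mem (evens q) (2 * z) ≡ true
mem-evens-even {suc q} {z} (s≤s z≤q) with z ≟ q
... | yes refl = mem-∷-yes (evens q) refl
... | no  z≢q  = mem-∷-old (2 * q) (evens q) (mem-evens-even (≤∧≢⇒< z≤q z≢q))

simple-evens : ∀ {k} q → 2 * q ≤ k → Simple k (evens q)
simple-evens zero    _    = tt
simple-evens (suc q) 2q≤k =
  2q<k , mem-evens-≥ q ≤-refl , simple-evens q (<⇒≤ 2q<k)
  where
  2q<k : 2 * q < _
  2q<k = ≤-trans (≤-trans (n≤1+n _) (≤-reflexive (2+2* q))) 2q≤k

Odd : ℕ → Set
Odd n = ∃[ e ] n ≡ suc (2 * e)

at : ∀ xs {z y b} → z ≡ y → mem xs y ≡ b → bit (mem xs z) ≡ bit b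
at xs refl refl = refl

module _ {k : ℕ} .{{_ : NonZero k}} where

  land : ∀ x d {y} → x + d ≡ y → y < k → (x + d) % k ≡ y
  land x d refl y<k = m<n⇒m%n≡m y<k

  wrap : ∀ x d {y} → x + d ≡ y + k → y < k → (x + d) % k ≡ y
  wrap x d {y} x+d≡y+k y<k = trans (cong (_% k) x+d≡y+k) (trans ([m+n]%n≡m%n y k) (m<n⇒m%n≡m y<k))

  -- A step by d is a step by − d′ when d + d′ = k.
  back : ∀ x d {y d′} → d + d′ ≡ k → y + d′ ≡ x → y < k → (x + d) % k ≡ y
  back x d {y} {d′} refl refl = wrap x d (trans (+-assoc y d′ d) (cong (y +_) (+-comm d′ d)))

  -- When x joins [0, x), a step by `d` meets the set only if it wraps around, and then it is a step
  -- back by k - d ≤ x. So `d` contributes once for every x with k - d ≤ x < w.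
  inner-downFrom : ∀ {D} w → w ≤ k → (∀ {d} → d ∈ D → d < k) → inner D (downFrom w) ≡ ∑[ d ∈ D ] (w ∸ (k ∸ d))
  inner-downFrom {D} zero _ _ =
    sym (trans (∑-cong D (λ d → 0∸n≡0 (k ∸ d))) (trans (∑-const D 0) (*-zeroʳ (length D))))
  inner-downFrom {D} (suc w) w<k D<k = begin
    gain D (downFrom w) w + inner D (downFrom w)
      ≡⟨ cong (gain D (downFrom w) w +_) (inner-downFrom w (<⇒≤ w<k) D<k) ⟩
    gain D (downFrom w) w + ∑[ d ∈ D ] (w ∸ (k ∸ d))
      ≡⟨ ∑-+ D _ _ ⟨
    ∑[ d ∈ D ] (bit (mem (downFrom w) ((w + d) % k)) + (w ∸ (k ∸ d)))
      ≡⟨ ∑-cong∈ D step ⟩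
    ∑[ d ∈ D ] (suc w ∸ (k ∸ d)) ∎
    where
    open ≡-Reasoning
    step : ∀ {d} → d ∈ D → bit (mem (downFrom w) ((w + d) % k)) + (w ∸ (k ∸ d)) ≡ suc w ∸ (k ∸ d)
    step {d} d∈D with k ∸ d ≤? w
    ... | yes k∸d≤w = trans (cong (_+ (w ∸ (k ∸ d))) (at (downFrom w) (back w d d+d′≡k (m∸n+n≡m k∸d≤w) (<-trans y<w w<k)) (mem-downFrom-< y<w)))
                        (sym (+-∸-assoc 1 k∸d≤w))
      where
      d+d′≡k : d + (k ∸ d) ≡ k
      d+d′≡k = m+[n∸m]≡n (<⇒≤ (D<k d∈D))
      y<w : w ∸ (k ∸ d) < w
      y<w = ∸-monoʳ-< (m<n⇒0<n∸m (D<k d∈D)) k∸d≤w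
    ... | no  k∸d≰w = trans (cong₂ _+_ (at (downFrom w) (land w d refl w+d<k) (mem-downFrom-≥ w (m≤m+n w d))) (m≤n⇒m∸n≡0 (<⇒≤ w<k∸d)))
                        (sym (m≤n⇒m∸n≡0 w<k∸d))
      where
      w<k∸d : w < k ∸ d
      w<k∸d = ≰⇒> k∸d≰w
      w+d<k : w + d < k
      w+d<k = ≤-trans (+-monoˡ-≤ d w<k∸d) (≤-reflexive (m∸n+n≡m (<⇒≤ (D<k d∈D))))

  module _ {k′ : ℕ} (1+k′≡k : suc k′ ≡ k) where

    private
      k′+1≡k : k′ + 1 ≡ k
      k′+1≡k = trans (+-comm k′ 1) 1+k′≡k

    -- The cycle neighbors of the new vertex lie at even offsets from `w`, where a spread has no
    -- elements, so only the chords in `D` can contribute edges.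
    gain-spread : ∀ D {w} r → w + 2 * suc r < k →
      gain (1 ∷ k′ ∷ D) (spread w r) (w + suc (2 * r)) ≡ gain D (spread w r) (w + suc (2 * r))
    gain-spread D {w} r w+2r<k = cong₂ (λ a b → a + (b + gain D (spread w r) (w + suc (2 * r))))
      (at (spread w r) (land (w + suc (2 * r)) 1 (up w r) w+2r<k) (mem-spread-even w (suc r) r))
      (at (spread w r) (back (w + suc (2 * r)) k′ k′+1≡k (down w r)
        (<-trans (+-monoʳ-< w (*-monoʳ-< 2 (n<1+n r))) w+2r<k)) (mem-spread-even w r r))
      where
      up : ∀ w r → w + suc (2 * r) + 1 ≡ w + 2 * suc r
      up = solve-∀
      down : ∀ w r → w + 2 * r + 1 ≡ w + suc (2 * r)
      down = solve-∀

  -- A step by `d` is a step back by `d′`. From x = w + 1 + 2 r it reaches x - d′, and 2 r + 1 < d′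
  -- puts this below `w`, into the interval itself, where parity is irrelevant.
  chord-in : ∀ {d d′ w} r → d + d′ ≡ k → w ≤ k → d′ ≤ w + suc (2 * r) → suc (2 * r) < d′ →
    bit (mem (spread w r) ((w + suc (2 * r) + d) % k)) ≡ 1
  chord-in {d} {d′} {w} r d+d′≡k w≤k d′≤x x<w+d′ =
    at (spread w r) (back (w + suc (2 * r)) d d+d′≡k (m∸n+n≡m d′≤x) (≤-trans y<w w≤k)) (mem-spread-< r y<w)
    where
    y<w : w + suc (2 * r) ∸ d′ < w
    y<w = +-cancelʳ-< d′ _ _ (≤-trans (≤-reflexive (cong suc (m∸n+n≡m d′≤x))) (≤-trans (≤-reflexive (sym (+-suc w (suc (2 * r))))) (+-monoʳ-≤ w x<w+d′)))

  -- For x < d′ = k - d the step does not wrap around and ends beyond all listed vertices.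
  chord-out : ∀ {d d′ w} r → d + d′ ≡ k → w + suc (2 * r) < d′ →
    bit (mem (spread w r) ((w + suc (2 * r) + d) % k)) ≡ 0
  chord-out {d} {d′} {w} r d+d′≡k x<d′ = at (spread w r)
    (land (w + suc (2 * r)) d refl (≤-trans (+-monoˡ-≤ d x<d′) (≤-reflexive (trans (+-comm d′ d) d+d′≡k))))
    (mem-spread-≥ r (≤-trans (+-monoʳ-≤ w (n≤1+n (2 * r))) (m≤m+n _ d)))

  odd-% : ∀ j i {d} → k ≡ 2 * j → Odd d → Odd ((2 * i + d) % k)
  odd-% j i {d} k≡2j (e , refl) with even⊎odd ((2 * i + d) % k)
  ... | z , inj₂ odd = z , odd
  ... | z , inj₁ even = contradiction (begin
    2 * (z + (2 * i + d) / k * j)             ≡⟨ distrib z ((2 * i + d) / k) j ⟩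
    2 * z + (2 * i + d) / k * (2 * j)         ≡⟨ cong₂ (λ a b → a + (2 * i + d) / k * b) even k≡2j ⟨
    (2 * i + d) % k + (2 * i + d) / k * k     ≡⟨ m≡m%n+[m/n]*n (2 * i + d) k ⟨
    2 * i + d                                 ≡⟨ odd i e ⟩
    suc (2 * (i + e))                         ∎) (even≢odd (z + (2 * i + d) / k * j) (i + e))
    where
    open ≡-Reasoning
    distrib : ∀ z c j → 2 * (z + c * j) ≡ 2 * z + c * (2 * j)
    distrib = solve-∀
    odd : ∀ i e → 2 * i + suc (2 * e) ≡ suc (2 * (i + e))
    odd = solve-∀

  mem-evens-odd-% : ∀ j q i {d} → k ≡ 2 * j → Odd d → bit (mem (evens q) ((2 * i + d) % k)) ≡ 0
  mem-evens-odd-% j q i k≡2j d-odd with odd-% j i k≡2j d-odd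
  ... | z , eq = at (evens q) eq (mem-evens-odd q z)

  -- As `k` is even, parity survives reduction modulo `k`. With odd steps only, the graph is
  -- bipartite by parity and its even vertices are independent.
  inner-evens : ∀ j {D} q → k ≡ 2 * j → (∀ {d} → d ∈ D → Odd d) → inner D (evens q) ≡ 0
  inner-evens j zero    k≡2j D-odd = refl
  inner-evens j {D} (suc q) k≡2j D-odd = cong₂ _+_
    (trans (∑-cong∈ D (λ d∈D → mem-evens-odd-% j q q k≡2j (D-odd d∈D))) (trans (∑-const D 0) (*-zeroʳ (length D))))
    (inner-evens j q k≡2j D-odd)

-- Sets inducing half of the edges, ℓ ≠ k / 2

∸-by : ∀ z y {x} → z + y ≡ x → x ∸ y ≡ z
∸-by z y refl = m+n∸n≡m z y

complement : ∀ a b {k} → a + b ≡ k → k ∸ a ≡ b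
complement a b refl = m+n∸m≡n a b

module FourRegular {k′ : ℕ} (ℓ ℓ′ : ℕ) (ℓ+ℓ′≡k : ℓ + ℓ′ ≡ suc k′) where

  D : List ℕ
  D = 1 ∷ k′ ∷ ℓ ∷ ℓ′ ∷ []

  -- The 4-regular graph has 2 k edges, so the set has to induce exactly k.
  Half : Set
  Half = ∃[ xs ] (Simple (suc k′) xs × inner {suc k′} D xs ≡ suc k′)

  private
    N : ℕ
    N = suc k′

    ℓ′+ℓ≡k : ℓ′ + ℓ ≡ N
    ℓ′+ℓ≡k = trans (+-comm ℓ′ ℓ) ℓ+ℓ′≡k

    below : ∀ {x} → x < ℓ + ℓ′ → x < N
    below x< = ≤-trans x< (≤-reflexive ℓ+ℓ′≡k)

  -- `α`, `β` and `γ` count the cycle edges and the chords spanning `ℓ` and `ℓ′` in [0, w). Since w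
  -- < k, no cycle edge closes up around the end.
  base : ∀ w {α β γ} → 0 < ℓ → 0 < ℓ′ → w < ℓ + ℓ′ → w ∸ 1 ≡ α → w ∸ ℓ ≡ β → w ∸ ℓ′ ≡ γ →
    inner {N} D (spread w 0) ≡ α + β + γ
  base w {α} {β} {γ} 0<ℓ 0<ℓ′ w<k w∸1 w∸ℓ w∸ℓ′ = begin
    inner {N} D (downFrom w)
      ≡⟨ inner-downFrom w (<⇒≤ (below w<k)) D<k ⟩
    (w ∸ k′) + ((w ∸ (N ∸ k′)) + ((w ∸ (N ∸ ℓ)) + ((w ∸ (N ∸ ℓ′)) + 0)))
      ≡⟨ cong₂ _+_ (m≤n⇒m∸n≡0 (s≤s⁻¹ (below w<k))) (cong₂ _+_
           (trans (cong (w ∸_) (complement k′ 1 (+-comm k′ 1))) w∸1) (cong₂ _+_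
           (trans (cong (w ∸_) (complement ℓ ℓ′ ℓ+ℓ′≡k)) w∸ℓ′) (cong (_+ 0)
           (trans (cong (w ∸_) (complement ℓ′ ℓ ℓ′+ℓ≡k)) w∸ℓ)))) ⟩
    0 + (α + (γ + (β + 0)))
      ≡⟨ reorder α β γ ⟩
    α + β + γ ∎
    where
    open ≡-Reasoning
    reorder : ∀ α β γ → 0 + (α + (γ + (β + 0))) ≡ α + β + γ
    reorder = solve-∀
    D<k : ∀ {d} → d ∈ D → d < N
    D<k (here refl) = s≤s (≤-trans 0<ℓ (s≤s⁻¹ (≤-trans (≤-trans (≤-reflexive (+-comm 1 ℓ)) (+-monoʳ-≤ ℓ 0<ℓ′)) (≤-reflexive ℓ+ℓ′≡k))))
    D<k (there (here refl)) = ≤-refl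
    D<k (there (there (here refl))) = ≤-trans (≤-trans (≤-reflexive (+-comm 1 ℓ)) (+-monoʳ-≤ ℓ 0<ℓ′)) (≤-reflexive ℓ+ℓ′≡k)
    D<k (there (there (there (here refl)))) = ≤-trans (+-monoˡ-≤ ℓ′ 0<ℓ) (≤-reflexive ℓ+ℓ′≡k)

  -- A record, so that conversion checking does not unfold the list spread w r.
  record Inner (w r e : ℕ) : Set where
    constructor inner≡
    field equation : inner {N} D (spread w r) ≡ e

  base-low : ∀ w α β → 0 < ℓ → 0 < ℓ′ → w < ℓ + ℓ′ → α + 1 ≡ w → β + ℓ ≡ w → w ≤ ℓ′ → Inner w 0 (α + β + 0)
  base-low w α β 0<ℓ 0<ℓ′ w<k α+1≡w β+ℓ≡w w≤ℓ′ =
    inner≡ (base w 0<ℓ 0<ℓ′ w<k (∸-by α 1 α+1≡w) (∸-by β ℓ β+ℓ≡w) (m≤n⇒m∸n≡0 w≤ℓ′))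

  base-high : ∀ w α β γ → 0 < ℓ → 0 < ℓ′ → w < ℓ + ℓ′ → α + 1 ≡ w → β + ℓ ≡ w → γ + ℓ′ ≡ w → Inner w 0 (α + β + γ)
  base-high w α β γ 0<ℓ 0<ℓ′ w<k α+1≡w β+ℓ≡w γ+ℓ′≡w =
    inner≡ (base w 0<ℓ 0<ℓ′ w<k (∸-by α 1 α+1≡w) (∸-by β ℓ β+ℓ≡w) (∸-by γ ℓ′ γ+ℓ′≡w))

  -- The vertex x = w + 1 + 2 r is joined to [0, w) by the chord to x − ℓ and, once ℓ′ ≤ x, also by the one to x + ℓ − k.
  low : ∀ w r {e} → w + 2 * suc r < ℓ + ℓ′ → ℓ ≤ w + suc (2 * r) → suc (2 * r) < ℓ → w + suc (2 * r) < ℓ′ →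
    Inner w r e → Inner w (suc r) (1 + e)
  low w r w+2r<k ℓ≤x 2r<ℓ x<ℓ′ (inner≡ eq) = inner≡ (cong₂ _+_
    (trans (gain-spread refl (ℓ ∷ ℓ′ ∷ []) r (below w+2r<k))
      (cong₂ (λ a b → a + (b + 0)) (chord-out r ℓ+ℓ′≡k x<ℓ′)
        (chord-in r ℓ′+ℓ≡k (m+n≤o⇒m≤o w (<⇒≤ (below w+2r<k))) ℓ≤x 2r<ℓ)))
    eq)

  high : ∀ w r {e} → w + 2 * suc r < ℓ + ℓ′ → ℓ ≤ w + suc (2 * r) → suc (2 * r) < ℓ →
    ℓ′ ≤ w + suc (2 * r) → suc (2 * r) < ℓ′ → Inner w r e → Inner w (suc r) (2 + e)
  high w r w+2r<k ℓ≤x 2r<ℓ ℓ′≤x 2r<ℓ′ (inner≡ eq) = inner≡ (cong₂ _+_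
    (trans (gain-spread refl (ℓ ∷ ℓ′ ∷ []) r (below w+2r<k))
      (cong₂ (λ a b → a + (b + 0)) (chord-in r ℓ+ℓ′≡k w≤k ℓ′≤x 2r<ℓ′) (chord-in r ℓ′+ℓ≡k w≤k ℓ≤x 2r<ℓ)))
    eq)
    where
    w≤k : w ≤ N
    w≤k = m+n≤o⇒m≤o w (<⇒≤ (below w+2r<k))

  done : ∀ w r {e} → w + 2 * r ≤ ℓ + ℓ′ → Inner w r e → e ≡ ℓ + ℓ′ → Half
  done w r w+2r≤k (inner≡ eq) e≡ =
    spread w r , simple-spread r (≤-trans w+2r≤k (≤-reflexive ℓ+ℓ′≡k)) , trans eq (trans e≡ ℓ+ℓ′≡k)

open FourRegular using (Half)

-- For ℓ ≤ w ≤ ℓ′ the interval has 2 w - ℓ - 1 edges. With k even and ℓ odd this equals k for w = (k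
-- + ℓ + 1) / 2, and 2 ℓ < ℓ′ gives w ≤ ℓ′.
half-far-odd : ∀ a s {k′} (eq : (1 + 2 * a) + (3 + 4 * a + 2 * s) ≡ suc k′) → Half (1 + 2 * a) (3 + 4 * a + 2 * s) eq
half-far-odd a s eq = done (3 + 4 * a + s) 0 (≤-by (1 + 2 * a + s) (solve (a ∷ s ∷ [])))
    (base-low (3 + 4 * a + s) (2 + 4 * a + s) (2 + 2 * a + s) (≤-by (2 * a) (solve (a ∷ s ∷ []))) (≤-by (2 + 4 * a + 2 * s) (solve (a ∷ s ∷ [])))
        (≤-by (2 * a + s) (solve (a ∷ s ∷ []))) (solve (a ∷ s ∷ [])) (solve (a ∷ s ∷ [])) (≤-by s (solve (a ∷ s ∷ []))))
    (solve (a ∷ s ∷ []))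
  where
  open FourRegular (1 + 2 * a) (3 + 4 * a + 2 * s) eq

-- For even ℓ the count 2 w - ℓ - 1 is odd, so one extra vertex with a single chord is added to w =
-- (k + ℓ) / 2. It has a single chord as long as w + 1 < ℓ′, that is, 2 ℓ + 2 < ℓ′.
half-far-even : ∀ a s {k′} (eq : (2 + 2 * a) + (8 + 4 * a + 2 * s) ≡ suc k′) → Half (2 + 2 * a) (8 + 4 * a + 2 * s) eq
half-far-even a s eq = done (6 + 4 * a + s) 1 (≤-by (2 + 2 * a + s) (solve (a ∷ s ∷ [])))
    (low (6 + 4 * a + s) 0 (≤-by (1 + 2 * a + s) (solve (a ∷ s ∷ [])))
        (≤-by (5 + 2 * a + s) (solve (a ∷ s ∷ [])))
        (≤-by (2 * a) (solve (a ∷ s ∷ [])))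
        (≤-by s (solve (a ∷ s ∷ [])))
    (base-low (6 + 4 * a + s) (5 + 4 * a + s) (4 + 2 * a + s) (≤-by (1 + 2 * a) (solve (a ∷ s ∷ []))) (≤-by (7 + 4 * a + 2 * s) (solve (a ∷ s ∷ [])))
        (≤-by (3 + 2 * a + s) (solve (a ∷ s ∷ []))) (solve (a ∷ s ∷ [])) (solve (a ∷ s ∷ [])) (≤-by (2 + s) (solve (a ∷ s ∷ [])))))
    (solve (a ∷ s ∷ []))
  where
  open FourRegular (2 + 2 * a) (8 + 4 * a + 2 * s) eq

-- Here ℓ′ = 2 ℓ + 2, and the extra vertex chosen in `half-far-even` would be ℓ′ itself, with two
-- chords. For w = 2 ℓ the interval lacks three edges: w + 1 < ℓ′ adds one, w + 3 > ℓ′ adds two. The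
-- chord from w + 3 ends in the interval because 3 < ℓ.
half-double+2 : ∀ a {k′} (eq : (4 + 2 * a) + (10 + 4 * a) ≡ suc k′) → Half (4 + 2 * a) (10 + 4 * a) eq
half-double+2 a eq = done (8 + 4 * a) 2 (≤-by (2 + 2 * a) (solve (a ∷ [])))
    (high (8 + 4 * a) 1 (≤-by (1 + 2 * a) (solve (a ∷ [])))
        (≤-by (7 + 2 * a) (solve (a ∷ [])))
        (≤-by (2 * a) (solve (a ∷ [])))
        (≤-by 1 (solve (a ∷ [])))
        (≤-by (6 + 4 * a) (solve (a ∷ [])))
    (low (8 + 4 * a) 0 (≤-by (3 + 2 * a) (solve (a ∷ [])))
        (≤-by (5 + 2 * a) (solve (a ∷ [])))
        (≤-by (2 + 2 * a) (solve (a ∷ [])))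
        (≤-by 0 (solve (a ∷ [])))
    (base-low (8 + 4 * a) (7 + 4 * a) (4 + 2 * a) (≤-by (3 + 2 * a) (solve (a ∷ []))) (≤-by (9 + 4 * a) (solve (a ∷ [])))
        (≤-by (5 + 2 * a) (solve (a ∷ []))) (solve (a ∷ [])) (solve (a ∷ [])) (≤-by 2 (solve (a ∷ []))))))
    (solve (a ∷ []))
  where
  open FourRegular (4 + 2 * a) (10 + 4 * a) eq

-- Here ℓ′ = 2 ℓ. For w = 2 ℓ - 2 the interval lacks five edges: w + 1 < ℓ′ adds one, w + 3 and w +
-- 5 add two each. The chord from w + 5 ends in the interval because 5 < ℓ.
half-double : ∀ a {k′} (eq : (6 + 2 * a) + (12 + 4 * a) ≡ suc k′) → Half (6 + 2 * a) (12 + 4 * a) eq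
half-double a eq = done (10 + 4 * a) 3 (≤-by (2 + 2 * a) (solve (a ∷ [])))
    (high (10 + 4 * a) 2 (≤-by (1 + 2 * a) (solve (a ∷ [])))
        (≤-by (9 + 2 * a) (solve (a ∷ [])))
        (≤-by (2 * a) (solve (a ∷ [])))
        (≤-by 3 (solve (a ∷ [])))
        (≤-by (6 + 4 * a) (solve (a ∷ [])))
    (high (10 + 4 * a) 1 (≤-by (3 + 2 * a) (solve (a ∷ [])))
        (≤-by (7 + 2 * a) (solve (a ∷ [])))
        (≤-by (2 + 2 * a) (solve (a ∷ [])))
        (≤-by 1 (solve (a ∷ [])))
        (≤-by (8 + 4 * a) (solve (a ∷ [])))
    (low (10 + 4 * a) 0 (≤-by (5 + 2 * a) (solve (a ∷ [])))
        (≤-by (5 + 2 * a) (solve (a ∷ [])))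
        (≤-by (4 + 2 * a) (solve (a ∷ [])))
        (≤-by 0 (solve (a ∷ [])))
    (base-low (10 + 4 * a) (9 + 4 * a) (4 + 2 * a) (≤-by (5 + 2 * a) (solve (a ∷ []))) (≤-by (11 + 4 * a) (solve (a ∷ [])))
        (≤-by (7 + 2 * a) (solve (a ∷ []))) (solve (a ∷ [])) (solve (a ∷ [])) (≤-by 2 (solve (a ∷ [])))))))
    (solve (a ∷ []))
  where
  open FourRegular (6 + 2 * a) (12 + 4 * a) eq

-- For w ≥ ℓ′ the interval has (w - 1) + (w - ℓ) + (w - ℓ′) = 3 w - 1 - k edges, and each extra
-- vertex adds two. With r of them the target requires 3 w = 2 k + 1 - 2 r, so k modulo 3 determines
-- r: here and in the next two lemmas k is 2, 1, 0 modulo 3 and r is 1, 0, 2.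
half-near₀ : ∀ p m {k′} (eq : (3 + 2 * p + 3 * m) + (5 + 4 * p + 3 * m) ≡ suc k′) → Half (3 + 2 * p + 3 * m) (5 + 4 * p + 3 * m) eq
half-near₀ p m eq = done (5 + 4 * p + 4 * m) 1 (≤-by (1 + 2 * p + 2 * m) (solve (p ∷ m ∷ [])))
    (high (5 + 4 * p + 4 * m) 0 (≤-by (2 * p + 2 * m) (solve (p ∷ m ∷ [])))
        (≤-by (3 + 2 * p + m) (solve (p ∷ m ∷ [])))
        (≤-by (1 + 2 * p + 3 * m) (solve (p ∷ m ∷ [])))
        (≤-by (1 + m) (solve (p ∷ m ∷ [])))
        (≤-by (3 + 4 * p + 3 * m) (solve (p ∷ m ∷ [])))
    (base-high (5 + 4 * p + 4 * m) (4 + 4 * p + 4 * m) (2 + 2 * p + m) m (≤-by (2 + 2 * p + 3 * m) (solve (p ∷ m ∷ []))) (≤-by (4 + 4 * p + 3 * m) (solve (p ∷ m ∷ [])))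
        (≤-by (2 + 2 * p + 2 * m) (solve (p ∷ m ∷ []))) (solve (p ∷ m ∷ [])) (solve (p ∷ m ∷ [])) (solve (p ∷ m ∷ []))))
    (solve (p ∷ m ∷ []))
  where
  open FourRegular (3 + 2 * p + 3 * m) (5 + 4 * p + 3 * m) eq

half-near₁ : ∀ p m {k′} (eq : (4 + 2 * p + 3 * m) + (6 + 4 * p + 3 * m) ≡ suc k′) → Half (4 + 2 * p + 3 * m) (6 + 4 * p + 3 * m) eq
half-near₁ p m eq = done (7 + 4 * p + 4 * m) 0 (≤-by (3 + 2 * p + 2 * m) (solve (p ∷ m ∷ [])))
    (base-high (7 + 4 * p + 4 * m) (6 + 4 * p + 4 * m) (3 + 2 * p + m) (1 + m) (≤-by (3 + 2 * p + 3 * m) (solve (p ∷ m ∷ []))) (≤-by (5 + 4 * p + 3 * m) (solve (p ∷ m ∷ [])))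
        (≤-by (2 + 2 * p + 2 * m) (solve (p ∷ m ∷ []))) (solve (p ∷ m ∷ [])) (solve (p ∷ m ∷ [])) (solve (p ∷ m ∷ [])))
    (solve (p ∷ m ∷ []))
  where
  open FourRegular (4 + 2 * p + 3 * m) (6 + 4 * p + 3 * m) eq

half-near₂ : ∀ p m {k′} (eq : (5 + 2 * p + 3 * m) + (7 + 4 * p + 3 * m) ≡ suc k′) → Half (5 + 2 * p + 3 * m) (7 + 4 * p + 3 * m) eq
half-near₂ p m eq = done (7 + 4 * p + 4 * m) 2 (≤-by (1 + 2 * p + 2 * m) (solve (p ∷ m ∷ [])))
    (high (7 + 4 * p + 4 * m) 1 (≤-by (2 * p + 2 * m) (solve (p ∷ m ∷ [])))
        (≤-by (5 + 2 * p + m) (solve (p ∷ m ∷ [])))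
        (≤-by (1 + 2 * p + 3 * m) (solve (p ∷ m ∷ [])))
        (≤-by (3 + m) (solve (p ∷ m ∷ [])))
        (≤-by (3 + 4 * p + 3 * m) (solve (p ∷ m ∷ [])))
    (high (7 + 4 * p + 4 * m) 0 (≤-by (2 + 2 * p + 2 * m) (solve (p ∷ m ∷ [])))
        (≤-by (3 + 2 * p + m) (solve (p ∷ m ∷ [])))
        (≤-by (3 + 2 * p + 3 * m) (solve (p ∷ m ∷ [])))
        (≤-by (1 + m) (solve (p ∷ m ∷ [])))
        (≤-by (5 + 4 * p + 3 * m) (solve (p ∷ m ∷ [])))
    (base-high (7 + 4 * p + 4 * m) (6 + 4 * p + 4 * m) (2 + 2 * p + m) m (≤-by (4 + 2 * p + 3 * m) (solve (p ∷ m ∷ []))) (≤-by (6 + 4 * p + 3 * m) (solve (p ∷ m ∷ [])))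
        (≤-by (4 + 2 * p + 2 * m) (solve (p ∷ m ∷ []))) (solve (p ∷ m ∷ [])) (solve (p ∷ m ∷ [])) (solve (p ∷ m ∷ [])))))
    (solve (p ∷ m ∷ []))
  where
  open FourRegular (5 + 2 * p + 3 * m) (7 + 4 * p + 3 * m) eq

-- For ℓ = 2 the construction of `half-double+2` fails, since the chord of span 2 from w + 3 ends
-- outside the interval. This explicit set induces 8 of the 16 edges.
inner-half-8-2 : (eq : 2 + 6 ≡ 8) → Half 2 6 eq
inner-half-8-2 eq = 0 ∷ 1 ∷ 2 ∷ 3 ∷ 5 ∷ 6 ∷ [] , (from-yes (0 <? 8) , refl , (from-yes (1 <? 8) , refl , (from-yes (2 <? 8) , refl , (from-yes (3 <? 8) , refl , (from-yes (5 <? 8) , refl , (from-yes (6 <? 8) , refl , tt)))))) , refl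

-- For ℓ = 4 the chord of span 4 from the vertex w + 5 of `half-double` ends outside the interval.
-- This explicit set induces 12 of the 24 edges.
inner-half-12-4 : (eq : 4 + 8 ≡ 12) → Half 4 8 eq
inner-half-12-4 eq = 0 ∷ 1 ∷ 2 ∷ 3 ∷ 4 ∷ 5 ∷ 8 ∷ 9 ∷ [] , (from-yes (0 <? 12) , refl , (from-yes (1 <? 12) , refl , (from-yes (2 <? 12) , refl , (from-yes (3 <? 12) , refl , (from-yes (4 <? 12) , refl , (from-yes (5 <? 12) , refl , (from-yes (8 <? 12) , refl , (from-yes (9 <? 12) , refl , tt)))))))) , refl

≤-diff : ∀ {m n} → m ≤ n → ∃[ d ] n ≡ m + d
≤-diff {m} {n} m≤n = n ∸ m , sym (m+[n∸m]≡n m≤n)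

even-rest : ∀ j b t → 2 * j ≡ 2 * b + t → ∃[ s ] t ≡ 2 * s
even-rest j b t eq with even⊎odd t
... | s , inj₁ t≡2s = s , t≡2s
... | s , inj₂ refl = contradiction (trans eq (shift-suc b s)) (even≢odd j (b + s))
  where
  shift-suc : ∀ b s → 2 * b + suc (2 * s) ≡ suc (2 * (b + s))
  shift-suc = solve-∀

mod₃ : ∀ n → ∃[ m ] (n ≡ 3 * m ⊎ n ≡ 1 + 3 * m ⊎ n ≡ 2 + 3 * m)
mod₃ zero = 0 , inj₁ refl
mod₃ (suc n) with mod₃ n
... | m , inj₁ refl        = m , inj₂ (inj₁ refl)
... | m , inj₂ (inj₁ refl) = m , inj₂ (inj₂ refl)
... | m , inj₂ (inj₂ refl) = suc m , inj₁ (3+3* m)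
  where
  3+3* : ∀ m → 3 + 3 * m ≡ 3 * suc m
  3+3* = solve-∀

half-cast : ∀ {k′} ℓ ℓ′ m m′ (eq : ℓ + ℓ′ ≡ suc k′) → ℓ ≡ m → ℓ′ ≡ m′ →
  ((eq′ : m + m′ ≡ suc k′) → Half m m′ eq′) → Half ℓ ℓ′ eq
half-cast ℓ ℓ′ m m′ eq refl refl half = half eq

-- As `k` is even, the gap ℓ′ - ℓ is even, say 2 + 2 s. With q = 2 ℓ - ℓ′ - 1 this gives k = 8 + 6 s
-- + 2 q, so the residue of q modulo 3 decides that of k.
half-near : ∀ j {k′ ℓ ℓ′} (eq : ℓ + ℓ′ ≡ suc k′) → 2 * j ≡ suc k′ → ℓ < ℓ′ → ℓ′ < 2 * ℓ → Half ℓ ℓ′ eq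
half-near j {k′} {ℓ} {ℓ′} eq 2j≡k ℓ<ℓ′ ℓ′<2ℓ with ≤-diff ℓ<ℓ′ | ≤-diff ℓ′<2ℓ
... | p , ℓ′≡ | q , 2ℓ≡ with even-rest j ℓ (1 + p) (trans 2j≡k (trans (sym eq) (trans (cong (ℓ +_) ℓ′≡) (reorder ℓ p))))
  where
  reorder : ∀ ℓ p → ℓ + (suc ℓ + p) ≡ 2 * ℓ + (1 + p)
  reorder = solve-∀
... | zero  , ()
... | suc s , 1+p≡ = by-residue (mod₃ q)
  where
  p≡ : p ≡ 1 + 2 * s
  p≡ = suc-injective (trans 1+p≡ (sym (2+2* s)))
  ℓ≡ : ℓ ≡ 3 + 2 * s + q
  ℓ≡ = +-cancelˡ-≡ ℓ ℓ _ (trans (cong (ℓ +_) (sym (+-identityʳ ℓ))) (trans 2ℓ≡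
    (trans (cong (λ x → suc x + q) (trans ℓ′≡ (cong (suc ℓ +_) p≡))) (reorder ℓ s q))))
    where
    reorder : ∀ ℓ s q → suc (suc ℓ + (1 + 2 * s)) + q ≡ ℓ + (3 + 2 * s + q)
    reorder = solve-∀
  ℓ′≡′ : ℓ′ ≡ 5 + 4 * s + q
  ℓ′≡′ = trans ℓ′≡ (trans (cong₂ (λ x y → suc x + y) ℓ≡ p≡) (reorder s q))
    where
    reorder : ∀ s q → suc (3 + 2 * s + q) + (1 + 2 * s) ≡ 5 + 4 * s + q
    reorder = solve-∀
  cast : ∀ n m → q ≡ n + 3 * m →
    (∀ {k′} (eq : 3 + n + 2 * s + 3 * m + (5 + n + 4 * s + 3 * m) ≡ suc k′) →
      Half (3 + n + 2 * s + 3 * m) (5 + n + 4 * s + 3 * m) eq) → Half ℓ ℓ′ eq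
  cast n m q≡ half = half-cast ℓ ℓ′ (3 + n + 2 * s + 3 * m) (5 + n + 4 * s + 3 * m) eq
    (trans ℓ≡ (trans (cong (3 + 2 * s +_) q≡) (solve (s ∷ n ∷ m ∷ []))))
    (trans ℓ′≡′ (trans (cong (5 + 4 * s +_) q≡) (solve (s ∷ n ∷ m ∷ [])))) half
  by-residue : ∃[ m ] (q ≡ 3 * m ⊎ q ≡ 1 + 3 * m ⊎ q ≡ 2 + 3 * m) → Half ℓ ℓ′ eq
  by-residue (m , inj₁ q≡)        = cast 0 m q≡ (half-near₀ s m)
  by-residue (m , inj₂ (inj₁ q≡)) = cast 1 m q≡ (half-near₁ s m)
  by-residue (m , inj₂ (inj₂ q≡)) = cast 2 m q≡ (half-near₂ s m)

-- 3 ℓ = k is even, hence so is ℓ: the value 2 is excluded, 4 is a single graph, and from 6 on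
-- `half-double` applies.
half-twice : ∀ j {k′ ℓ} (eq : ℓ + 2 * ℓ ≡ suc k′) → 2 * j ≡ suc k′ → 2 ≤ ℓ → ℓ ≢ 2 → Half ℓ (2 * ℓ) eq
half-twice j {ℓ = ℓ} eq 2j≡k 2≤ℓ ℓ≢2 with even-rest j ℓ ℓ (trans 2j≡k (trans (sym eq) (+-comm ℓ (2 * ℓ))))
... | 0 , refl = contradiction 2≤ℓ λ ()
... | 1 , refl = contradiction refl ℓ≢2
... | 2 , refl = special eq
  where
  special : ∀ {k′} (eq : 4 + 8 ≡ suc k′) → Half 4 8 eq
  special refl = inner-half-12-4 refl
... | suc (suc (suc a)) , refl =
  half-cast (2 * (3 + a)) (2 * (2 * (3 + a))) (6 + 2 * a) (12 + 4 * a) eq (solve (a ∷ [])) (solve (a ∷ [])) (half-double a)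

half-far : ∀ j {k′ ℓ ℓ′} (eq : ℓ + ℓ′ ≡ suc k′) → 2 * j ≡ suc k′ → 2 ≤ ℓ → 2 * ℓ < ℓ′ → Half ℓ ℓ′ eq
half-far j {k′} {ℓ} eq 2j≡k 2≤ℓ 2ℓ<ℓ′ with even⊎odd ℓ | ≤-diff 2ℓ<ℓ′
... | a , inj₂ refl | t , refl with even-rest j (2 + 3 * a) t (trans 2j≡k (trans (sym eq) (reorder a t)))
  where
  reorder : ∀ a t → suc (2 * a) + (suc (2 * suc (2 * a)) + t) ≡ 2 * (2 + 3 * a) + t
  reorder = solve-∀
...   | s , refl = half-cast (1 + 2 * a) (suc (2 * suc (2 * a)) + 2 * s) (1 + 2 * a) (3 + 4 * a + 2 * s) eq refl (solve (a ∷ s ∷ [])) (half-far-odd a s)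
half-far j {k′} {ℓ} eq 2j≡k 2≤ℓ 2ℓ<ℓ′ | zero , inj₁ refl | _ = contradiction 2≤ℓ λ ()
half-far j {k′} {ℓ} eq 2j≡k 2≤ℓ 2ℓ<ℓ′ | suc a , inj₁ refl | t , refl
  with even-rest j (3 * suc a) (1 + t) (trans 2j≡k (trans (sym eq) (reorder a t)))
  where
  reorder : ∀ a t → 2 * suc a + (suc (2 * (2 * suc a)) + t) ≡ 2 * (3 * suc a) + (1 + t)
  reorder = solve-∀
... | zero        , ()
... | suc (suc s) , 1+t≡ =
  half-cast (2 * suc a) (suc (2 * (2 * suc a)) + t) (2 + 2 * a) (8 + 4 * a + 2 * s) eq (solve (a ∷ [])) (trans (shuffle a t) (trans (cong (4 + 4 * a +_) 1+t≡) (solve (a ∷ s ∷ [])))) (half-far-even a s)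
  where
  shuffle : ∀ a t → suc (2 * (2 * suc a)) + t ≡ 4 + 4 * a + (1 + t)
  shuffle = solve-∀
-- Here ℓ′ = 2 ℓ + 2, the borderline that `half-far-even` does not reach.
... | suc zero    , 1+t≡ with a | suc-injective 1+t≡
...   | zero  | refl = special eq
  where
  special : ∀ {k′} (eq : 2 + 6 ≡ suc k′) → Half 2 6 eq
  special refl = inner-half-8-2 refl
...   | suc a | refl = half-cast (2 * (2 + a)) (suc (2 * (2 * (2 + a))) + 1) (4 + 2 * a) (10 + 4 * a) eq (solve (a ∷ [])) (solve (a ∷ [])) (half-double+2 a)

-- The interval [0, ℓ′) has 2 ℓ′ - ℓ - 1 edges, which is at least k = ℓ + ℓ′ exactly when 2 ℓ < ℓ′.
-- So comparing ℓ′ with 2 ℓ tells whether chords of span ℓ′ occur in an interval with about k edges.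
inner-half : ∀ j {k′ ℓ ℓ′} (eq : ℓ + ℓ′ ≡ suc k′) → 2 * j ≡ suc k′ → 2 ≤ ℓ → ℓ < ℓ′ → ¬ (ℓ ≡ 2 × ℓ′ ≡ 4) → Half ℓ ℓ′ eq
inner-half j {ℓ = ℓ} {ℓ′} eq 2j≡k 2≤ℓ ℓ<ℓ′ exceptional with <-cmp ℓ′ (2 * ℓ)
... | tri< ℓ′<2ℓ _ _ = half-near j eq 2j≡k ℓ<ℓ′ ℓ′<2ℓ
... | tri≈ _ refl _  = half-twice j eq 2j≡k 2≤ℓ λ { refl → exceptional (refl , refl) }
... | tri> _ _ 2ℓ<ℓ′ = half-far j eq 2j≡k 2≤ℓ 2ℓ<ℓ′

-- Balanced cuts, ℓ ≠ k / 2

isEven : ℕ → Bool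
isEven zero    = true
isEven (suc n) = not (isEven n)

isEven-+2* : ∀ x e → isEven (x + 2 * e) ≡ isEven x
isEven-+2* x zero    = cong isEven (+-identityʳ x)
isEven-+2* x (suc e) = trans (cong isEven (two x e)) (trans (Bool.not-involutive _) (isEven-+2* x e))
  where
  two : ∀ x e → x + 2 * suc e ≡ suc (suc (x + 2 * e))
  two = solve-∀

module _ {k : ℕ} .{{_ : NonZero k}} where

  isEven-% : ∀ j x → 2 * j ≡ k → isEven (x % k) ≡ isEven x
  isEven-% j x 2j≡k = trans (sym (isEven-+2* (x % k) (x / k * j))) (cong isEven (begin
    x % k + 2 * (x / k * j)   ≡⟨ cong (x % k +_) (rotate (x / k) j) ⟩
    x % k + x / k * (2 * j)   ≡⟨ cong (λ m → x % k + x / k * m) 2j≡k ⟩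
    x % k + x / k * k         ≡⟨ m≡m%n+[m/n]*n x k ⟨
    x                         ∎))
    where
    open ≡-Reasoning
    rotate : ∀ a b → 2 * (a * b) ≡ a * (2 * b)
    rotate = solve-∀

  record InnerHalf (D : List ℕ) : Set where
    field
      elements     : List ℕ
      simple       : Simple k elements
      {number}     : ℕ
      inner-number : inner D elements ≡ number
      upper        : 4 * number ≤ k * length D + 2
      lower        : k * length D ≤ 4 * number + 2

  -- The cut is never counted edge by edge: in a regular graph it follows from the size of the set
  -- and the number of edges inside.
  record CutHalf (D : List ℕ) : Set where
    field
      elements   : List ℕ
      simple     : Simple k elements
      {number}   : ℕ
      cut-number : number + (inner D elements + inner D elements) ≡ length elements * length D
      upper      : 4 * number ≤ k * length D + 2
      lower      : k * length D ≤ 4 * number + 2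

  halved-within : ∀ {D} (G : Graph k) → Circulant G D → InnerHalf D → ∃[ W ] Halved G (within W)
  halved-within {D} G circ I = subset elements ,
    halved {G = G} {D = D} circ _ number (trans (within-subset {G = G} {D = D} circ elements simple) inner-number) upper lower
    where open InnerHalf I

  halved-crossing : ∀ {D} (G : Graph k) → Circulant G D → CutHalf D → ∃[ W ] Halved G (crossing W)
  halved-crossing {D} G circ I = subset elements , halved {G = G} {D = D} circ _ number
    (+-cancelʳ-≡ (inner D elements + inner D elements) _ _ (trans (crossing-subset {G = G} {D = D} circ elements simple) (sym cut-number)))
    upper lower
    where open CutHalf I

  -- The parity cut consists of the odd arcs.
  halved-parity : ∀ j {k′ ℓ ℓ′} (G : Graph k) → Circulant G (1 ∷ k′ ∷ ℓ ∷ ℓ′ ∷ []) → 2 * j ≡ k → Odd k′ →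
    ∃[ a ] ℓ ≡ 2 * a → ∃[ a ] ℓ′ ≡ 2 * a → ∃[ W ] Halved G (crossing W)
  halved-parity j {k′} G circ 2j≡k (c , refl) (a , refl) (b , refl) = W , halved {G = G} {D = D} circ _ k
    (*-cancelˡ-≡ _ _ 2 (begin
      2 * count G (crossing W)
        ≡⟨ cong (count G (crossing W) +_) (+-identityʳ _) ⟩
      count G (crossing W) + count G (crossing W)
        ≡⟨ handshake G (crossing W) (λ u v → Bool.xor-comm (W u) (W v)) ⟩
      ∑[ u ∈ V ] (∑[ v ∈ V ] (edge G u v * bit (crossing W u v)))
        ≡⟨ ∑-cong V (λ u → circ u (bit ∘ crossing W u)) ⟩
      ∑[ u ∈ V ] (∑[ d ∈ D ] bit (crossing W u (shift d u)))
        ≡⟨ ∑-cong V (λ u → cong₂ _+_ (odd-arc u 0) (cong₂ _+_ (odd-arc u c) (cong₂ _+_ (even-arc u a) (cong (_+ 0) (even-arc u b))))) ⟩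
      ∑[ u ∈ V ] 2
        ≡⟨ trans (∑-allFin-const k 2) (*-comm k 2) ⟩
      2 * k ∎)) (≤-trans (≤-reflexive (*-comm 4 k)) (m≤m+n _ 2)) (≤-trans (≤-reflexive (*-comm k 4)) (m≤m+n _ 2))
    where
    open ≡-Reasoning
    V : List (Fin k)
    V = allFin k
    D : List ℕ
    D = 1 ∷ suc (2 * c) ∷ 2 * a ∷ 2 * b ∷ []
    W : Fin k → Bool
    W u = isEven (toℕ u)
    W-shift : ∀ d u → W (shift d u) ≡ isEven (toℕ u + d)
    W-shift d u = trans (cong isEven (toℕ-shift d u)) (isEven-% j (toℕ u + d) 2j≡k)
    xor-self : ∀ x → bit (x xor x) ≡ 0
    xor-self true  = refl
    xor-self false = refl
    xor-not : ∀ x → bit (x xor not x) ≡ 1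
    xor-not true  = refl
    xor-not false = refl
    even-arc : ∀ u e → bit (crossing W u (shift (2 * e) u)) ≡ 0
    even-arc u e = trans (cong (λ x → bit (W u xor x)) (trans (W-shift (2 * e) u) (isEven-+2* (toℕ u) e))) (xor-self (W u))
    odd-arc : ∀ u e → bit (crossing W u (shift (suc (2 * e)) u)) ≡ 1
    odd-arc u e = trans (cong (λ x → bit (W u xor x)) (trans (W-shift (suc (2 * e)) u)
      (trans (cong isEven (+-suc (toℕ u) (2 * e))) (cong not (isEven-+2* (toℕ u) e))))) (xor-not (W u))

half⇒innerHalf : ∀ {k′ ℓ ℓ′} {eq : ℓ + ℓ′ ≡ suc k′} → Half ℓ ℓ′ eq → InnerHalf {suc k′} (1 ∷ k′ ∷ ℓ ∷ ℓ′ ∷ [])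
half⇒innerHalf {k′} (xs , xs! , inner≡k) = record
  { elements     = xs
  ; simple       = xs!
  ; inner-number = inner≡k
  ; upper        = ≤-trans (≤-reflexive (*-comm 4 (suc k′))) (m≤m+n _ 2)
  ; lower        = ≤-trans (≤-reflexive (*-comm (suc k′) 4)) (m≤m+n _ 2)
  }

-- All four steps are odd, so the q even vertices are independent and their 4 q = k edges all cross.
odd-cut-0 : ∀ q {k′ ℓ ℓ′} → 2 * (2 * q) ≡ suc k′ → Odd k′ → Odd ℓ → Odd ℓ′ → CutHalf {suc k′} (1 ∷ k′ ∷ ℓ ∷ ℓ′ ∷ [])
odd-cut-0 q {k′} {ℓ} {ℓ′} 4q≡k k′-odd ℓ-odd ℓ′-odd = record
  { elements   = evens q
  ; simple     = simple-evens q (≤-trans (m≤m+n (2 * q) (2 * q + 0)) (≤-reflexive 4q≡k))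
  ; number     = suc k′
  ; cut-number = trans (cong (λ i → suc k′ + (i + i)) (inner-evens (2 * q) q (sym 4q≡k) D-odd))
                   (trans (+-identityʳ (suc k′)) (trans (sym 4q≡k) (trans (rotate q) (cong (_* 4) (sym (length-evens q))))))
  ; upper      = ≤-trans (≤-reflexive (*-comm 4 (suc k′))) (m≤m+n _ 2)
  ; lower      = ≤-trans (≤-reflexive (*-comm (suc k′) 4)) (m≤m+n _ 2)
  }
  where
  rotate : ∀ q → 2 * (2 * q) ≡ q * 4
  rotate = solve-∀
  D-odd : ∀ {d} → d ∈ 1 ∷ k′ ∷ ℓ ∷ ℓ′ ∷ [] → Odd d
  D-odd (here refl)                         = 0 , refl
  D-odd (there (here refl))                 = k′-odd
  D-odd (there (there (here refl)))         = ℓ-odd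
  D-odd (there (there (there (here refl)))) = ℓ′-odd

-- Here q = 2 + e + z, ℓ = 3 + 2 e, and the last element has the single neighbor 2 (1 + z) among the even ones.
odd-cut-2 : ∀ e z {k′ ℓ′} → 2 * suc (2 * (2 + e + z)) ≡ suc k′ → 3 + 2 * e + ℓ′ ≡ suc k′ → Odd k′ → Odd ℓ′ →
  CutHalf {suc k′} (1 ∷ k′ ∷ 3 + 2 * e ∷ ℓ′ ∷ [])
odd-cut-2 e z {k′} {ℓ′} 2j≡k ℓ+ℓ′≡k k′-odd ℓ′-odd = record
  { elements   = x ∷ evens q
  ; simple     = ≤-trans (≤-by (4 + 2 * e + 2 * z) (eq₁ e z)) (≤-reflexive 2j≡k) , mem-evens-odd q q ,
                 simple-evens q (≤-trans (≤-by (6 + 2 * e + 2 * z) (eq₂ e z)) (≤-reflexive 2j≡k))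
  ; number     = suc k′
  -- With k = 4 q + 2, the q + 1 vertices have degree sum k + 2, and the one inner edge takes 2 from
  -- it.
  ; cut-number = trans (cong (λ i → suc k′ + (i + i)) inner≡1)
                   (trans (cong (_+ 2) (sym 2j≡k)) (trans (eq₃ q) (cong (λ n → suc n * 4) (sym (length-evens q)))))
  ; upper      = ≤-trans (≤-reflexive (*-comm 4 (suc k′))) (m≤m+n _ 2)
  ; lower      = ≤-trans (≤-reflexive (*-comm (suc k′) 4)) (m≤m+n _ 2)
  }
  where
  q x : ℕ
  q = 2 + e + z
  x = suc (2 * q)
  eq₁ : ∀ e z → suc (suc (2 * (2 + e + z))) + (4 + 2 * e + 2 * z) ≡ 2 * suc (2 * (2 + e + z))
  eq₁ = solve-∀
  eq₂ : ∀ e z → 2 * (2 + e + z) + (6 + 2 * e + 2 * z) ≡ 2 * suc (2 * (2 + e + z))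
  eq₂ = solve-∀
  eq₃ : ∀ q → 2 * suc (2 * q) + 2 ≡ suc q * 4
  eq₃ = solve-∀
  D-odd : ∀ {d} → d ∈ 1 ∷ k′ ∷ 3 + 2 * e ∷ ℓ′ ∷ [] → Odd d
  D-odd (here refl)                         = 0 , refl
  D-odd (there (here refl))                 = k′-odd
  D-odd (there (there (here refl)))         = suc e , eq e
    where
    eq : ∀ e → 3 + 2 * e ≡ suc (2 * suc e)
    eq = solve-∀
  D-odd (there (there (there (here refl)))) = ℓ′-odd
  up : bit (mem (evens q) ((x + 1) % suc k′)) ≡ 0
  up = at (evens q) {y = x + 1} (land x 1 refl (≤-trans (≤-by (3 + 2 * e + 2 * z) (eq e z)) (≤-reflexive 2j≡k)))
         (mem-evens-≥ q (≤-by 2 (eq′ e z)))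
    where
    eq : ∀ e z → suc (suc (2 * (2 + e + z)) + 1) + (3 + 2 * e + 2 * z) ≡ 2 * suc (2 * (2 + e + z))
    eq = solve-∀
    eq′ : ∀ e z → 2 * (2 + e + z) + 2 ≡ suc (2 * (2 + e + z)) + 1
    eq′ = solve-∀
  down : bit (mem (evens q) ((x + k′) % suc k′)) ≡ 0
  down = at (evens q) {y = 2 * q} (back x k′ (+-comm k′ 1) (+-comm (2 * q) 1) (≤-trans (≤-by (5 + 2 * e + 2 * z) (eq e z)) (≤-reflexive 2j≡k)))
           (mem-evens-≥ q ≤-refl)
    where
    eq : ∀ e z → suc (2 * (2 + e + z)) + (5 + 2 * e + 2 * z) ≡ 2 * suc (2 * (2 + e + z))
    eq = solve-∀
  forth : bit (mem (evens q) ((x + (3 + 2 * e)) % suc k′)) ≡ 0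
  forth = at (evens q) {y = x + (3 + 2 * e)} (land x (3 + 2 * e) refl (≤-trans (≤-by (1 + 2 * z) (eq e z)) (≤-reflexive 2j≡k)))
            (mem-evens-≥ q (≤-by (4 + 2 * e) (eq′ e z)))
    where
    eq : ∀ e z → suc (suc (2 * (2 + e + z)) + (3 + 2 * e)) + (1 + 2 * z) ≡ 2 * suc (2 * (2 + e + z))
    eq = solve-∀
    eq′ : ∀ e z → 2 * (2 + e + z) + (4 + 2 * e) ≡ suc (2 * (2 + e + z)) + (3 + 2 * e)
    eq′ = solve-∀
  single : bit (mem (evens q) ((x + ℓ′) % suc k′)) ≡ 1
  single = at (evens q) {y = 2 * suc z} (back x ℓ′ (trans (+-comm ℓ′ (3 + 2 * e)) ℓ+ℓ′≡k) (eq e z) (≤-trans (≤-by (7 + 4 * e + 2 * z) (eq′ e z)) (≤-reflexive 2j≡k)))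
             (mem-evens-even (s≤s (s≤s (m≤n+m z e))))
    where
    eq : ∀ e z → 2 * suc z + (3 + 2 * e) ≡ suc (2 * (2 + e + z))
    eq = solve-∀
    eq′ : ∀ e z → suc (2 * suc z) + (7 + 4 * e + 2 * z) ≡ 2 * suc (2 * (2 + e + z))
    eq′ = solve-∀
  inner≡1 : inner {suc k′} (1 ∷ k′ ∷ 3 + 2 * e ∷ ℓ′ ∷ []) (x ∷ evens q) ≡ 1
  inner≡1 = cong₂ _+_ (cong₂ _+_ up (cong₂ _+_ down (cong₂ _+_ forth (cong (_+ 0) single))))
    (inner-evens (suc (2 * q)) q (sym 2j≡k) D-odd)

-- The case ℓ = k / 2

module ThreeRegular {k′ : ℕ} (ℓ : ℕ) (ℓ+ℓ≡k : ℓ + ℓ ≡ suc k′) where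

  D : List ℕ
  D = 1 ∷ k′ ∷ ℓ ∷ []

  private
    N : ℕ
    N = suc k′

    below : ∀ {x} → x < ℓ + ℓ → x < N
    below x< = ≤-trans x< (≤-reflexive ℓ+ℓ≡k)

  record Inner (w r e : ℕ) : Set where
    constructor inner≡
    field equation : inner {N} D (spread w r) ≡ e

  base : ∀ w α β → 0 < ℓ → w < ℓ + ℓ → α + 1 ≡ w → β + ℓ ≡ w → Inner w 0 (α + β)
  base w α β 0<ℓ w<k α+1≡w β+ℓ≡w = inner≡ (begin
    inner {N} D (downFrom w)
      ≡⟨ inner-downFrom w (<⇒≤ (below w<k)) D<k ⟩
    (w ∸ k′) + ((w ∸ (N ∸ k′)) + ((w ∸ (N ∸ ℓ)) + 0))
      ≡⟨ cong₂ _+_ (m≤n⇒m∸n≡0 (s≤s⁻¹ (below w<k))) (cong₂ _+_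
           (trans (cong (w ∸_) (complement k′ 1 (+-comm k′ 1))) (∸-by α 1 α+1≡w)) (cong (_+ 0)
           (trans (cong (w ∸_) (complement ℓ ℓ ℓ+ℓ≡k)) (∸-by β ℓ β+ℓ≡w)))) ⟩
    0 + (α + (β + 0))
      ≡⟨ cong (α +_) (+-identityʳ β) ⟩
    α + β ∎)
    where
    open ≡-Reasoning
    ℓ<N : ℓ < N
    ℓ<N = ≤-trans (+-monoˡ-≤ ℓ 0<ℓ) (≤-reflexive ℓ+ℓ≡k)
    D<k : ∀ {d} → d ∈ D → d < N
    D<k (here refl)                 = ≤-trans (s≤s 0<ℓ) ℓ<N
    D<k (there (here refl))         = ≤-refl
    D<k (there (there (here refl))) = ℓ<N

  step : ∀ w r {e} → w + 2 * suc r < ℓ + ℓ → ℓ ≤ w + suc (2 * r) → suc (2 * r) < ℓ → Inner w r e → Inner w (suc r) (1 + e)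
  step w r w+2r<k ℓ≤x 2r<ℓ (inner≡ eq) = inner≡ (cong₂ _+_
    (trans (gain-spread refl (ℓ ∷ []) r (below w+2r<k))
      (cong (_+ 0) (chord-in r ℓ+ℓ≡k (m+n≤o⇒m≤o w (<⇒≤ (below w+2r<k))) ℓ≤x 2r<ℓ)))
    eq)

  done : ∀ w r {e} → w + 2 * r ≤ ℓ + ℓ → Inner w r e → 4 * e ≤ (ℓ + ℓ) * 3 + 2 → (ℓ + ℓ) * 3 ≤ 4 * e + 2 → InnerHalf {N} D
  done w r {e} w+2r≤k (inner≡ eq) upper lower = record
    { elements     = spread w r
    ; simple       = simple-spread r (≤-trans w+2r≤k (≤-reflexive ℓ+ℓ≡k))
    ; inner-number = eq
    ; upper        = subst (λ k → 4 * e ≤ k * 3 + 2) ℓ+ℓ≡k upper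
    ; lower        = subst (λ k → k * 3 ≤ 4 * e + 2) ℓ+ℓ≡k lower
    }

-- For w ≥ ℓ the interval has 2 w - ℓ - 1 of the 3 ℓ edges. If ℓ is divisible by 4 this is odd while
-- half of the edges is even, so one extra vertex with a single chord is added. In the other three
-- residue classes an interval suffices; for odd ℓ the total is odd and rounding in either direction
-- is allowed.
half₃-mod4≡0 : ∀ m {k′} (eq : (4 + 4 * m) + (4 + 4 * m) ≡ suc k′) → InnerHalf {suc k′} (1 ∷ k′ ∷ (4 + 4 * m) ∷ [])
half₃-mod4≡0 m eq = done (5 + 5 * m) 1 (≤-by (1 + 3 * m) (solve (m ∷ [])))
    (step (5 + 5 * m) 0 (≤-by (3 * m) (solve (m ∷ []))) (≤-by (2 + m) (solve (m ∷ []))) (≤-by (2 + 4 * m) (solve (m ∷ [])))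
    (base (5 + 5 * m) (4 + 5 * m) (1 + m) (≤-by (3 + 4 * m) (solve (m ∷ []))) (≤-by (2 + 3 * m) (solve (m ∷ []))) (solve (m ∷ [])) (solve (m ∷ []))))
    (≤-by 2 (solve (m ∷ []))) (≤-by 2 (solve (m ∷ [])))
  where
  open ThreeRegular (4 + 4 * m) eq

half₃-mod4≡1 : ∀ m {k′} (eq : (5 + 4 * m) + (5 + 4 * m) ≡ suc k′) → InnerHalf {suc k′} (1 ∷ k′ ∷ (5 + 4 * m) ∷ [])
half₃-mod4≡1 m eq = done (7 + 5 * m) 0 (≤-by (3 + 3 * m) (solve (m ∷ [])))
    (base (7 + 5 * m) (6 + 5 * m) (2 + m) (≤-by (4 + 4 * m) (solve (m ∷ []))) (≤-by (2 + 3 * m) (solve (m ∷ []))) (solve (m ∷ [])) (solve (m ∷ [])))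
    (≤-by 0 (solve (m ∷ []))) (≤-by 4 (solve (m ∷ [])))
  where
  open ThreeRegular (5 + 4 * m) eq

half₃-mod4≡2 : ∀ m {k′} (eq : (2 + 4 * m) + (2 + 4 * m) ≡ suc k′) → InnerHalf {suc k′} (1 ∷ k′ ∷ (2 + 4 * m) ∷ [])
half₃-mod4≡2 m eq = done (3 + 5 * m) 0 (≤-by (1 + 3 * m) (solve (m ∷ [])))
    (base (3 + 5 * m) (2 + 5 * m) (1 + m) (≤-by (1 + 4 * m) (solve (m ∷ []))) (≤-by (3 * m) (solve (m ∷ []))) (solve (m ∷ [])) (solve (m ∷ [])))
    (≤-by 2 (solve (m ∷ []))) (≤-by 2 (solve (m ∷ [])))
  where
  open ThreeRegular (2 + 4 * m) eq

half₃-mod4≡3 : ∀ m {k′} (eq : (3 + 4 * m) + (3 + 4 * m) ≡ suc k′) → InnerHalf {suc k′} (1 ∷ k′ ∷ (3 + 4 * m) ∷ [])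
half₃-mod4≡3 m eq = done (4 + 5 * m) 0 (≤-by (2 + 3 * m) (solve (m ∷ [])))
    (base (4 + 5 * m) (3 + 5 * m) (1 + m) (≤-by (2 + 4 * m) (solve (m ∷ []))) (≤-by (1 + 3 * m) (solve (m ∷ []))) (solve (m ∷ [])) (solve (m ∷ [])))
    (≤-by 4 (solve (m ∷ []))) (≤-by 0 (solve (m ∷ [])))
  where
  open ThreeRegular (3 + 4 * m) eq

half₃-cast : ∀ {k′} ℓ m (eq : ℓ + ℓ ≡ suc k′) → ℓ ≡ m →
  ((eq′ : m + m ≡ suc k′) → InnerHalf {suc k′} (1 ∷ k′ ∷ m ∷ [])) → InnerHalf {suc k′} (1 ∷ k′ ∷ ℓ ∷ [])
half₃-cast ℓ m eq refl half = half eq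

inner-half₃ : ∀ {k′} ℓ (eq : ℓ + ℓ ≡ suc k′) → 2 ≤ ℓ → InnerHalf {suc k′} (1 ∷ k′ ∷ ℓ ∷ [])
inner-half₃ ℓ eq 2≤ℓ with even⊎odd ℓ
... | h , inj₁ refl with even⊎odd h
...   | zero  , inj₁ refl = contradiction 2≤ℓ λ ()
...   | suc m , inj₁ refl = half₃-cast (2 * (2 * suc m)) (4 + 4 * m) eq (solve (m ∷ [])) (half₃-mod4≡0 m)
...   | m     , inj₂ refl = half₃-cast (2 * suc (2 * m)) (2 + 4 * m) eq (solve (m ∷ [])) (half₃-mod4≡2 m)
inner-half₃ ℓ eq 2≤ℓ | h , inj₂ refl with even⊎odd h
...   | zero  , inj₁ refl = contradiction 2≤ℓ λ { (s≤s ()) }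
...   | suc m , inj₁ refl = half₃-cast (suc (2 * (2 * suc m))) (5 + 4 * m) eq (solve (m ∷ [])) (half₃-mod4≡1 m)
...   | m     , inj₂ refl = half₃-cast (suc (2 * suc (2 * m))) (3 + 4 * m) eq (solve (m ∷ [])) (half₃-mod4≡3 m)

-- The m even vertices below ℓ = 2 m are independent: their cycle neighbors are odd and their
-- opposite vertices are at least ℓ. So 3 m of the 6 m edges cross.
cut-half₃-even : ∀ m {k′} → 2 * m + 2 * m ≡ suc k′ → Odd k′ → CutHalf {suc k′} (1 ∷ k′ ∷ 2 * m ∷ [])
cut-half₃-even m {k′} eq k′-odd = record
  { elements   = evens m
  ; simple     = simple-evens m (≤-trans (m≤m+n (2 * m) (2 * m)) (≤-reflexive eq))
  ; number     = 3 * m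
  ; cut-number = trans (cong (λ i → 3 * m + (i + i)) (inner≡0 m ≤-refl))
                   (trans (+-identityʳ (3 * m)) (trans (*-comm 3 m) (cong (_* 3) (sym (length-evens m)))))
  ; upper      = ≤-trans (≤-reflexive total) (m≤m+n _ 2)
  ; lower      = ≤-trans (≤-reflexive (sym total)) (m≤m+n _ 2)
  }
  where
  rotate : ∀ m → 4 * (3 * m) ≡ (2 * m + 2 * m) * 3
  rotate = solve-∀
  total : 4 * (3 * m) ≡ suc k′ * 3
  total = trans (rotate m) (cong (_* 3) eq)
  k-even : suc k′ ≡ 2 * (2 * m)
  k-even = trans (sym eq) (cong (2 * m +_) (sym (+-identityʳ (2 * m))))
  inner≡0 : ∀ q → q ≤ m → inner {suc k′} (1 ∷ k′ ∷ 2 * m ∷ []) (evens q) ≡ 0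
  inner≡0 zero    _   = refl
  inner≡0 (suc q) q<m = cong₂ _+_ (cong₂ _+_ (mem-evens-odd-% (2 * m) q q k-even (0 , refl))
    (cong₂ _+_ (mem-evens-odd-% (2 * m) q q k-even k′-odd) (cong (_+ 0)
      (at (evens q) {y = 2 * q + 2 * m} (land (2 * q) (2 * m) refl (≤-trans (+-monoˡ-< (2 * m) (*-monoʳ-< 2 q<m)) (≤-reflexive eq)))
        (mem-evens-≥ q (m≤m+n (2 * q) (2 * m))))))) (inner≡0 q (<⇒≤ q<m))

-- Half of the 9 + 6 m edges is 4 + 3 m or 5 + 3 m. The m + 1 independent vertices 0, 2, ..., 2 m
-- give a cut of only 3 + 3 m; the vertex 2 m + 1, adjacent to 2 m alone among them, raises it by 3
-- - 2 = 1.
cut-half₃-odd : ∀ m {k′} → 3 + 2 * m + (3 + 2 * m) ≡ suc k′ → Odd k′ → CutHalf {suc k′} (1 ∷ k′ ∷ 3 + 2 * m ∷ [])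
cut-half₃-odd m {k′} eq k′-odd = record
  { elements   = x ∷ evens q
  ; simple     = ≤-trans (≤-by (4 + 2 * m) (eq₁ m)) (≤-reflexive eq) , mem-evens-odd q m ,
                 simple-evens q (≤-trans (≤-by (4 + 2 * m) (eq₂ m)) (≤-reflexive eq))
  ; number     = 4 + 3 * m
  ; cut-number = trans (cong (λ i → 4 + 3 * m + (i + i)) inner≡1)
                   (trans (eq₃ m) (cong (λ n → suc n * 3) (sym (length-evens q))))
  ; upper      = subst (λ k → 4 * (4 + 3 * m) ≤ k * 3 + 2) eq (≤-by 4 (eq₄ m))
  ; lower      = subst (λ k → k * 3 ≤ 4 * (4 + 3 * m) + 2) eq (≤-by 0 (eq₅ m))
  }
  where
  q x : ℕ
  q = suc m
  x = suc (2 * m)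
  eq₁ : ∀ m → suc (suc (2 * m)) + (4 + 2 * m) ≡ 3 + 2 * m + (3 + 2 * m)
  eq₁ = solve-∀
  eq₂ : ∀ m → 2 * suc m + (4 + 2 * m) ≡ 3 + 2 * m + (3 + 2 * m)
  eq₂ = solve-∀
  eq₃ : ∀ m → 4 + 3 * m + 2 ≡ suc (suc m) * 3
  eq₃ = solve-∀
  eq₄ : ∀ m → 4 * (4 + 3 * m) + 4 ≡ (3 + 2 * m + (3 + 2 * m)) * 3 + 2
  eq₄ = solve-∀
  eq₅ : ∀ m → (3 + 2 * m + (3 + 2 * m)) * 3 + 0 ≡ 4 * (4 + 3 * m) + 2
  eq₅ = solve-∀
  k-even : suc k′ ≡ 2 * (3 + 2 * m)
  k-even = trans (sym eq) (cong (3 + 2 * m +_) (sym (+-identityʳ (3 + 2 * m))))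
  D-odd : ∀ {d} → d ∈ 1 ∷ k′ ∷ 3 + 2 * m ∷ [] → Odd d
  D-odd (here refl)                 = 0 , refl
  D-odd (there (here refl))         = k′-odd
  D-odd (there (there (here refl))) = suc m , cong suc (2+2* m)
  up : bit (mem (evens q) ((x + 1) % suc k′)) ≡ 0
  up = at (evens q) {y = x + 1} (land x 1 refl (≤-trans (≤-by (3 + 2 * m) (up₁ m)) (≤-reflexive eq))) (mem-evens-≥ q (≤-by 0 (up₂ m)))
    where
    up₁ : ∀ m → suc (suc (2 * m) + 1) + (3 + 2 * m) ≡ 3 + 2 * m + (3 + 2 * m)
    up₁ = solve-∀
    up₂ : ∀ m → 2 * suc m + 0 ≡ suc (2 * m) + 1
    up₂ = solve-∀
  down : bit (mem (evens q) ((x + k′) % suc k′)) ≡ 1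
  down = at (evens q) {y = 2 * m} (back x k′ (+-comm k′ 1) (+-comm (2 * m) 1) (≤-trans (≤-by (5 + 2 * m) (down₁ m)) (≤-reflexive eq)))
           (mem-evens-even {q} {m} ≤-refl)
    where
    down₁ : ∀ m → suc (2 * m) + (5 + 2 * m) ≡ 3 + 2 * m + (3 + 2 * m)
    down₁ = solve-∀
  forth : bit (mem (evens q) ((x + (3 + 2 * m)) % suc k′)) ≡ 0
  forth = at (evens q) {y = x + (3 + 2 * m)} (land x (3 + 2 * m) refl (≤-trans (≤-by 1 (forth₁ m)) (≤-reflexive eq)))
            (mem-evens-≥ q (≤-by (2 + 2 * m) (forth₂ m)))
    where
    forth₁ : ∀ m → suc (suc (2 * m) + (3 + 2 * m)) + 1 ≡ 3 + 2 * m + (3 + 2 * m)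
    forth₁ = solve-∀
    forth₂ : ∀ m → 2 * suc m + (2 + 2 * m) ≡ suc (2 * m) + (3 + 2 * m)
    forth₂ = solve-∀
  inner≡1 : inner {suc k′} (1 ∷ k′ ∷ 3 + 2 * m ∷ []) (x ∷ evens q) ≡ 1
  inner≡1 = cong₂ _+_ (cong₂ _+_ up (cong₂ _+_ down (cong (_+ 0) forth))) (inner-evens (3 + 2 * m) q k-even D-odd)

cut-half₃ : ∀ {k′} ℓ → ℓ + ℓ ≡ suc k′ → Odd k′ → 2 ≤ ℓ → CutHalf {suc k′} (1 ∷ k′ ∷ ℓ ∷ [])
cut-half₃ {k′} ℓ eq k′-odd 2≤ℓ with even⊎odd ℓ
... | m     , inj₁ refl = cut-half₃-even m eq k′-odd
... | zero  , inj₂ refl = contradiction 2≤ℓ λ { (s≤s ()) }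
... | suc m , inj₂ refl = subst (λ ℓ → ℓ + ℓ ≡ suc k′ → CutHalf {suc k′} (1 ∷ k′ ∷ ℓ ∷ [])) (cong suc (2+2* m)) (λ eq → cut-half₃-odd m eq k′-odd) eq

-- Balanceability for even k

pred-odd : ∀ j {k′} → 2 * j ≡ suc k′ → Odd k′
pred-odd (suc i) eq = i , suc-injective (trans (sym eq) (sym (2+2* i)))

balanceable₃ : ∀ j {k′} ℓ (G : Graph (suc k′)) → ℓ + ℓ ≡ suc k′ → 2 * j ≡ suc k′ → 2 ≤ ℓ →
  Circulant G (1 ∷ k′ ∷ ℓ ∷ []) → Balanceable G
balanceable₃ j ℓ G eq 2j≡k 2≤ℓ circ = balanceable (s≤s z≤n)
  (halved-within G circ (inner-half₃ ℓ eq 2≤ℓ))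
  (halved-crossing G circ (cut-half₃ ℓ eq (pred-odd j 2j≡k) 2≤ℓ))

odd-cut : ∀ j {k′} ℓ ℓ′ → 2 * j ≡ suc k′ → ℓ + ℓ′ ≡ suc k′ → Odd k′ → Odd ℓ → Odd ℓ′ → 2 ≤ ℓ → ℓ < ℓ′ →
  CutHalf {suc k′} (1 ∷ k′ ∷ ℓ ∷ ℓ′ ∷ [])
odd-cut j {k′} ℓ ℓ′ 2j≡k eq k′-odd ℓ-odd ℓ′-odd 2≤ℓ ℓ<ℓ′ with even⊎odd j | ℓ-odd
... | q , inj₁ refl | _            = odd-cut-0 q 2j≡k k′-odd ℓ-odd ℓ′-odd
... | q , inj₂ refl | zero  , refl = contradiction 2≤ℓ λ { (s≤s ()) }
... | q , inj₂ refl | suc e , refl with ≤-diff 1+e<q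
  where
  -- ℓ = 3 + 2 e is less than k / 2 = 2 q + 1. This yields the `z` with q = 2 + e + z that
  -- `odd-cut-2` requires.
  1+e<q : suc e < q
  1+e<q = *-cancelˡ-< 4 (suc e) q (+-cancelʳ-< 2 (4 * suc e) (4 * q) (begin-strict
    4 * suc e + 2                             ≡⟨ quadruple e ⟩
    suc (2 * suc e) + suc (2 * suc e)         <⟨ +-monoʳ-< (suc (2 * suc e)) ℓ<ℓ′ ⟩
    suc (2 * suc e) + ℓ′                      ≡⟨ trans eq (sym 2j≡k) ⟩
    2 * suc (2 * q)                           ≡⟨ expand q ⟩
    4 * q + 2                                 ∎))
    where
    open ≤-Reasoning
    quadruple : ∀ e → 4 * suc e + 2 ≡ suc (2 * suc e) + suc (2 * suc e)
    quadruple = solve-∀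
    expand : ∀ q → 2 * suc (2 * q) ≡ 4 * q + 2
    expand = solve-∀
... | z , refl = subst (λ ℓ → ℓ + ℓ′ ≡ suc k′ → CutHalf {suc k′} (1 ∷ k′ ∷ ℓ ∷ ℓ′ ∷ [])) (cong suc (2+2* e))
  (λ eq → odd-cut-2 e z 2j≡k eq k′-odd ℓ′-odd) eq

balanceable₄ : ∀ j {k′} ℓ ℓ′ (G : Graph (suc k′)) → ℓ + ℓ′ ≡ suc k′ → 2 * j ≡ suc k′ → 2 ≤ ℓ → ℓ < ℓ′ →
  ¬ (ℓ ≡ 2 × ℓ′ ≡ 4) → Circulant G (1 ∷ k′ ∷ ℓ ∷ ℓ′ ∷ []) → Balanceable G
balanceable₄ j ℓ ℓ′ G eq 2j≡k 2≤ℓ ℓ<ℓ′ exceptional circ = balanceable (s≤s z≤n)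
  (halved-within G circ (half⇒innerHalf {eq = eq} (inner-half j eq 2j≡k 2≤ℓ ℓ<ℓ′ exceptional))) (cut (even⊎odd ℓ))
  where
  cut : ∃[ a ] (ℓ ≡ 2 * a ⊎ ℓ ≡ suc (2 * a)) → ∃[ W ] Halved G (crossing W)
  cut (a , inj₁ ℓ≡2a) = halved-parity j G circ 2j≡k (pred-odd j 2j≡k) (a , ℓ≡2a)
    (even-rest j a ℓ′ (trans 2j≡k (trans (sym eq) (cong (_+ ℓ′) ℓ≡2a))))
  cut (a , inj₂ ℓ≡) with even-rest j a (suc ℓ′) (trans 2j≡k (trans (sym eq) (trans (cong (_+ ℓ′) ℓ≡) (sym (+-suc (2 * a) ℓ′)))))
  ... | b , 1+ℓ′≡2b = halved-crossing G circ (odd-cut j ℓ ℓ′ 2j≡k eq (pred-odd j 2j≡k) (a , ℓ≡) (pred-odd b (sym 1+ℓ′≡2b)) 2≤ℓ ℓ<ℓ′)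

-- Necessity

-- The adjacency matrix of the complete graph is the all-ones matrix without its diagonal; adding
-- `f u` restores the diagonal term without subtraction.
edge-K : ∀ {n} (f : Fin n → ℕ) u → ∑[ v ∈ allFin n ] (edge (K n) u v * f v) + f u ≡ ∑ (allFin n) f
edge-K {n} f u = begin
  ∑[ v ∈ allFin n ] (edge (K n) u v * f v) + f u
    ≡⟨ cong (∑[ v ∈ allFin n ] (edge (K n) u v * f v) +_) (∑-δ u f) ⟨
  ∑[ v ∈ allFin n ] (edge (K n) u v * f v) + ∑[ v ∈ allFin n ] (bit (does (v Fin.≟ u)) * f v)
    ≡⟨ ∑-+ (allFin n) _ _ ⟨
  ∑[ v ∈ allFin n ] (edge (K n) u v * f v + bit (does (v Fin.≟ u)) * f v)
    ≡⟨ ∑-cong (allFin n) split ⟩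
  ∑ (allFin n) f ∎
  where
  open ≡-Reasoning
  split : ∀ v → edge (K n) u v * f v + bit (does (v Fin.≟ u)) * f v ≡ f v
  split v with u Fin.≟ v
  ... | yes refl rewrite dec-true (v Fin.≟ v) refl = +-identityʳ (f v)
  ... | no  u≢v  rewrite dec-false (v Fin.≟ u) (≢-sym u≢v) = trans (+-identityʳ _) (+-identityʳ (f v))

degree-K : ∀ {n} (u : Fin n) → ∑[ v ∈ allFin n ] edge (K n) u v + 1 ≡ n
degree-K {n} u = begin
  ∑[ v ∈ allFin n ] edge (K n) u v + 1
    ≡⟨ cong (_+ 1) (∑-cong (allFin n) (λ v → *-identityʳ (edge (K n) u v))) ⟨
  ∑[ v ∈ allFin n ] (edge (K n) u v * 1) + 1  ≡⟨ edge-K (λ _ → 1) u ⟩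
  ∑[ _ ∈ allFin n ] 1                         ≡⟨ trans (∑-allFin-const n 1) (*-identityʳ n) ⟩
  n                                           ∎
  where open ≡-Reasoning

length-edges-K : ∀ n → length (edges (K n)) ≡ n C 2
length-edges-K n = *-cancelˡ-≡ _ _ 2 (+-cancelʳ-≡ n _ _ (begin
  2 * length (edges (K n)) + n
    ≡⟨ cong (λ T → length (edges (K n)) + T + n) (+-identityʳ _) ⟩
  length (edges (K n)) + length (edges (K n)) + n
    ≡⟨ cong₂ _+_ (size-handshake (K n)) (sym (trans (∑-allFin-const n 1) (*-identityʳ n))) ⟩
  ∑[ u ∈ allFin n ] (∑[ v ∈ allFin n ] edge (K n) u v) + ∑[ u ∈ allFin n ] 1
    ≡⟨ ∑-+ (allFin n) _ _ ⟨
  ∑[ u ∈ allFin n ] (∑[ v ∈ allFin n ] edge (K n) u v + 1)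
    ≡⟨ trans (∑-cong (allFin n) degree-K) (∑-allFin-const n n) ⟩
  n * n
    ≡⟨ square n ⟩
  n * (n ∸ 1) + n
    ≡⟨ cong (_+ n) (2*nC2 n) ⟨
  2 * (n C 2) + n ∎))
  where
  open ≡-Reasoning
  square : ∀ n → n * n ≡ n * (n ∸ 1) + n
  square zero    = refl
  square (suc m) = trans (*-suc (suc m) m) (+-comm (suc m) (suc m * m))

module _ {n : ℕ} (W : Fin n → Bool) where

  private
    V : List (Fin n)
    V = allFin n

    size : ℕ
    size = ∑[ u ∈ V ] bit (W u)

    bit-idem : ∀ b → bit b * bit b ≡ bit b
    bit-idem true  = refl
    bit-idem false = refl

  within-K : count (K n) (within W) + count (K n) (within W) + size ≡ size * size
  within-K = begin
    count (K n) (within W) + count (K n) (within W) + size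
      ≡⟨ cong₂ _+_ (2within (K n) W) (∑-cong V (λ u → sym (bit-idem (W u)))) ⟩
    ∑[ u ∈ V ] (bit (W u) * ∑[ v ∈ V ] (edge (K n) u v * bit (W v))) + ∑[ u ∈ V ] (bit (W u) * bit (W u))
      ≡⟨ ∑-+ V _ _ ⟨
    ∑[ u ∈ V ] (bit (W u) * ∑[ v ∈ V ] (edge (K n) u v * bit (W v)) + bit (W u) * bit (W u))
      ≡⟨ ∑-cong V (λ u → trans (sym (*-distribˡ-+ (bit (W u)) _ _)) (cong (bit (W u) *_) (edge-K (bit ∘ W) u))) ⟩
    ∑[ u ∈ V ] (bit (W u) * size)
      ≡⟨ ∑-*ʳ V size _ ⟩
    size * size ∎
    where open ≡-Reasoning

  crossing-K : count (K n) (crossing W) + size * size ≡ size * n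
  crossing-K = begin
    count (K n) (crossing W) + size * size
      ≡⟨ cong (count (K n) (crossing W) +_) within-K ⟨
    count (K n) (crossing W) + (count (K n) (within W) + count (K n) (within W) + size)
      ≡⟨ +-assoc (count (K n) (crossing W)) _ size ⟨
    count (K n) (crossing W) + (count (K n) (within W) + count (K n) (within W)) + size
      ≡⟨ cong₂ _+_ (crossing+2within (K n) W) (∑-cong V (λ u → sym (*-identityʳ (bit (W u))))) ⟩
    ∑[ u ∈ V ] (bit (W u) * ∑[ v ∈ V ] edge (K n) u v) + ∑[ u ∈ V ] (bit (W u) * 1)
      ≡⟨ ∑-+ V _ _ ⟨
    ∑[ u ∈ V ] (bit (W u) * ∑[ v ∈ V ] edge (K n) u v + bit (W u) * 1)
      ≡⟨ ∑-cong V (λ u → trans (sym (*-distribˡ-+ (bit (W u)) _ 1)) (cong (bit (W u) *_) (degree-K u))) ⟩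
    ∑[ u ∈ V ] (bit (W u) * n)
      ≡⟨ ∑-*ʳ V n _ ⟩
    size * n ∎
    where open ≡-Reasoning

initial : ∀ {n} → ℕ → Fin n → Bool
initial x u = toℕ u <ᵇ x

size-initial : ∀ {n} x → x ≤ n → ∑[ u ∈ allFin n ] bit (initial x u) ≡ x
size-initial {n}     zero    _         = trans (∑-allFin-const n 0) (*-zeroʳ n)
size-initial {suc n} (suc x) (s≤s x≤n) = trans (∑-suc {n} (λ u → bit (initial (suc x) u))) (cong suc (size-initial {n} x x≤n))

-- Φ is within or crossing: its two-coloring of Kₙ is exactly balanced for arbitrarily
-- large n, while every copy of G receives an unbalanced coloring of the same kind.
module Obstruction
  (Φ : ∀ {n} → (Fin n → Bool) → Fin n → Fin n → Bool)
  (Φ-sym : ∀ {n} (W : Fin n → Bool) u v → Φ W u v ≡ Φ W v u)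
  (Φ-natural : ∀ {k n} (W : Fin n → Bool) (f : Fin k → Fin n) u v → Φ W (f u) (f v) ≡ Φ (W ∘ f) u v)
  where

  colouring : ∀ {n} → (Fin n → Bool) → Colouring n
  colouring W = record
    { colour      = λ u v → if Φ W u v then R else B
    ; colour-symm = λ u v → cong (if_then R else B) (Φ-sym W u v)
    }

  #edges-colouring : ∀ {k n} (G : Graph k) (W : Fin n → Bool) (f : Fin k → Fin n) →
    #edges G (colour (colouring W) on f) R ≡ count G (Φ (W ∘ f)) ×
    #edges G (colour (colouring W) on f) B ≡ count G (λ u v → not (Φ (W ∘ f) u v))
  #edges-colouring G W f =
    trans (#edges-count G _ R) (count-cong G (λ {u} {v} _ → trans (red (Φ W (f u) (f v))) (Φ-natural W f u v))) ,
    trans (#edges-count G _ B) (count-cong G (λ {u} {v} _ → trans (blue (Φ W (f u) (f v))) (cong not (Φ-natural W f u v))))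
    where
    red : ∀ b → does ((if b then R else B) ≟ᶜ R) ≡ b
    red true  = refl
    red false = refl
    blue : ∀ b → does ((if b then R else B) ≟ᶜ B) ≡ not b
    blue true  = refl
    blue false = refl

  -- In an exactly balanced coloring both classes have ⌊½ C(n,2)⌋ edges, more than any admissible
  -- `m`. Hence no choice of `m` can exclude this coloring, and a balanced copy in it would halve
  -- `G` by the pulled-back set.
  unbalanceable : ∀ {k} (G : Graph k) →
    (∀ n₀ → ∃[ n ] (n ≥ n₀ × Σ[ W ∈ (Fin n → Bool) ] 4 * count (K n) (Φ W) ≡ n * (n ∸ 1))) →
    (∀ W → ¬ Halved G (Φ W)) → ¬ Balanceable G
  unbalanceable G large unhalved (n₀ , bal) with large n₀
  ... | n , n≥n₀ , W , 4p≡ with bal n n≥n₀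
  ...   | m , m<half , copies = unhalved (W ∘ to f) (subst₂ (λ x y → ∣ x - y ∣ ≤ 1) (proj₁ counts) (proj₂ counts) (proj₂ balanced))
    where
    p q : ℕ
    p = count (K n) (Φ W)
    q = count (K n) (λ u v → not (Φ W u v))
    2p≡ : p + p ≡ n C 2
    2p≡ = *-cancelˡ-≡ _ _ 2 (trans (quadruple p) (trans 4p≡ (sym (2*nC2 n))))
      where
      quadruple : ∀ p → 2 * (p + p) ≡ 4 * p
      quadruple = solve-∀
    p≡q : p ≡ q
    p≡q = +-cancelˡ-≡ p p q (trans 2p≡ (trans (sym (length-edges-K n)) (sym (count-complement (K n) (Φ W)))))
    half≡p : ⌊ n C 2 /2⌋ ≡ p
    half≡p = trans (cong ⌊_/2⌋ (sym 2p≡)) (sym (n≡⌊n+n/2⌋ p))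
    host : #edges (K n) (colour (colouring W)) R ≡ p × #edges (K n) (colour (colouring W)) B ≡ q
    host = #edges-colouring (K n) W (λ u → u)
    balanced : BalancedCopy G (colouring W)
    balanced = copies (colouring W)
      (subst (m <_) (trans half≡p (sym (proj₁ host))) m<half)
      (subst (m <_) (trans half≡p (trans p≡q (sym (proj₂ host)))) m<half)
    f : Copy G (K n)
    f = proj₁ balanced
    counts : #edges G (colour (colouring W) on to f) R ≡ count G (Φ (W ∘ to f)) ×
             #edges G (colour (colouring W) on to f) B ≡ count G (λ u v → not (Φ (W ∘ to f) u v))
    counts = #edges-colouring G W (to f)

-- Exactly balanced colorings of complete graphs

triangular : ℕ → ℕ
triangular zero    = 0
triangular (suc t) = suc t + triangular t

2*triangular : ∀ t → 2 * triangular t ≡ t * suc t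
2*triangular zero    = refl
2*triangular (suc t) = trans (*-distribˡ-+ 2 (suc t) (triangular t)) (trans (cong (2 * suc t +_) (2*triangular t)) (expand t))
  where
  expand : ∀ t → 2 * suc t + t * suc t ≡ suc t * suc (suc t)
  expand = solve-∀

-- The two sides have t(t+1)/2 and (t+1)(t+2)/2 vertices.
balanced-cuts : ∀ n₀ → ∃[ n ] (n ≥ n₀ × Σ[ W ∈ (Fin n → Bool) ] 4 * count (K n) (crossing W) ≡ n * (n ∸ 1))
balanced-cuts t = n , ≤-by (1 + t + t * t) (eq₁ t) , initial x , +-cancelʳ-≡ (4 * (x * x)) _ _ (begin
  4 * c + 4 * (x * x)                 ≡⟨ *-distribˡ-+ 4 c (x * x) ⟨
  4 * (c + x * x)                     ≡⟨ cong (4 *_) c+x²≡xn ⟩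
  4 * (x * n)                         ≡⟨ eq₂ x n ⟩
  2 * x * (2 * n)                     ≡⟨ cong (_* (2 * n)) (2*triangular t) ⟩
  t * suc t * (2 * n)                 ≡⟨ eq₃ t ⟩
  n * (t * (2 + t)) + t * suc t * (t * suc t)
    ≡⟨ cong₂ (λ a b → n * a + b * b) (eq₄ t) (2*triangular t) ⟨
  n * (n ∸ 1) + 2 * x * (2 * x)       ≡⟨ cong (n * (n ∸ 1) +_) (eq₅ x) ⟩
  n * (n ∸ 1) + 4 * (x * x)           ∎)
  where
  open ≡-Reasoning
  n x c : ℕ
  n = suc t * suc t
  x = triangular t
  c = count (K n) (crossing (initial x))
  eq₁ : ∀ t → t + (1 + t + t * t) ≡ suc t * suc t
  eq₁ = solve-∀
  eq₂ : ∀ x n → 4 * (x * n) ≡ 2 * x * (2 * n)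
  eq₂ = solve-∀
  eq₃ : ∀ t → t * suc t * (2 * (suc t * suc t)) ≡ suc t * suc t * (t * (2 + t)) + t * suc t * (t * suc t)
  eq₃ = solve-∀
  eq₄ : ∀ t → t + t * suc t ≡ t * (2 + t)
  eq₄ = solve-∀
  eq₅ : ∀ x → 2 * x * (2 * x) ≡ 4 * (x * x)
  eq₅ = solve-∀
  x≤n : x ≤ n
  x≤n = ≤-trans (m≤m+n x (x + 0)) (≤-trans (≤-reflexive (2*triangular t)) (*-monoˡ-≤ (suc t) (n≤1+n t)))
  c+x²≡xn : c + x * x ≡ x * n
  c+x²≡xn = subst (λ s → c + s * s ≡ s * n) (size-initial {n} x x≤n) (crossing-K {n} (initial x))

-- The solutions n = 1 + a, x = 1 + b of 2 x (x − 1) = n (n − 1), a Pell equation in 2 n − 1 and 2 x − 1.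
pell : ℕ → ℕ × ℕ
pell zero    = 0 , 0
pell (suc i) = let (a , b) = pell i in 3 + 3 * a + 4 * b , 2 + 2 * a + 3 * b

-- With X = 2 a + 1 and Y = 2 b + 1 the equation reads X² - 2 Y² = -1. A step of `pell` multiplies X
-- + Y √2 by 3 + 2 √2, whose norm is 1.
pell-equation : ∀ i → let (a , b) = pell i in 2 * (suc b * b) ≡ suc a * a
pell-equation zero    = refl
pell-equation (suc i) = let (a , b) = pell i in
  +-cancelʳ-≡ (suc a * a) _ _ (trans (step a b) (cong (suc (3 + 3 * a + 4 * b) * (3 + 3 * a + 4 * b) +_) (pell-equation i)))
  where
  step : ∀ a b → 2 * (suc (2 + 2 * a + 3 * b) * (2 + 2 * a + 3 * b)) + suc a * a ≡
                 suc (3 + 3 * a + 4 * b) * (3 + 3 * a + 4 * b) + 2 * (suc b * b)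
  step = solve-∀

pell-large : ∀ i → i ≤ proj₁ (pell i)
pell-large zero    = z≤n
pell-large (suc i) = let (a , b) = pell i in
  ≤-trans (s≤s (pell-large i)) (≤-by (2 + 2 * a + 4 * b) (eq a b))
  where
  eq : ∀ a b → suc a + (2 + 2 * a + 4 * b) ≡ 3 + 3 * a + 4 * b
  eq = solve-∀

pell-ordered : ∀ i → proj₂ (pell i) ≤ proj₁ (pell i)
pell-ordered zero    = z≤n
pell-ordered (suc i) = let (a , b) = pell i in ≤-by (1 + a + b) (eq a b)
  where
  eq : ∀ a b → 2 + 2 * a + 3 * b + (1 + a + b) ≡ 3 + 3 * a + 4 * b
  eq = solve-∀

balanced-cliques : ∀ n₀ → ∃[ n ] (n ≥ n₀ × Σ[ W ∈ (Fin n → Bool) ] 4 * count (K n) (within W) ≡ n * (n ∸ 1))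
balanced-cliques i with pell i | pell-equation i | pell-large i | pell-ordered i
... | a , b | pell-eq | i≤a | b≤a = suc a , m≤n⇒m≤1+n i≤a , W ,
  trans (eq₁ c) (trans (cong (2 *_) 2c≡) pell-eq)
  where
  W : Fin (suc a) → Bool
  W = initial (suc b)
  c : ℕ
  c = count (K (suc a)) (within W)
  eq₁ : ∀ c → 4 * c ≡ 2 * (c + c)
  eq₁ = solve-∀
  2c≡ : c + c ≡ suc b * b
  2c≡ = +-cancelʳ-≡ (suc b) _ _ (trans
    (subst (λ s → c + c + s ≡ s * s) (size-initial {suc a} (suc b) (s≤s b≤a)) (within-K W))
    (trans (*-suc (suc b) b) (+-comm (suc b) (suc b * b))))

-- Graphs that cannot be halved

∣-∣≤1⇒≡ : ∀ a b k → a + b ≡ 2 * k → ∣ a - b ∣ ≤ 1 → a ≡ b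
∣-∣≤1⇒≡ a b k a+b≡2k ∣a-b∣≤1 with ∣ a - b ∣ in eq
... | zero = ∣m-n∣≡0⇒m≡n eq
... | suc zero = [ (λ a≤b → contradiction (odd-sum a b a+b≡2k a≤b eq) λ ())
                 , (λ b≤a → contradiction (odd-sum b a (trans (+-comm b a) a+b≡2k) b≤a (trans (∣-∣-comm b a) eq)) λ ()) ]′ (≤-total a b)
  where
  odd-sum : ∀ a b → a + b ≡ 2 * k → a ≤ b → ∣ a - b ∣ ≡ 1 → ⊥
  odd-sum a b a+b≡ a≤b dist = even≢odd k a (trans (sym a+b≡) (trans (cong (a +_) b≡) (trans (+-suc a a) (cong (λ y → suc (a + y)) (sym (+-identityʳ a))))))
    where
    b≡ : b ≡ suc a
    b≡ = trans (sym (m∸n+n≡m a≤b)) (cong (_+ a) (trans (sym (m≤n⇒∣m-n∣≡n∸m a≤b)) dist))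
... | suc (suc _) = contradiction ∣a-b∣≤1 λ { (s≤s ()) }

-- A cut of a 4-regular graph is even, while half of its edges are k.
odd-unhalved : ∀ {k} .{{_ : NonZero k}} {D} (G : Graph k) → Circulant G D → length D ≡ 4 → Odd k →
  ∀ W → ¬ Halved G (crossing W)
odd-unhalved {k} {D} G circ ∣D∣≡4 (e , k≡) W half = even≢odd (2 * s) (e + i) (begin
  2 * (2 * s)             ≡⟨ eq₁ s ⟩
  s * 4                   ≡⟨ cong (s *_) ∣D∣≡4 ⟨
  s * length D            ≡⟨ crossing+2within-regular {G = G} {D = D} circ W ⟨
  x + (i + i)             ≡⟨ cong (_+ (i + i)) (trans x≡k k≡) ⟩
  suc (2 * e) + (i + i)   ≡⟨ eq₂ e i ⟩
  suc (2 * (e + i))       ∎)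
  where
  open ≡-Reasoning
  x y i s : ℕ
  x = count G (crossing W)
  y = count G (λ u v → not (crossing W u v))
  i = count G (within W)
  s = ∑[ u ∈ allFin k ] bit (W u)
  eq₁ : ∀ s → 2 * (2 * s) ≡ s * 4
  eq₁ = solve-∀
  eq₂ : ∀ e i → suc (2 * e) + (i + i) ≡ suc (2 * (e + i))
  eq₂ = solve-∀
  x+y≡2k : x + y ≡ 2 * k
  x+y≡2k = *-cancelˡ-≡ _ _ 2 (begin
    2 * (x + y)                               ≡⟨ cong (2 *_) (count-complement G (crossing W)) ⟩
    2 * length (edges G)                      ≡⟨ cong (length (edges G) +_) (+-identityʳ _) ⟩
    length (edges G) + length (edges G)       ≡⟨ 2size {G = G} {D = D} circ ⟩
    k * length D                              ≡⟨ cong (k *_) ∣D∣≡4 ⟩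
    k * 4                                     ≡⟨ eq₁ k ⟨
    2 * (2 * k)                               ∎)
  x≡y : x ≡ y
  x≡y = ∣-∣≤1⇒≡ x y k x+y≡2k half
  x≡k : x ≡ k
  x≡k = *-cancelˡ-≡ _ _ 2 (trans (cong (x +_) (trans (+-identityʳ x) x≡y)) x+y≡2k)

∀-Bool? : {P : Bool → Set} → (∀ b → Dec (P b)) → Dec (∀ b → P b)
∀-Bool? P? = map′ (λ { (t , f) true → t ; (t , f) false → f }) (λ p → p true , p false) (P? true ×-dec P? false)

∀-subset? : ∀ k {P : Vec Bool k → Set} → (∀ bs → Dec (P bs)) → Dec (∀ bs → P bs)
∀-subset? zero    P? = map′ (λ { p Vec.[] → p }) (λ p → p Vec.[]) (P? Vec.[])
∀-subset? (suc k) P? = map′ (λ { p (b Vec.∷ bs) → p b bs }) (λ p b bs → p (b Vec.∷ bs))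
  (∀-Bool? λ b → ∀-subset? k λ bs → P? (b Vec.∷ bs))

halved? : ∀ {k} (G : Graph k) P → Dec (Halved G P)
halved? G P = ∣ count G P - count G (λ u v → not (P u v)) ∣ ≤? 1

-- The exhaustive search runs over vectors. A function `W` agrees pointwise with its table, and the
-- edge counts depend on its values only.
unhalved-from-vec : ∀ {k} (G : Graph k) → (∀ bs → ¬ Halved G (within (Vec.lookup bs))) → ∀ W → ¬ Halved G (within W)
unhalved-from-vec G none W half = none (Vec.tabulate W) (subst₂ (λ x y → ∣ x - y ∣ ≤ 1)
  (count-cong G (λ {u} {v} _ → same u v)) (count-cong G (λ {u} {v} _ → cong not (same u v))) half)
  where
  same : ∀ u v → within W u v ≡ within (Vec.lookup (Vec.tabulate W)) u v
  same u v = sym (cong₂ _∧_ (Vec.lookup∘tabulate W u) (Vec.lookup∘tabulate W v))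

module Crossing = Obstruction crossing (λ W u v → Bool.xor-comm (W u) (W v)) (λ _ _ _ _ → refl)
module Within = Obstruction within (λ W u v → Bool.∧-comm (W u) (W v)) (λ _ _ _ _ → refl)

-- C₆,₂ = C₆,₄ is the octahedron: among its 64 sets of vertices none induces 6 of the 12 edges.
octahedron-unbalanceable : ∀ ℓ (k>3 : 6 > 3) (2≤ℓ : 2 ≤ ℓ) (ℓ≤4 : ℓ ≤ 4) → ℓ ≡ 2 ⊎ ℓ ≡ 4 →
  ¬ Balanceable (chordedCycle 6 ℓ k>3 2≤ℓ ℓ≤4)
octahedron-unbalanceable ℓ k>3 2≤ℓ ℓ≤4 (inj₁ refl) =
  Within.unbalanceable G balanced-cliques (unhalved-from-vec G (from-yes (∀-subset? 6 λ bs → ¬? (halved? G (within (Vec.lookup bs))))))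
  where
  G : Graph 6
  G = chordedCycle 6 2 k>3 2≤ℓ ℓ≤4
octahedron-unbalanceable ℓ k>3 2≤ℓ ℓ≤4 (inj₂ refl) =
  Within.unbalanceable G balanced-cliques (unhalved-from-vec G (from-yes (∀-subset? 6 λ bs → ¬? (halved? G (within (Vec.lookup bs))))))
  where
  G : Graph 6
  G = chordedCycle 6 4 k>3 2≤ℓ ℓ≤4

theorem11 : (k ℓ : ℕ) (k>3 : k > 3) (2≤ℓ : 2 ≤ ℓ) (ℓ≤k-2 : ℓ ≤ k ∸ 2) →
    Balanceable (chordedCycle k ℓ k>3 2≤ℓ ℓ≤k-2) ⇔
    (2 ∣ k × (k , ℓ) ∉ (6 , 2) ∷ (6 , 4) ∷ [])
theorem11 k@(suc k′) ℓ k>3 2≤ℓ ℓ≤k-2 = mk⇔ necessary sufficient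
  where
  G : Graph k
  G = chordedCycle k ℓ k>3 2≤ℓ ℓ≤k-2

  ℓ′ : ℕ
  ℓ′ = k ∸ ℓ

  ℓ+ℓ′≡k : ℓ + ℓ′ ≡ k
  ℓ+ℓ′≡k = m+[n∸m]≡n (≤-trans ℓ≤k-2 (m∸n≤m k 2))

  2≤ℓ′ : 2 ≤ ℓ′
  2≤ℓ′ = m+n≤o⇒m≤o∸n 2 (≤-trans (+-monoʳ-≤ 2 ℓ≤k-2) (≤-reflexive (m+[n∸m]≡n (≤-trans (s≤s (s≤s z≤n)) k>3))))

  necessary : Balanceable G → 2 ∣ k × (k , ℓ) ∉ (6 , 2) ∷ (6 , 4) ∷ []
  necessary bal = even-order (even⊎odd k) , ordinary
    where
    even-order : ∃[ a ] (k ≡ 2 * a ⊎ k ≡ suc (2 * a)) → 2 ∣ k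
    even-order (a , inj₁ k≡2a) = divides a (trans k≡2a (*-comm 2 a))
    even-order (a , inj₂ k≡)   = contradiction bal (Crossing.unbalanceable G balanced-cuts
      (odd-unhalved {D = 1 ∷ k′ ∷ ℓ ∷ ℓ′ ∷ []} G (circulant₄ k ℓ k>3 2≤ℓ ℓ≤k-2 refl ℓ+ℓ′≡k ℓ≢ℓ′) refl (a , k≡)))
      where
      ℓ≢ℓ′ : ℓ ≢ ℓ′
      ℓ≢ℓ′ ℓ≡ℓ′ = even≢odd ℓ a (trans (cong (ℓ +_) (trans (+-identityʳ ℓ) ℓ≡ℓ′)) (trans ℓ+ℓ′≡k k≡))
    ordinary : (k , ℓ) ∉ (6 , 2) ∷ (6 , 4) ∷ []
    ordinary (here refl)         = octahedron-unbalanceable ℓ k>3 2≤ℓ ℓ≤k-2 (inj₁ refl) bal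
    ordinary (there (here refl)) = octahedron-unbalanceable ℓ k>3 2≤ℓ ℓ≤k-2 (inj₂ refl) bal

  sufficient : 2 ∣ k × (k , ℓ) ∉ (6 , 2) ∷ (6 , 4) ∷ [] → Balanceable G
  sufficient (divides j k≡j2 , ordinary) with <-cmp ℓ ℓ′
  ... | tri< ℓ<ℓ′ ℓ≢ℓ′ _ = balanceable₄ j ℓ ℓ′ G ℓ+ℓ′≡k 2j≡k 2≤ℓ ℓ<ℓ′
    (λ (ℓ≡2 , ℓ′≡4) → ordinary (here (cong₂ _,_ (trans (sym ℓ+ℓ′≡k) (cong₂ _+_ ℓ≡2 ℓ′≡4)) ℓ≡2)))
    (circulant₄ k ℓ k>3 2≤ℓ ℓ≤k-2 refl ℓ+ℓ′≡k ℓ≢ℓ′)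
    where
    2j≡k : 2 * j ≡ k
    2j≡k = trans (*-comm 2 j) (sym k≡j2)
  ... | tri≈ _ ℓ≡ℓ′ _ = balanceable₃ j ℓ G (trans (cong (ℓ +_) ℓ≡ℓ′) ℓ+ℓ′≡k) (trans (*-comm 2 j) (sym k≡j2)) 2≤ℓ
    (circulant₃ k ℓ k>3 2≤ℓ ℓ≤k-2 refl ℓ+ℓ′≡k ℓ≡ℓ′)
  -- C_{k,ℓ} = C_{k,k-ℓ}: the graph stays as it is, and only the two chord steps in its list are
  -- exchanged.
  ... | tri> _ ℓ≢ℓ′ ℓ′<ℓ = balanceable₄ j ℓ′ ℓ G (trans (+-comm ℓ′ ℓ) ℓ+ℓ′≡k) (trans (*-comm 2 j) (sym k≡j2)) 2≤ℓ′ ℓ′<ℓ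
    (λ (ℓ′≡2 , ℓ≡4) → ordinary (there (here (cong₂ _,_ (trans (sym ℓ+ℓ′≡k) (cong₂ _+_ ℓ≡4 ℓ′≡2)) ℓ≡4))))
    (λ u f → trans (circulant₄ k ℓ k>3 2≤ℓ ℓ≤k-2 refl ℓ+ℓ′≡k ℓ≢ℓ′ u f)
      (swap-chords (f (shift 1 u)) (f (shift k′ u)) (f (shift ℓ u)) (f (shift ℓ′ u))))
    where
    swap-chords : ∀ a b c d → a + (b + (c + (d + 0))) ≡ a + (b + (d + (c + 0)))
    swap-chords = solve-∀
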